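{- Let $X$ be independent of $q$. Then $$U_2\left(\frac{f_2 f_6}{f_1 f_3}\,(qX,\,q^2/X,\,q^2X,\,q/X;\,q^3)_\infty\right) = \left(\frac{f_2 f_6}{f_1 f_3}\,(qX,\,q^2/X,\,q^2X,\,q/X;\,q^3)_\infty\right)^2 .$$
   Context: All series are power series in $q$ whose coefficients do not depend on $q$; with $X$ an (invertible) parameter independent of $q$, they may be read as elements of $\mathbb{Z}[X,X^{ -1}][[q]]$. The $q$-Pochhammer symbol is $(a;q)_\infty := \prod_{k\ge 0}(1-aq^k)$, so that $(a;q^m)_\infty=\prod_{k\ge 0}(1-aq^{mk})$, and $(a_1,a_2,\ldots,a_r;q^m)_\infty := \prod_{j=1}^r (a_j;q^m)_\infty$. For a positive integer $i$, $f_i := (q^i;q^i)_\infty=\prod_{k\ge 1}(1-q^{ik})$. For a positive integer $m$, the unitizing operator of degree $m$ acts on power series in $q$ by $U_m\left(\sum_{n\ge 0} a_n q^n\right) := \sum_{n\ge 0} a_{mn} q^n$, where the coefficients $a_n$ are independent of $q$. -}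

module Defs where

open import Algebra.Bundles using (CommutativeRing)
import Algebra.Properties.Monoid.Sum as Sum
import Algebra.Properties.Ring as RingProperties
open import Data.Bool.Base using (true; false; if_then_else_)
open import Data.Fin.Base using (Fin; zero; suc; toℕ)
open import Data.Fin.Properties using (toℕ<n)
open import Data.List.Base using (List; foldr; map)
open import Data.Nat.Base as ℕ using (ℕ; zero; suc; _∸_; NonZero; s≤s)
open import Data.Nat.Properties as ℕₚ using (_≟_)
open import Data.Vec.Functional using (Vector; []; _∷_)
open import Relation.Binary.PropositionalEquality.Core as ≡ using (_≡_; _≢_)
open import Relation.Nullary.Decidable using (does; dec-false)

-- Formal power series in q over a commutative ring R of coefficients.  A
-- parameter independent of q is an element of R; the universal choice for one
-- invertible parameter X is R = ℤ[X, X⁻¹].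
module PowerSeries {c ℓ} (R : CommutativeRing c ℓ) where

  open CommutativeRing R hiding (zero)
  open Sum +-monoid using (sum; sum⁺-syntax; sum-cong-≋; sum-replicate-zero)

  PowerSeries : Set c
  PowerSeries = ℕ → Carrier

  infix  4 _≋_
  infixl 6 _⊖_
  infixl 7 _⊛_ _⊘_
  infix  8 _q^_
  infix  9 _⁻¹

  _≋_ : PowerSeries → PowerSeries → Set ℓ
  a ≋ b = ∀ n → a n ≈ b n

  _q^_ : Carrier → ℕ → PowerSeries
  (x q^ k) n = if does (n ≟ k) then x else 0#

  𝟙 : PowerSeries
  𝟙 = 1# q^ 0

  _⊖_ : PowerSeries → PowerSeries → PowerSeries
  (a ⊖ b) n = a n - b n

  _⊛_ : PowerSeries → PowerSeries → PowerSeries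
  (a ⊛ b) n = ∑[ i ≤ n ] (a (toℕ i) * b (n ∸ toℕ i))

  -- The list bₙ, …, b₁, b₀ of the coefficients of b = 1 / a, where a₀ = 1:
  -- b₀ = 1 and bₙ₊₁ = - (a₁ bₙ + a₂ bₙ₋₁ + … + aₙ₊₁ b₀).
  inverseCoeffs : PowerSeries → ∀ n → Vector Carrier (suc n)
  inverseCoeffs a zero    = 1# ∷ []
  inverseCoeffs a (suc n) =
    (- (∑[ i ≤ n ] (a (suc (toℕ i)) * inverseCoeffs a n i))) ∷ inverseCoeffs a n

  -- Meaningful only when the constant coefficient of a is 1; see ⁻¹-inverseʳ.
  _⁻¹ : PowerSeries → PowerSeries
  (a ⁻¹) n = inverseCoeffs a n zero

  _⊘_ : PowerSeries → PowerSeries → PowerSeries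
  a ⊘ b = a ⊛ b ⁻¹

  -- ∏_{k < N} (1 - a q^{mk})
  partialPochhammer : PowerSeries → ℕ → ℕ → PowerSeries
  partialPochhammer a m zero    = 𝟙
  partialPochhammer a m (suc N) =
    partialPochhammer a m N ⊛ (𝟙 ⊖ a ⊛ 1# q^ (m ℕ.* N))

  -- (a; q^m)_∞.  As m ≥ 1, the factors with k > n do not affect the coefficient
  -- of q^n, so the coefficients of the partial products are eventually
  -- constant; see partialPochhammer-stable.
  ⟨_⨾q^_⟩∞ : PowerSeries → (m : ℕ) → .{{_ : NonZero m}} → PowerSeries
  ⟨ a ⨾q^ m ⟩∞ n = partialPochhammer a m (suc n) n

  -- (a₁, …, aᵣ; q^m)_∞
  ⟪_⨾q^_⟫∞ : List PowerSeries → (m : ℕ) → .{{_ : NonZero m}} → PowerSeries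
  ⟪ as ⨾q^ m ⟫∞ = foldr _⊛_ 𝟙 (map (λ a → ⟨ a ⨾q^ m ⟩∞) as)

  f : (i : ℕ) → .{{_ : NonZero i}} → PowerSeries
  f i = ⟨ 1# q^ i ⨾q^ i ⟩∞

  U : (m : ℕ) → .{{_ : NonZero m}} → PowerSeries → PowerSeries
  U m a n = a (m ℕ.* n)


  private
    open import Relation.Binary.Reasoning.Setoid setoid
    open RingProperties ring using (-0#≈0#)

    sum-zero : ∀ {n} (t : Vector Carrier n) → (∀ i → t i ≈ 0#) → sum t ≈ 0#
    sum-zero {n} t t≈0 = trans (sum-cong-≋ t≈0) (sum-replicate-zero n)

    q^-off : ∀ x {k n} → n ≢ k → (x q^ k) n ≈ 0#
    q^-off x {k} {n} n≢k rewrite dec-false (n ≟ k) n≢k = refl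

    ⊛-q^-low : ∀ a x {k n} → n ℕ.< k → (a ⊛ x q^ k) n ≈ 0#
    ⊛-q^-low a x {k} {n} n<k = sum-zero {suc n} _ λ i →
      trans (*-congˡ {a (toℕ i)} (q^-off x (ℕₚ.<⇒≢ (ℕₚ.≤-<-trans (ℕₚ.m∸n≤m n (toℕ i)) n<k))))
            (zeroʳ _)

    sum-last : ∀ n (h : ℕ → ℕ → Carrier) →
               (∀ i j → h i (suc j) ≈ 0#) →
               ∑[ i ≤ n ] h (toℕ i) (n ∸ toℕ i) ≈ h n 0
    sum-last zero    h h≈0 = +-identityʳ _
    sum-last (suc n) h h≈0 =
      trans (+-cong (h≈0 0 n) (sum-last n (λ i → h (suc i)) (λ i → h≈0 (suc i))))
            (+-identityˡ _)

    ⊛-identityʳ : ∀ a n → (a ⊛ 𝟙) n ≈ a n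
    ⊛-identityʳ a n =
      trans (sum-last n (λ i j → a i * 𝟙 j) (λ i j → zeroʳ _)) (*-identityʳ _)

    factor-low : ∀ a {k n} → n ℕ.< k → (𝟙 ⊖ a ⊛ 1# q^ k) n ≈ 𝟙 n
    factor-low a n<k =
      trans (+-congˡ (trans (-‿cong (⊛-q^-low a 1# n<k)) -0#≈0#)) (+-identityʳ _)

    partialPochhammer-step : ∀ a m .{{_ : NonZero m}} {n N} → n ℕ.< N →
      partialPochhammer a m (suc N) n ≈ partialPochhammer a m N n
    partialPochhammer-step a m {n} {N} n<N = trans
      (sum-cong-≋ {suc n} λ i → *-congˡ {partialPochhammer a m N (toℕ i)}
        (factor-low a (ℕₚ.≤-<-trans (ℕₚ.m∸n≤m n (toℕ i)) (ℕₚ.<-≤-trans n<N (ℕₚ.m≤n*m N m)))))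
      (⊛-identityʳ (partialPochhammer a m N) n)

    inverseCoeffs-lookup : ∀ a n (i : Fin (suc n)) →
                           inverseCoeffs a n i ≡ (a ⁻¹) (n ∸ toℕ i)
    inverseCoeffs-lookup a zero    zero    = ≡.refl
    inverseCoeffs-lookup a (suc n) zero    = ≡.refl
    inverseCoeffs-lookup a (suc n) (suc i) = inverseCoeffs-lookup a n i

  partialPochhammer-stable : ∀ a m .{{_ : NonZero m}} {n N} → n ℕ.< N →
    partialPochhammer a m N n ≈ ⟨ a ⨾q^ m ⟩∞ n
  partialPochhammer-stable a m n<N = go (ℕₚ.≤⇒≤′ n<N)
    where
    go : ∀ {n N} → suc n ℕ.≤′ N → partialPochhammer a m N n ≈ ⟨ a ⨾q^ m ⟩∞ n
    go (ℕ.≤′-reflexive ≡.refl) = refl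
    go (ℕ.≤′-step n<′N)        =
      trans (partialPochhammer-step a m (ℕₚ.≤′⇒≤ n<′N)) (go n<′N)

  ⁻¹-inverseʳ : ∀ a → a 0 ≈ 1# → a ⊛ a ⁻¹ ≋ 𝟙
  ⁻¹-inverseʳ a a₀≈1 zero    =
    trans (+-identityʳ _) (trans (*-identityʳ _) a₀≈1)
  ⁻¹-inverseʳ a a₀≈1 (suc n) = begin
    a 0 * - s + ∑[ i ≤ n ] (a (suc (toℕ i)) * (a ⁻¹) (n ∸ toℕ i))
      ≈⟨ +-cong (trans (*-congʳ a₀≈1) (*-identityˡ _))
                (sum-cong-≋ {suc n} λ i →
                  *-congˡ {a (suc (toℕ i))} (reflexive (≡.sym (inverseCoeffs-lookup a n i)))) ⟩
    - s + s  ≈⟨ -‿inverseˡ s ⟩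
    0#       ∎
    where s = ∑[ i ≤ n ] (a (suc (toℕ i)) * inverseCoeffs a n i)

  f-constant : ∀ i .{{_ : NonZero i}} → f i 0 ≈ 1#
  f-constant i@(suc _) = begin
    1# * (1# - (0# * (1# q^ (i ℕ.* 0)) 0 + 0#)) + 0#  ≈⟨ +-identityʳ _ ⟩
    1# * (1# - (0# * (1# q^ (i ℕ.* 0)) 0 + 0#))       ≈⟨ *-identityˡ _ ⟩
    1# - (0# * (1# q^ (i ℕ.* 0)) 0 + 0#)
      ≈⟨ +-congˡ (-‿cong (trans (+-identityʳ _) (zeroˡ _))) ⟩
    1# - 0#                                           ≈⟨ +-congˡ -0#≈0# ⟩
    1# + 0#                                           ≈⟨ +-identityʳ _ ⟩
    1#                                                ∎

  f⊛f-constant : ∀ i j .{{_ : NonZero i}} .{{_ : NonZero j}} → (f i ⊛ f j) 0 ≈ 1#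
  f⊛f-constant i j =
    trans (+-identityʳ _) (trans (*-cong (f-constant i) (f-constant j)) (*-identityˡ _))

-- Write F(q) for the series in the statement and V for q ↦ q², so that
-- U₂ (V a · b) = a · U₂ b.  Comparing residues modulo 6 in the products, F / V F is,
-- up to a factor depending only on q², the product of ψ(q) ψ(q³) and the theta series
-- φX = ∑ (-X)^n q^{n²}, φ₃ = ∑ X^n q^{3n²}.  Hence only the even part of this fourfold
-- theta series is needed.  By the Jacobi triple product everything is a lattice sum, and
-- splitting ℤ² according to the parity of m - n dissects
--   ψ(q) ψ(q³) = ψ(q⁴) φ(q⁶) + q φ(q²) ψ(q¹²),
--   φX φ₃      = φ(-q⁴) S₀(q²) - q ψ(-q²) (S₊ + S₋)(q²).
-- The same splitting, applied to the two theta series in the numerator of F and to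
-- θ = (q³X², q³/X², q⁶; q⁶)_∞, expresses F θ through the same S₀ and S₊ + S₋, and the
-- coefficients agree by identities between eta quotients.
module Submission where

open import Defs
open import Algebra.Bundles using (CommutativeRing)
open import Algebra.Structures using (IsCommutativeRing)
import Algebra.Properties.AbelianGroup as AbelianGroupProperties
import Algebra.Properties.Ring as RingProperties
import Algebra.Solver.CommutativeMonoid as CommutativeMonoidSolver
open import Data.Integer.Base as ℤ using (ℤ; +_; -[1+_]; ∣_∣; 0ℤ; 1ℤ; -1ℤ)
open import Data.Integer.DivMod using (_/ℕ_; _%ℕ_; n%ℕd<d; a≡a%ℕn+[a/ℕn]*n)
import Data.Integer.Properties as ℤₚ
open import Data.Integer.Solver using (module +-*-Solver)
open import Data.List.Base using
  (List; []; _∷_; map; _++_; filter; cartesianProduct; upTo; applyUpTo)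
open import Data.List.Membership.Propositional using (_∈_)
import Data.List.Membership.Propositional.Properties as ∈
open import Data.List.Membership.Propositional.Properties.WithK using (unique∧set⇒bag)
open import Data.List.Relation.Binary.BagAndSetEquality using (∼bag⇒↭)
open import Data.List.Relation.Binary.Permutation.Propositional as Perm using (_↭_)
open import Data.List.Relation.Unary.All as All using (All)
import Data.List.Relation.Unary.AllPairs as AllPairs
open import Data.List.Relation.Unary.Any using (here; there)
open import Data.List.Relation.Unary.Unique.Propositional using (Unique)
import Data.List.Relation.Unary.Unique.Propositional.Properties as Unique
open import Data.Nat.Base as ℕ using (ℕ; zero; suc; NonZero; nonZero; _∸_)
import Data.Nat.Properties as ℕₚ
open import Data.Nat.Tactic.RingSolver using (solve-∀)
open import Data.Product.Base using (_,_; _×_)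
open import Data.Product.Properties using (×-≡,≡→≡)
open import Data.Sum.Base using (_⊎_; inj₁; inj₂; [_,_]′)
open import Function.Base using (_∘_; id; const)
open import Function.Bundles using (_↔_; Inverse; mk↔ₛ′; mk⇔)
import Relation.Binary.Reasoning.Setoid as SetoidReasoning
open import Relation.Binary.PropositionalEquality as ≡ using (_≡_; _≢_)
open import Relation.Nullary using (¬_; yes; no; contradiction)
open import Relation.Nullary.Decidable using (dec-false; dec-true)
open import Relation.Unary using (Decidable)

open +-*-Solver using (Polynomial; _:=_; _:+_; _:*_; :-_; con) renaming (solve to solveℤ)

-- The series φ₃ and θ are forced by the residues. The exponents of `B` are 1, 2 modulo 3. Modulo 6
-- the even ones among them make up `V B`, and the odd ones are 1 and 5, so residue 3 is missing
-- from (qX; q²)_∞. Supplying (q³X; q⁶)_∞ alone would leave a factor that is not a series in q².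
-- Supplying (-q³X; q⁶)_∞ as well turns it into (q⁶X²; q¹²)_∞, the dilation of (q³X²; q⁶)_∞. The
-- products with -X and -X⁻¹ form φ₃, and the undilated factors in X² and X⁻² form θ. The same θ
-- also carries the theta series in X² coming from the numerator to those in X⁴ coming from the
-- dissection of φX φ₃, so that both sides can be compared at all. The coefficient ring is arbitrary
-- and may have zero divisors. Hence quotients are cleared throughout, and only series with constant
-- coefficient 1 are cancelled.

module ℤGroup = AbelianGroupProperties ℤₚ.+-0-abelianGroup

-- The ring of formal power series and congruence modulo powers of q.

module PowerSeriesRing {c ℓ} (R : CommutativeRing c ℓ) where

  open CommutativeRing R hiding (zero)
  open PowerSeries R
  open RingProperties ring using (-0#≈0#)
  module ≈-Reasoning = SetoidReasoning setoid
  open import Algebra.Properties.CommutativeSemigroup +-commutativeSemigroup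
    using () renaming (interchange to +-interchange)

  infix  4 _≐_
  infixl 6 _⊕_
  infixl 7 _⊗_
  infix  8 ⊝_ _·q^_

  -- ≋ as a record, so that the series can be inferred from the equation.
  record _≐_ (a b : PowerSeries) : Set ℓ where
    constructor mk≐
    field at : a ≋ b
  open _≐_ public

  -- The convolution unfolds definitionally to `a 0 * b (suc n) + (tail a ⊛ b) n` at `suc n`. This
  -- makes induction on `n`, with `a` replaced by its tail, the natural proof of the ring laws.
  tail : PowerSeries → PowerSeries
  tail a n = a (suc n)

  ⊛-cong : ∀ {a a′ b b′} n → (∀ i → i ℕ.≤ n → a i ≈ a′ i) → (∀ i → i ℕ.≤ n → b i ≈ b′ i) →
           (a ⊛ b) n ≈ (a′ ⊛ b′) n
  ⊛-cong zero    a≈ b≈ = +-congʳ (*-cong (a≈ 0 ℕ.z≤n) (b≈ 0 ℕ.z≤n))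
  ⊛-cong (suc n) a≈ b≈ =
    +-cong (*-cong (a≈ 0 ℕ.z≤n) (b≈ (suc n) ℕₚ.≤-refl))
           (⊛-cong n (λ i i≤n → a≈ (suc i) (ℕ.s≤s i≤n)) (λ i i≤n → b≈ i (ℕₚ.m≤n⇒m≤1+n i≤n)))

  ⊛-distribʳ : ∀ a b c n → ((λ i → a i + b i) ⊛ c) n ≈ (a ⊛ c) n + (b ⊛ c) n
  ⊛-distribʳ a b c zero = let open ≈-Reasoning in begin
    (a 0 + b 0) * c 0 + 0#                ≈⟨ +-congˡ (+-identityˡ 0#) ⟨
    (a 0 + b 0) * c 0 + (0# + 0#)         ≈⟨ +-congʳ (distribʳ _ _ _) ⟩
    (a 0 * c 0 + b 0 * c 0) + (0# + 0#)   ≈⟨ +-interchange _ _ _ _ ⟩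
    (a 0 * c 0 + 0#) + (b 0 * c 0 + 0#)   ∎
  ⊛-distribʳ a b c (suc n) =
    trans (+-cong (distribʳ _ _ _) (⊛-distribʳ (tail a) (tail b) c n)) (+-interchange _ _ _ _)

  ⊛-scaleˡ : ∀ x a b n → ((λ i → x * a i) ⊛ b) n ≈ x * (a ⊛ b) n
  ⊛-scaleˡ x a b zero = let open ≈-Reasoning in begin
    x * a 0 * b 0 + 0#     ≈⟨ +-identityʳ _ ⟩
    x * a 0 * b 0          ≈⟨ *-assoc _ _ _ ⟩
    x * (a 0 * b 0)        ≈⟨ *-congˡ (+-identityʳ _) ⟨
    x * (a 0 * b 0 + 0#)   ∎
  ⊛-scaleˡ x a b (suc n) =
    trans (+-cong (*-assoc _ _ _) (⊛-scaleˡ x (tail a) b n)) (sym (distribˡ _ _ _))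

  ⊛-assoc : ∀ a b c n → ((a ⊛ b) ⊛ c) n ≈ (a ⊛ (b ⊛ c)) n
  ⊛-assoc a b c zero = +-congʳ (let open ≈-Reasoning in begin
    (a 0 * b 0 + 0#) * c 0   ≈⟨ *-congʳ (+-identityʳ _) ⟩
    a 0 * b 0 * c 0          ≈⟨ *-assoc _ _ _ ⟩
    a 0 * (b 0 * c 0)        ≈⟨ *-congˡ (+-identityʳ _) ⟨
    a 0 * (b 0 * c 0 + 0#)   ∎)
  ⊛-assoc a b c (suc n) = let open ≈-Reasoning in begin
    (a 0 * b 0 + 0#) * c (suc n) + ((λ i → a 0 * tail b i + (tail a ⊛ b) i) ⊛ c) n
      ≈⟨ +-cong (trans (*-congʳ (+-identityʳ _)) (*-assoc _ _ _))
                (trans (⊛-distribʳ (λ i → a 0 * tail b i) (tail a ⊛ b) c n)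
                       (+-cong (⊛-scaleˡ (a 0) (tail b) c n) (⊛-assoc (tail a) b c n))) ⟩
    a 0 * (b 0 * c (suc n)) + (a 0 * (tail b ⊛ c) n + (tail a ⊛ (b ⊛ c)) n)
      ≈⟨ +-assoc _ _ _ ⟨
    (a 0 * (b 0 * c (suc n)) + a 0 * (tail b ⊛ c) n) + (tail a ⊛ (b ⊛ c)) n
      ≈⟨ +-congʳ (distribˡ _ _ _) ⟨
    (a ⊛ (b ⊛ c)) (suc n) ∎

  -- Peeling off the last term complements the definitional peeling of the first; comparing the two
  -- gives commutativity.
  ⊛-last : ∀ a b n → (a ⊛ b) (suc n) ≈ (a ⊛ tail b) n + a (suc n) * b 0
  ⊛-last a b zero    = trans (+-congˡ (+-identityʳ _)) (+-congʳ (sym (+-identityʳ _)))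
  ⊛-last a b (suc n) = trans (+-congˡ (⊛-last (tail a) b n)) (sym (+-assoc _ _ _))

  ⊛-comm : ∀ a b n → (a ⊛ b) n ≈ (b ⊛ a) n
  ⊛-comm a b zero    = +-congʳ (*-comm _ _)
  ⊛-comm a b (suc n) = let open ≈-Reasoning in begin
    a 0 * b (suc n) + (tail a ⊛ b) n   ≈⟨ +-cong (*-comm _ _) (⊛-comm (tail a) b n) ⟩
    b (suc n) * a 0 + (b ⊛ tail a) n   ≈⟨ +-comm _ _ ⟩
    (b ⊛ tail a) n + b (suc n) * a 0   ≈⟨ ⊛-last b a n ⟨
    (b ⊛ a) (suc n)                    ∎

  ⊛-zeroˡ : ∀ {a} b → (∀ i → a i ≈ 0#) → ∀ n → (a ⊛ b) n ≈ 0#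
  ⊛-zeroˡ b a≈0 zero    = trans (+-identityʳ _) (trans (*-congʳ (a≈0 0)) (zeroˡ _))
  ⊛-zeroˡ b a≈0 (suc n) =
    trans (+-cong (trans (*-congʳ (a≈0 0)) (zeroˡ _)) (⊛-zeroˡ b (λ i → a≈0 (suc i)) n))
          (+-identityˡ _)

  ⊛-identityˡ : ∀ a n → (𝟙 ⊛ a) n ≈ a n
  ⊛-identityˡ a zero    = trans (+-identityʳ _) (*-identityˡ _)
  ⊛-identityˡ a (suc n) =
    trans (+-cong (*-identityˡ _) (⊛-zeroˡ a (λ _ → refl) n)) (+-identityʳ _)

  q^-on : ∀ x k → (x q^ k) k ≈ x
  q^-on x k rewrite dec-true (k ℕₚ.≟ k) ≡.refl = refl

  q^-off : ∀ x {k n} → n ≢ k → (x q^ k) n ≈ 0#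
  q^-off x {k} {n} n≢k rewrite dec-false (n ℕₚ.≟ k) n≢k = refl

  tail-q^ : ∀ x k n → (x q^ suc k) (suc n) ≈ (x q^ k) n
  tail-q^ x k n with n ℕₚ.≟ k
  ... | yes ≡.refl = trans (q^-on x (suc k)) (sym (q^-on x k))
  ... | no n≢k     = trans (q^-off x (λ p → n≢k (ℕₚ.suc-injective p))) (sym (q^-off x n≢k))

  ⊛-q^-step : ∀ x k a n → (x q^ suc k ⊛ a) (suc n) ≈ (x q^ k ⊛ a) n
  ⊛-q^-step x k a n =
    trans (+-cong (trans (*-congʳ (q^-off x {suc k} {zero} λ ())) (zeroˡ _))
                  (⊛-cong {b = a} n (λ i _ → tail-q^ x k i) (λ _ _ → refl)))
          (+-identityˡ _)

  ⊛-q^-0 : ∀ x a n → (x q^ 0 ⊛ a) n ≈ x * a n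
  ⊛-q^-0 x a zero    = +-identityʳ _
  ⊛-q^-0 x a (suc n) = trans (+-congˡ (⊛-zeroˡ a (λ _ → refl) n)) (+-identityʳ _)

  ⊛-q^-shift : ∀ x k a n → (x q^ k ⊛ a) (k ℕ.+ n) ≈ x * a n
  ⊛-q^-shift x zero    a n = ⊛-q^-0 x a n
  ⊛-q^-shift x (suc k) a n = trans (⊛-q^-step x k a (k ℕ.+ n)) (⊛-q^-shift x k a n)

  ⊛-q^-low : ∀ x k a {n} → n ℕ.< k → (x q^ k ⊛ a) n ≈ 0#
  ⊛-q^-low x (suc k) a {zero}  _ =
    trans (+-identityʳ _) (trans (*-congʳ (q^-off x {suc k} {zero} λ ())) (zeroˡ _))
  ⊛-q^-low x (suc k) a {suc n} (ℕ.s≤s n<k) = trans (⊛-q^-step x k a n) (⊛-q^-low x k a n<k)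

  ⊛-q^ : ∀ x j y k n → (x q^ j ⊛ y q^ k) n ≈ ((x * y) q^ (j ℕ.+ k)) n
  ⊛-q^ x zero y k n with n ℕₚ.≟ k
  ... | yes ≡.refl = trans (⊛-q^-0 x (y q^ k) n) (trans (*-congˡ (q^-on y k)) (sym (q^-on (x * y) k)))
  ... | no n≢k     = trans (⊛-q^-0 x (y q^ k) n)
                           (trans (*-congˡ (q^-off y n≢k)) (trans (zeroʳ x) (sym (q^-off (x * y) n≢k))))
  ⊛-q^ x (suc j) y k zero    =
    trans (⊛-q^-low x (suc j) (y q^ k) (ℕ.s≤s ℕ.z≤n)) (sym (q^-off (x * y) {suc j ℕ.+ k} {zero} λ ()))
  ⊛-q^ x (suc j) y k (suc n) =
    trans (⊛-q^-step x j (y q^ k) n) (trans (⊛-q^ x j y k n) (sym (tail-q^ (x * y) (j ℕ.+ k) n)))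

  -- The operations are made opaque: otherwise they unfold as soon as two series
  -- are compared, as these are functions.
  opaque

    _⊗_ : PowerSeries → PowerSeries → PowerSeries
    _⊗_ = _⊛_

    _⊕_ : PowerSeries → PowerSeries → PowerSeries
    (a ⊕ b) n = a n + b n

    ⊝_ : PowerSeries → PowerSeries
    (⊝ a) n = - a n

    𝟘 : PowerSeries
    𝟘 n = 0#

    _·q^_ : Carrier → ℕ → PowerSeries
    _·q^_ = _q^_

    𝟏 : PowerSeries
    𝟏 = 𝟙

  opaque
    unfolding _⊗_ _⊕_ ⊝_ 𝟘 𝟏 _·q^_

    ⊛≐⊗ : ∀ {a a′ b b′} → a ≐ a′ → b ≐ b′ → a ⊛ b ≐ a′ ⊗ b′
    ⊛≐⊗ p q = mk≐ λ n → ⊛-cong n (λ i _ → at p i) (λ i _ → at q i)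

    ⊖≐⊕⊝ : ∀ a b → a ⊖ b ≐ a ⊕ ⊝ b
    ⊖≐⊕⊝ a b = mk≐ λ n → refl

    q^≐·q^ : ∀ x k → x q^ k ≐ x ·q^ k
    q^≐·q^ x k = mk≐ λ n → refl

    𝟙≐𝟏 : 𝟙 ≐ 𝟏
    𝟙≐𝟏 = mk≐ λ n → refl

    𝟏≐·q^ : 𝟏 ≐ 1# ·q^ 0
    𝟏≐·q^ = mk≐ λ n → refl

    ⊗⊕-isCommutativeRing : IsCommutativeRing _≐_ _⊕_ _⊗_ ⊝_ 𝟘 𝟏
    ⊗⊕-isCommutativeRing = record
      { isRing = record
        { +-isAbelianGroup = record
          { isGroup = record
            { isMonoid = record
              { isSemigroup = record
                { isMagma = record
                  { isEquivalence = record
                    { refl  = mk≐ λ n → refl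
                    ; sym   = λ p → mk≐ λ n → sym (at p n)
                    ; trans = λ p q → mk≐ λ n → trans (at p n) (at q n) }
                  ; ∙-cong = λ p q → mk≐ λ n → +-cong (at p n) (at q n) }
                ; assoc = λ a b c → mk≐ λ n → +-assoc _ _ _ }
              ; identity = (λ a → mk≐ λ n → +-identityˡ _) , (λ a → mk≐ λ n → +-identityʳ _) }
            ; inverse = (λ a → mk≐ λ n → -‿inverseˡ _) , (λ a → mk≐ λ n → -‿inverseʳ _)
            ; ⁻¹-cong = λ p → mk≐ λ n → -‿cong (at p n) }
          ; comm = λ a b → mk≐ λ n → +-comm _ _ }
        ; *-cong = λ p q → mk≐ λ n → ⊛-cong n (λ i _ → at p i) (λ i _ → at q i)
        ; *-assoc = λ a b c → mk≐ (⊛-assoc a b c)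
        ; *-identity = (λ a → mk≐ (⊛-identityˡ a))
                     , (λ a → mk≐ λ n → trans (⊛-comm a 𝟙 n) (⊛-identityˡ a n))
        ; distrib = (λ a b c → mk≐ λ n →
                       trans (⊛-comm a (b ⊕ c) n)
                             (trans (⊛-distribʳ b c a n) (+-cong (⊛-comm b a n) (⊛-comm c a n))))
                  , (λ c a b → mk≐ (⊛-distribʳ a b c)) }
      ; *-comm = λ a b → mk≐ (⊛-comm a b) }

    ·q^-cong : ∀ {x y k l} → x ≈ y → k ≡ l → x ·q^ k ≐ y ·q^ l
    ·q^-cong {x} {y} {k} x≈y ≡.refl = mk≐ go
      where
      go : ∀ n → (x q^ k) n ≈ (y q^ k) n
      go n with n ℕₚ.≟ k
      ... | yes ≡.refl = trans (q^-on x k) (trans x≈y (sym (q^-on y k)))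
      ... | no n≢k     = trans (q^-off x n≢k) (sym (q^-off y n≢k))

    ⊗-·q^ : ∀ x j y k → x ·q^ j ⊗ y ·q^ k ≐ (x * y) ·q^ (j ℕ.+ k)
    ⊗-·q^ x j y k = mk≐ (⊛-q^ x j y k)

    ·q^-neg : ∀ x k → (- x) ·q^ k ≐ ⊝ (x ·q^ k)
    ·q^-neg x k = mk≐ go
      where
      go : ∀ n → ((- x) q^ k) n ≈ - (x q^ k) n
      go n with n ℕₚ.≟ k
      ... | yes ≡.refl = trans (q^-on (- x) k) (-‿cong (sym (q^-on x k)))
      ... | no n≢k     = trans (q^-off (- x) n≢k) (trans (sym -0#≈0#) (-‿cong (sym (q^-off x n≢k))))

  ring⟦q⟧ : CommutativeRing c ℓ
  ring⟦q⟧ = record { isCommutativeRing = ⊗⊕-isCommutativeRing }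

  module R⟦q⟧ = CommutativeRing ring⟦q⟧
  module ≐-Reasoning = SetoidReasoning R⟦q⟧.setoid

  infix 4 _≡_mod-q^_

  -- Stands in for convergence: approximants that agree with `a` modulo `q^N` for every `N`
  -- determine `a`, by `mod⇒≐`.
  record _≡_mod-q^_ (a b : PowerSeries) (N : ℕ) : Set ℓ where
    constructor mk-mod
    field below : ∀ {n} → n ℕ.< N → a n ≈ b n
  open _≡_mod-q^_ public

  module _ {N : ℕ} where

    mod-refl : ∀ {a} → a ≡ a mod-q^ N
    mod-refl = mk-mod λ _ → refl

    mod-sym : ∀ {a b} → a ≡ b mod-q^ N → b ≡ a mod-q^ N
    mod-sym p = mk-mod λ n<N → sym (below p n<N)

    mod-trans : ∀ {a b d} → a ≡ b mod-q^ N → b ≡ d mod-q^ N → a ≡ d mod-q^ N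
    mod-trans p q = mk-mod λ n<N → trans (below p n<N) (below q n<N)

    ≐⇒mod : ∀ {a b} → a ≐ b → a ≡ b mod-q^ N
    ≐⇒mod p = mk-mod λ _ → at p _

    opaque
      unfolding _⊗_ _⊕_

      ⊕-mod : ∀ {a a′ b b′} → a ≡ a′ mod-q^ N → b ≡ b′ mod-q^ N → a ⊕ b ≡ a′ ⊕ b′ mod-q^ N
      ⊕-mod p q = mk-mod λ n<N → +-cong (below p n<N) (below q n<N)

      ⊗-mod : ∀ {a a′ b b′} → a ≡ a′ mod-q^ N → b ≡ b′ mod-q^ N → a ⊗ b ≡ a′ ⊗ b′ mod-q^ N
      ⊗-mod p q = mk-mod λ {n} n<N → ⊛-cong n (λ i i≤n → below p (ℕₚ.≤-<-trans i≤n n<N))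
                                              (λ i i≤n → below q (ℕₚ.≤-<-trans i≤n n<N))

  mod⇒≐ : ∀ {a b} → (∀ N → a ≡ b mod-q^ N) → a ≐ b
  mod⇒≐ p = mk≐ λ n → below (p (suc n)) ℕₚ.≤-refl

  mod-weaken : ∀ {a b M N} → M ℕ.≤ N → a ≡ b mod-q^ N → a ≡ b mod-q^ M
  mod-weaken M≤N p = mk-mod λ n<M → below p (ℕₚ.<-≤-trans n<M M≤N)

  opaque
    unfolding _⊗_ _·q^_ 𝟘 𝟏

    -- A factor `q^k` raises the precision by `k`. In the triple product this makes up for the
    -- precision that a Gaussian binomial lacks near its ends.
    ·q^⊗-mod : ∀ x k {a b N} → a ≡ b mod-q^ N → x ·q^ k ⊗ a ≡ x ·q^ k ⊗ b mod-q^ (k ℕ.+ N)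
    ·q^⊗-mod x k {a} {b} {N} p = mk-mod go
      where
      go : ∀ {n} → n ℕ.< k ℕ.+ N → (x q^ k ⊛ a) n ≈ (x q^ k ⊛ b) n
      go {n} n<k+N with n ℕₚ.<? k
      ... | yes n<k = trans (⊛-q^-low x k a n<k) (sym (⊛-q^-low x k b n<k))
      ... | no n≮k
        with m , ≡.refl ← ℕₚ.m≤n⇒∃[o]m+o≡n (ℕₚ.≮⇒≥ n≮k) =
          trans (⊛-q^-shift x k a m)
                (trans (*-congˡ (below p (ℕₚ.+-cancelˡ-< k m N n<k+N))) (sym (⊛-q^-shift x k b m)))

    ·q^-mod-𝟘 : ∀ x {k N} → N ℕ.≤ k → x ·q^ k ≡ 𝟘 mod-q^ N
    ·q^-mod-𝟘 x {k} N≤k = mk-mod λ n<N → q^-off x {k} (ℕₚ.<⇒≢ (ℕₚ.<-≤-trans n<N N≤k))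

  -- Constant coefficient 1 is the case in which `⁻¹` is a true inverse, and it covers every product
  -- that has to be cancelled.
  record Unit (u : PowerSeries) : Set ℓ where
    constructor mk-unit
    field constant : u 0 ≈ 1#
  open Unit public

  opaque
    unfolding _⊗_ _⊕_ _·q^_ 𝟏

    ⊗-unit : ∀ {a b} → Unit a → Unit b → Unit (a ⊗ b)
    ⊗-unit a₀ b₀ = mk-unit (trans (+-identityʳ _)
                     (trans (*-cong (constant a₀) (constant b₀)) (*-identityˡ _)))

    𝟏-unit : Unit 𝟏
    𝟏-unit = mk-unit refl

    1+q-unit : ∀ x e .{{_ : NonZero e}} → Unit (𝟏 ⊕ x ·q^ e)
    1+q-unit x (suc e) = mk-unit (trans (+-congˡ (q^-off x {suc e} {0} λ ())) (+-identityʳ 1#))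

    unit-inverse : ∀ {u} → Unit u → u ⊗ u ⁻¹ ≐ 𝟏
    unit-inverse {u} u₀ = mk≐ (⁻¹-inverseʳ u (constant u₀))

  unit-≐ : ∀ {a b} → a ≐ b → Unit a → Unit b
  unit-≐ a≐b a₀ = mk-unit (trans (sym (at a≐b 0)) (constant a₀))

  module _ {u} (u₀ : Unit u) where

    unit-cancelˡ-mod : ∀ {a b N} → u ⊗ a ≡ u ⊗ b mod-q^ N → a ≡ b mod-q^ N
    unit-cancelˡ-mod p =
      mod-trans (mod-sym (≐⇒mod (retract _))) (mod-trans (⊗-mod mod-refl p) (≐⇒mod (retract _)))
      where
      retract : ∀ a → u ⁻¹ ⊗ (u ⊗ a) ≐ a
      retract a = let open ≐-Reasoning in begin
        u ⁻¹ ⊗ (u ⊗ a)   ≈⟨ R⟦q⟧.*-assoc _ _ _ ⟨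
        (u ⁻¹ ⊗ u) ⊗ a   ≈⟨ R⟦q⟧.*-congʳ (R⟦q⟧.trans (R⟦q⟧.*-comm _ _) (unit-inverse u₀)) ⟩
        𝟏 ⊗ a            ≈⟨ R⟦q⟧.*-identityˡ a ⟩
        a                ∎

    unit-cancelˡ : ∀ {a b} → u ⊗ a ≐ u ⊗ b → a ≐ b
    unit-cancelˡ p = mod⇒≐ λ N → unit-cancelˡ-mod (≐⇒mod p)

-- Dilation, even parts and infinite products.

module Products {c ℓ} (R : CommutativeRing c ℓ) where

  open CommutativeRing R hiding (zero)
  open PowerSeries R
  open PowerSeriesRing R
  open RingProperties ring using (-‿distribˡ-*; -‿involutive)
  open import Algebra.Properties.CommutativeSemigroup R⟦q⟧.*-commutativeSemigroup
    using () renaming (interchange to ⊗-interchange)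

  -- Dilation and even part

  -- The substitution q ↦ q². Recursion in steps of two makes the odd coefficients vanish by
  -- computation and fits the head and tail inductions used for `⊛`.
  dilate : PowerSeries → PowerSeries
  dilate a zero          = a 0
  dilate a (suc zero)    = 0#
  dilate a (suc (suc n)) = dilate (tail a) n

  dilate-cong : ∀ {a b} n → (∀ i → i ℕ.≤ n → a i ≈ b i) → dilate a n ≈ dilate b n
  dilate-cong zero          p = p 0 ℕ.z≤n
  dilate-cong (suc zero)    p = refl
  dilate-cong (suc (suc n)) p =
    dilate-cong n (λ i i≤n → p (suc i) (ℕ.s≤s (ℕₚ.m≤n⇒m≤1+n i≤n)))

  dilate-even : ∀ a n → dilate a (2 ℕ.* n) ≈ a n
  dilate-even a zero = refl
  dilate-even a (suc n) rewrite ℕₚ.+-suc n (n ℕ.+ 0) = dilate-even (tail a) n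

  dilate-linear : ∀ x a b n → dilate (λ i → x * a i + b i) n ≈ x * dilate a n + dilate b n
  dilate-linear x a b zero          = refl
  dilate-linear x a b (suc zero)    = sym (trans (+-identityʳ _) (zeroʳ x))
  dilate-linear x a b (suc (suc n)) = dilate-linear x (tail a) (tail b) n

  dilate-zero : ∀ {a} → (∀ i → a i ≈ 0#) → ∀ n → dilate a n ≈ 0#
  dilate-zero p zero          = p 0
  dilate-zero p (suc zero)    = refl
  dilate-zero p (suc (suc n)) = dilate-zero (λ i → p (suc i)) n

  dilate-⊛ : ∀ a b n → dilate (a ⊛ b) n ≈ (dilate a ⊛ dilate b) n
  dilate-⊛ a b zero       = refl
  dilate-⊛ a b (suc zero) =
    sym (trans (+-cong (zeroʳ _) (trans (+-identityʳ _) (zeroˡ _))) (+-identityˡ _))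
  dilate-⊛ a b (suc (suc n)) = let open ≈-Reasoning in begin
    dilate (λ i → a 0 * tail b i + (tail a ⊛ b) i) n
      ≈⟨ dilate-linear (a 0) (tail b) (tail a ⊛ b) n ⟩
    a 0 * dilate (tail b) n + dilate (tail a ⊛ b) n
      ≈⟨ +-congˡ (dilate-⊛ (tail a) b n) ⟩
    a 0 * dilate (tail b) n + (dilate (tail a) ⊛ dilate b) n
      ≈⟨ +-congˡ (trans (+-congʳ (zeroˡ _)) (+-identityˡ _)) ⟨
    (dilate a ⊛ dilate b) (suc (suc n)) ∎

  dilate-q^ : ∀ x k n → dilate (x q^ k) n ≈ (x q^ (2 ℕ.* k)) n
  dilate-q^ x k zero with k
  ... | zero  = refl
  ... | suc _ = refl
  dilate-q^ x zero (suc zero) = refl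
  dilate-q^ x (suc k) (suc zero) rewrite ℕₚ.+-suc k (k ℕ.+ 0) = refl
  dilate-q^ x zero (suc (suc n)) = dilate-zero (λ i → refl) n
  dilate-q^ x (suc k) (suc (suc n)) rewrite ℕₚ.+-suc k (k ℕ.+ 0) =
    trans (dilate-cong {tail (x q^ suc k)} {x q^ k} n (λ i _ → tail-q^ x k i))
      (trans (dilate-q^ x k n)
        (sym (trans (tail-q^ x (suc (2 ℕ.* k)) (suc n)) (tail-q^ x (2 ℕ.* k) n))))

  -- In an even coefficient of the product, the even coefficients of `dilate a` meet only even
  -- coefficients of `b`; the odd ones are 0.
  U₂-dilate-⊛ : ∀ a b n → (dilate a ⊛ b) (2 ℕ.* n) ≈ (a ⊛ U 2 b) n
  U₂-dilate-⊛ a b zero = refl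
  U₂-dilate-⊛ a b (suc n) = trans (reflexive (≡.cong (dilate a ⊛ b) (ℕₚ.*-suc 2 n)))
    (+-cong (*-congˡ (reflexive (≡.cong b (≡.sym (ℕₚ.*-suc 2 n)))))
      (trans (+-congʳ (zeroˡ _)) (trans (+-identityˡ _) (U₂-dilate-⊛ (tail a) b n))))

  dilate-odd : ∀ a n → dilate a (suc (2 ℕ.* n)) ≈ 0#
  dilate-odd a zero = refl
  dilate-odd a (suc n) rewrite ℕₚ.+-suc n (n ℕ.+ 0) = dilate-odd (tail a) n

  U₂-q⊛dilate : ∀ x a n → (x q^ 1 ⊛ dilate a) (2 ℕ.* n) ≈ 0#
  U₂-q⊛dilate x a zero    = ⊛-q^-low x 1 (dilate a) (ℕ.s≤s ℕ.z≤n)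
  U₂-q⊛dilate x a (suc n) =
    trans (reflexive (≡.cong (x q^ 1 ⊛ dilate a) (ℕₚ.*-suc 2 n)))
      (trans (⊛-q^-shift x 1 (dilate a) (suc (2 ℕ.* n)))
        (trans (*-congˡ (dilate-odd a n)) (zeroʳ x)))

  opaque

    V : PowerSeries → PowerSeries
    V = dilate

    U₂ : PowerSeries → PowerSeries
    U₂ = U 2

  opaque
    unfolding V U₂ _⊗_ _⊕_ ⊝_ _·q^_ 𝟏 𝟘

    U₂-at : ∀ a n → U₂ a n ≡ U 2 a n
    U₂-at a n = ≡.refl

    V-cong : ∀ {a b} → a ≐ b → V a ≐ V b
    V-cong p = mk≐ λ n → dilate-cong n (λ i _ → at p i)

    V-mod : ∀ {a b N} → a ≡ b mod-q^ N → V a ≡ V b mod-q^ N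
    V-mod p = mk-mod λ {n} n<N → dilate-cong n (λ i i≤n → below p (ℕₚ.≤-<-trans i≤n n<N))

    V-⊗ : ∀ a b → V (a ⊗ b) ≐ V a ⊗ V b
    V-⊗ a b = mk≐ (dilate-⊛ a b)

    V-⊕ : ∀ a b → V (a ⊕ b) ≐ V a ⊕ V b
    V-⊕ a b = mk≐ λ n → trans (dilate-cong n (λ i _ → +-congʳ (sym (*-identityˡ (a i)))))
                          (trans (dilate-linear 1# a b n) (+-congʳ (*-identityˡ _)))

    V-𝟘 : V 𝟘 ≐ 𝟘
    V-𝟘 = mk≐ (dilate-zero (λ _ → refl))

    V-·q^ : ∀ x k → V (x ·q^ k) ≐ x ·q^ (2 ℕ.* k)
    V-·q^ x k = mk≐ (dilate-q^ x k)

    U₂-cong : ∀ {a b} → a ≐ b → U₂ a ≐ U₂ b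
    U₂-cong p = mk≐ λ n → at p (2 ℕ.* n)

    U₂-⊕ : ∀ a b → U₂ (a ⊕ b) ≐ U₂ a ⊕ U₂ b
    U₂-⊕ a b = mk≐ λ n → refl

    U₂-V⊗ : ∀ a b → U₂ (V a ⊗ b) ≐ a ⊗ U₂ b
    U₂-V⊗ a b = mk≐ (U₂-dilate-⊛ a b)

    U₂-V : ∀ a → U₂ (V a) ≐ a
    U₂-V a = mk≐ (dilate-even a)

    U₂-qV : ∀ x a → U₂ (x ·q^ 1 ⊗ V a) ≐ 𝟘
    U₂-qV x a = mk≐ (U₂-q⊛dilate x a)

  -- Infinite products

  poch : Carrier → ℕ → ℕ → ℕ → PowerSeries
  poch x k m zero    = 𝟏
  poch x k m (suc N) = poch x k m N ⊗ (𝟏 ⊕ (- x) ·q^ (k ℕ.+ m ℕ.* N))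

  opaque

    Poch : Carrier → ℕ → (m : ℕ) → .{{NonZero m}} → PowerSeries
    Poch x k m = ⟨ x q^ k ⨾q^ m ⟩∞

  opaque
    unfolding Poch

    ⟨⟩∞≐Poch : ∀ x k m .{{_ : NonZero m}} → ⟨ x q^ k ⨾q^ m ⟩∞ ≐ Poch x k m
    ⟨⟩∞≐Poch x k m = R⟦q⟧.refl

    partialPochhammer-monomial : ∀ x k m N → partialPochhammer (x q^ k) m N ≐ poch x k m N
    partialPochhammer-monomial x k m zero    = 𝟙≐𝟏
    partialPochhammer-monomial x k m (suc N) =
      ⊛≐⊗ (partialPochhammer-monomial x k m N) (let open ≐-Reasoning in begin
        𝟙 ⊖ x q^ k ⊛ 1# q^ (m ℕ.* N)
          ≈⟨ ⊖≐⊕⊝ _ _ ⟩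
        𝟙 ⊕ ⊝ (x q^ k ⊛ 1# q^ (m ℕ.* N))
          ≈⟨ R⟦q⟧.+-cong 𝟙≐𝟏 (R⟦q⟧.-‿cong (⊛≐⊗ (q^≐·q^ x k) (q^≐·q^ 1# (m ℕ.* N)))) ⟩
        𝟏 ⊕ ⊝ (x ·q^ k ⊗ 1# ·q^ (m ℕ.* N))
          ≈⟨ R⟦q⟧.+-congˡ (R⟦q⟧.-‿cong
               (R⟦q⟧.trans (⊗-·q^ _ _ _ _) (·q^-cong (*-identityʳ x) ≡.refl))) ⟩
        𝟏 ⊕ ⊝ (x ·q^ (k ℕ.+ m ℕ.* N))
          ≈⟨ R⟦q⟧.+-congˡ (·q^-neg _ _) ⟨
        𝟏 ⊕ (- x) ·q^ (k ℕ.+ m ℕ.* N) ∎)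

    poch-limit : ∀ x k m .{{_ : NonZero m}} N → poch x k m N ≡ Poch x k m mod-q^ N
    poch-limit x k m N = mk-mod λ {n} n<N →
      trans (sym (at (partialPochhammer-monomial x k m N) n))
            (partialPochhammer-stable (x q^ k) m n<N)

  poch-cong : ∀ {x y k l m n} N → x ≈ y → k ≡ l → m ≡ n → poch x k m N ≐ poch y l n N
  poch-cong zero    x≈y k≡l m≡n = R⟦q⟧.refl
  poch-cong (suc N) x≈y ≡.refl ≡.refl =
    R⟦q⟧.*-cong (poch-cong N x≈y ≡.refl ≡.refl)
                (R⟦q⟧.+-congˡ (·q^-cong (-‿cong x≈y) ≡.refl))

  -- Identities between infinite products are proved as exact identities between truncations and
  -- transferred by this lemma.
  limit : ∀ {a b : PowerSeries} (a′ b′ : ℕ → PowerSeries) →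
          (∀ N → a′ N ≡ a mod-q^ N) → (∀ N → b′ N ≡ b mod-q^ N) →
          (∀ N → a′ N ≐ b′ N) → a ≐ b
  limit a′ b′ a′→a b′→b p =
    mod⇒≐ λ N → mod-trans (mod-sym (a′→a N)) (mod-trans (≐⇒mod (p N)) (b′→b N))

  Poch-cong : ∀ {x y k l m n} .{{_ : NonZero m}} .{{_ : NonZero n}} →
              x ≈ y → k ≡ l → m ≡ n → Poch x k m ≐ Poch y l n
  Poch-cong {x} {y} {k} {l} {m} {n} x≈y k≡l m≡n =
    limit (poch x k m) (poch y l n) (poch-limit x k m) (poch-limit y l n)
          (λ N → poch-cong N x≈y k≡l m≡n)

  V-poch : ∀ x k m N → V (poch x k m N) ≐ poch x (2 ℕ.* k) (2 ℕ.* m) N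
  V-poch x k m zero = V-𝟏
    where
    V-𝟏 : V 𝟏 ≐ 𝟏
    V-𝟏 = R⟦q⟧.trans (V-cong 𝟏≐·q^) (R⟦q⟧.trans (V-·q^ 1# 0) (R⟦q⟧.sym 𝟏≐·q^))
  V-poch x k m (suc N) = let open ≐-Reasoning in begin
    V (poch x k m N ⊗ (𝟏 ⊕ (- x) ·q^ (k ℕ.+ m ℕ.* N)))
      ≈⟨ V-⊗ _ _ ⟩
    V (poch x k m N) ⊗ V (𝟏 ⊕ (- x) ·q^ (k ℕ.+ m ℕ.* N))
      ≈⟨ R⟦q⟧.*-cong (V-poch x k m N) (V-⊕ _ _) ⟩
    poch x (2 ℕ.* k) (2 ℕ.* m) N ⊗ (V 𝟏 ⊕ V ((- x) ·q^ (k ℕ.+ m ℕ.* N)))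
      ≈⟨ R⟦q⟧.*-congˡ (R⟦q⟧.+-cong (V-poch x k m 0) (R⟦q⟧.trans (V-·q^ _ _)
           (·q^-cong refl (lemma k m N)))) ⟩
    poch x (2 ℕ.* k) (2 ℕ.* m) (suc N) ∎
    where
    lemma : ∀ k m N → 2 ℕ.* (k ℕ.+ m ℕ.* N) ≡ 2 ℕ.* k ℕ.+ 2 ℕ.* m ℕ.* N
    lemma = solve-∀

  V-Poch : ∀ x k m .{{_ : NonZero m}} .{{_ : NonZero (2 ℕ.* m)}} →
           V (Poch x k m) ≐ Poch x (2 ℕ.* k) (2 ℕ.* m)
  V-Poch x k m = limit (λ N → V (poch x k m N)) (poch x (2 ℕ.* k) (2 ℕ.* m))
    (λ N → V-mod (poch-limit x k m N)) (poch-limit x (2 ℕ.* k) (2 ℕ.* m)) (V-poch x k m)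

  -- Factor by factor this is (1 - xt)(1 + xt) = 1 - x²t² with t a power of q.
  poch-conjugate : ∀ x k m N →
    poch x k m N ⊗ poch (- x) k m N ≐ poch (x * x) (2 ℕ.* k) (2 ℕ.* m) N
  poch-conjugate x k m zero    = R⟦q⟧.*-identityˡ 𝟏
  poch-conjugate x k m (suc N) =
    R⟦q⟧.trans (⊗-interchange _ _ _ _) (R⟦q⟧.*-cong (poch-conjugate x k m N) (factors _ (lemma k m N)))
    where
    lemma : ∀ k m N → (k ℕ.+ m ℕ.* N) ℕ.+ (k ℕ.+ m ℕ.* N) ≡ 2 ℕ.* k ℕ.+ 2 ℕ.* m ℕ.* N
    lemma = solve-∀
    factors : ∀ e {e′} → e ℕ.+ e ≡ e′ →
              (𝟏 ⊕ (- x) ·q^ e) ⊗ (𝟏 ⊕ (- - x) ·q^ e) ≐ 𝟏 ⊕ (- (x * x)) ·q^ e′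
    factors e e+e≡e′ = let open ≐-Reasoning in begin
      (𝟏 ⊕ a) ⊗ (𝟏 ⊕ b)          ≈⟨ R⟦q⟧.distribˡ _ _ _ ⟩
      (𝟏 ⊕ a) ⊗ 𝟏 ⊕ (𝟏 ⊕ a) ⊗ b   ≈⟨ R⟦q⟧.+-cong (R⟦q⟧.*-identityʳ _) (R⟦q⟧.distribʳ _ _ _) ⟩
      (𝟏 ⊕ a) ⊕ (𝟏 ⊗ b ⊕ a ⊗ b)   ≈⟨ R⟦q⟧.+-congˡ (R⟦q⟧.+-congʳ (R⟦q⟧.*-identityˡ _)) ⟩
      (𝟏 ⊕ a) ⊕ (b ⊕ a ⊗ b)       ≈⟨ R⟦q⟧.+-assoc _ _ _ ⟩
      𝟏 ⊕ (a ⊕ (b ⊕ a ⊗ b))       ≈⟨ R⟦q⟧.+-congˡ (R⟦q⟧.+-assoc _ _ _) ⟨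
      𝟏 ⊕ ((a ⊕ b) ⊕ a ⊗ b)       ≈⟨ R⟦q⟧.+-congˡ (R⟦q⟧.+-congʳ (R⟦q⟧.trans
                                       (R⟦q⟧.+-congˡ (·q^-neg _ _)) (R⟦q⟧.-‿inverseʳ a))) ⟩
      𝟏 ⊕ (𝟘 ⊕ a ⊗ b)             ≈⟨ R⟦q⟧.+-congˡ (R⟦q⟧.+-identityˡ _) ⟩
      𝟏 ⊕ a ⊗ b                   ≈⟨ R⟦q⟧.+-congˡ (R⟦q⟧.trans (⊗-·q^ _ _ _ _)
                                       (·q^-cong (trans (*-congˡ (-‿involutive x))
                                                        (sym (-‿distribˡ-* x x))) e+e≡e′)) ⟩
      𝟏 ⊕ (- (x * x)) ·q^ _       ∎
      where
      a = (- x) ·q^ e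
      b = (- - x) ·q^ e

  Poch-conjugate : ∀ x k m .{{_ : NonZero m}} .{{_ : NonZero (2 ℕ.* m)}} →
                   Poch x k m ⊗ Poch (- x) k m ≐ Poch (x * x) (2 ℕ.* k) (2 ℕ.* m)
  Poch-conjugate x k m = limit (λ N → poch x k m N ⊗ poch (- x) k m N) _
    (λ N → ⊗-mod (poch-limit x k m N) (poch-limit (- x) k m N))
    (poch-limit (x * x) (2 ℕ.* k) (2 ℕ.* m)) (poch-conjugate x k m)

  -- ∏_{i < r} (x q^{k+mi}; q^M)_N and its limit
  poch-residues : Carrier → ℕ → ℕ → ℕ → ℕ → ℕ → PowerSeries
  poch-residues x k m M zero    N = 𝟏
  poch-residues x k m M (suc r) N = poch-residues x k m M r N ⊗ poch x (k ℕ.+ m ℕ.* r) M N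

  Poch-residues : Carrier → ℕ → ℕ → (M : ℕ) → .{{NonZero M}} → ℕ → PowerSeries
  Poch-residues x k m M zero    = 𝟏
  Poch-residues x k m M (suc r) = Poch-residues x k m M r ⊗ Poch x (k ℕ.+ m ℕ.* r) M

  poch-residues-limit : ∀ x k m M .{{_ : NonZero M}} r N →
    poch-residues x k m M r N ≡ Poch-residues x k m M r mod-q^ N
  poch-residues-limit x k m M zero    N = mod-refl
  poch-residues-limit x k m M (suc r) N =
    ⊗-mod (poch-residues-limit x k m M r N) (poch-limit x (k ℕ.+ m ℕ.* r) M N)

  poch-+ : ∀ x k m s N → poch x k m (s ℕ.+ N) ≐ poch x k m s ⊗ poch x (k ℕ.+ m ℕ.* s) m N
  poch-+ x k m s zero rewrite ℕₚ.+-identityʳ s = R⟦q⟧.sym (R⟦q⟧.*-identityʳ _)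
  poch-+ x k m s (suc N) rewrite ℕₚ.+-suc s N =
    R⟦q⟧.trans (R⟦q⟧.*-cong (poch-+ x k m s N) (R⟦q⟧.+-congˡ (·q^-cong refl (lemma k m s N))))
               (R⟦q⟧.*-assoc _ _ _)
    where
    lemma : ∀ k m s N → k ℕ.+ m ℕ.* (s ℕ.+ N) ≡ k ℕ.+ m ℕ.* s ℕ.+ m ℕ.* N
    lemma = solve-∀

  poch-residues-step : ∀ x k m M r N →
    poch-residues x k m M r N ⊗ poch x (k ℕ.+ M ℕ.* N) m r ≐ poch-residues x k m M r (suc N)
  poch-residues-step x k m M zero    N = R⟦q⟧.*-identityˡ 𝟏
  poch-residues-step x k m M (suc r) N =
    R⟦q⟧.trans (⊗-interchange _ _ _ _)
      (R⟦q⟧.*-cong (poch-residues-step x k m M r N)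
                   (R⟦q⟧.*-congˡ (R⟦q⟧.+-congˡ (·q^-cong refl (lemma k m M r N)))))
    where
    lemma : ∀ k m M r N → k ℕ.+ M ℕ.* N ℕ.+ m ℕ.* r ≡ k ℕ.+ m ℕ.* r ℕ.+ M ℕ.* N
    lemma = solve-∀

  -- Truncation after `N * r` factors makes the splitting exact: every residue class receives
  -- precisely `N` of them.
  poch-split : ∀ x k m r N → poch x k m (N ℕ.* r) ≐ poch-residues x k m (r ℕ.* m) r N
  poch-split x k m r zero    = R⟦q⟧.sym (empty r)
    where
    empty : ∀ r′ → poch-residues x k m (r ℕ.* m) r′ 0 ≐ 𝟏
    empty zero     = R⟦q⟧.refl
    empty (suc r′) = R⟦q⟧.trans (R⟦q⟧.*-identityʳ _) (empty r′)
  poch-split x k m r (suc N) = let open ≐-Reasoning in begin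
    poch x k m (r ℕ.+ N ℕ.* r)
      ≡⟨ ≡.cong (poch x k m) (ℕₚ.+-comm r (N ℕ.* r)) ⟩
    poch x k m (N ℕ.* r ℕ.+ r)
      ≈⟨ poch-+ x k m (N ℕ.* r) r ⟩
    poch x k m (N ℕ.* r) ⊗ poch x (k ℕ.+ m ℕ.* (N ℕ.* r)) m r
      ≈⟨ R⟦q⟧.*-cong (poch-split x k m r N) (poch-cong r refl (lemma k m N r) ≡.refl) ⟩
    poch-residues x k m (r ℕ.* m) r N ⊗ poch x (k ℕ.+ r ℕ.* m ℕ.* N) m r
      ≈⟨ poch-residues-step x k m (r ℕ.* m) r N ⟩
    poch-residues x k m (r ℕ.* m) r (suc N) ∎
    where
    lemma : ∀ k m N r → k ℕ.+ m ℕ.* (N ℕ.* r) ≡ k ℕ.+ r ℕ.* m ℕ.* N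
    lemma = solve-∀

  Poch-split : ∀ x k m r .{{_ : NonZero m}} .{{_ : NonZero r}} .{{_ : NonZero (r ℕ.* m)}} →
               Poch x k m ≐ Poch-residues x k m (r ℕ.* m) r
  Poch-split x k m r = limit (λ N → poch x k m (N ℕ.* r)) (poch-residues x k m (r ℕ.* m) r)
    (λ N → mod-weaken (ℕₚ.m≤m*n N r) (poch-limit x k m (N ℕ.* r)))
    (poch-residues-limit x k m (r ℕ.* m) r) (poch-split x k m r)

  poch-unit : ∀ x k m .{{_ : NonZero k}} N → Unit (poch x k m N)
  poch-unit x k       m zero    = 𝟏-unit
  poch-unit x (suc k) m (suc N) =
    ⊗-unit (poch-unit x (suc k) m N) (1+q-unit (- x) (suc k ℕ.+ m ℕ.* N))

  Poch-unit : ∀ x k m .{{_ : NonZero k}} .{{_ : NonZero m}} → Unit (Poch x k m)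
  Poch-unit x k m = mk-unit (trans (sym (below (poch-limit x k m 1) (ℕ.s≤s ℕ.z≤n)))
                                   (constant (poch-unit x k m 1)))

-- Infinite families of monomials.

-- (-1)^sgn X^xp q^qp
record Monomial : Set where
  constructor ⟨_,_,_⟩
  field
    sgn xp : ℤ
    qp     : ℕ
open Monomial public

infixl 7 _⊙_

_⊙_ : Monomial → Monomial → Monomial
⟨ s , x , e ⟩ ⊙ ⟨ s′ , x′ , e′ ⟩ = ⟨ s ℤ.+ s′ , x ℤ.+ x′ , e ℕ.+ e′ ⟩

double : Monomial → Monomial
double ⟨ s , x , e ⟩ = ⟨ s , x , 2 ℕ.* e ⟩

-- A formal sum over `I` whose exponents are bounded only by finitely many indices at a time. The
-- list for `d` may also contain indices of larger exponent, so products, halves and reindexings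
-- need not compute exact supports.
record Family (I : Set) : Set where
  field
    term     : I → Monomial
    support  : ℕ → List I
    unique   : ∀ d → Unique (support d)
    complete : ∀ d {i} → qp (term i) ℕ.≤ d → i ∈ support d
open Family public

private variable I J : Set

lefts : List (I ⊎ J) → List I
lefts []            = []
lefts (inj₁ i ∷ is) = i ∷ lefts is
lefts (inj₂ _ ∷ is) = lefts is

rights : List (I ⊎ J) → List J
rights []            = []
rights (inj₁ _ ∷ is) = rights is
rights (inj₂ j ∷ is) = j ∷ rights is

∈-lefts⁺ : ∀ (is : List (I ⊎ J)) {i} → inj₁ i ∈ is → i ∈ lefts is
∈-lefts⁺ (inj₁ _ ∷ is) (here ≡.refl) = here ≡.refl
∈-lefts⁺ (inj₁ _ ∷ is) (there p)     = there (∈-lefts⁺ is p)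
∈-lefts⁺ (inj₂ _ ∷ is) (there p)     = ∈-lefts⁺ is p

∈-rights⁺ : ∀ (is : List (I ⊎ J)) {j} → inj₂ j ∈ is → j ∈ rights is
∈-rights⁺ (inj₂ _ ∷ is) (here ≡.refl) = here ≡.refl
∈-rights⁺ (inj₂ _ ∷ is) (there p)     = there (∈-rights⁺ is p)
∈-rights⁺ (inj₁ _ ∷ is) (there p)     = ∈-rights⁺ is p

lefts-All : ∀ (is : List (I ⊎ J)) {i} → All (inj₁ i ≢_) is → All (i ≢_) (lefts is)
lefts-All []            All.[]       = All.[]
lefts-All (inj₁ _ ∷ is) (p All.∷ ps) = (p ∘ ≡.cong inj₁) All.∷ lefts-All is ps
lefts-All (inj₂ _ ∷ is) (_ All.∷ ps) = lefts-All is ps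

rights-All : ∀ (is : List (I ⊎ J)) {j} → All (inj₂ j ≢_) is → All (j ≢_) (rights is)
rights-All []            All.[]       = All.[]
rights-All (inj₂ _ ∷ is) (p All.∷ ps) = (p ∘ ≡.cong inj₂) All.∷ rights-All is ps
rights-All (inj₁ _ ∷ is) (_ All.∷ ps) = rights-All is ps

lefts-unique : ∀ (is : List (I ⊎ J)) → Unique is → Unique (lefts is)
lefts-unique []            _               = AllPairs.[]
lefts-unique (inj₁ _ ∷ is) (p AllPairs.∷ u) = lefts-All is p AllPairs.∷ lefts-unique is u
lefts-unique (inj₂ _ ∷ is) (_ AllPairs.∷ u) = lefts-unique is u

rights-unique : ∀ (is : List (I ⊎ J)) → Unique is → Unique (rights is)
rights-unique []            _               = AllPairs.[]
rights-unique (inj₂ _ ∷ is) (p AllPairs.∷ u) = rights-All is p AllPairs.∷ rights-unique is u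
rights-unique (inj₁ _ ∷ is) (_ AllPairs.∷ u) = rights-unique is u

reindex : J ↔ I → Family I → Family J
reindex σ F = record
  { term     = term F ∘ σ.to
  ; support  = λ d → map σ.from (support F d)
  ; unique   = λ d → Unique.map⁺ from-injective (unique F d)
  ; complete = λ d {j} e≤d →
      ≡.subst (_∈ map σ.from (support F d)) (σ.strictlyInverseʳ j)
              (∈.∈-map⁺ σ.from (complete F d e≤d)) }
  where
  module σ = Inverse σ
  from-injective : ∀ {i i′} → σ.from i ≡ σ.from i′ → i ≡ i′
  from-injective {i} {i′} p =
    ≡.trans (≡.sym (σ.strictlyInverseˡ i)) (≡.trans (≡.cong σ.to p) (σ.strictlyInverseˡ i′))

left : Family (I ⊎ J) → Family I
left F = record
  { term     = term F ∘ inj₁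
  ; support  = lefts ∘ support F
  ; unique   = λ d → lefts-unique _ (unique F d)
  ; complete = λ d e≤d → ∈-lefts⁺ _ (complete F d e≤d) }

right : Family (I ⊎ J) → Family J
right F = record
  { term     = term F ∘ inj₂
  ; support  = rights ∘ support F
  ; unique   = λ d → rights-unique _ (unique F d)
  ; complete = λ d e≤d → ∈-rights⁺ _ (complete F d e≤d) }

infixl 7 _⊠_
infixr 8 _·_

_⊠_ : Family I → Family J → Family (I × J)
F ⊠ G = record
  { term     = λ (i , j) → term F i ⊙ term G j
  ; support  = λ d → cartesianProduct (support F d) (support G d)
  ; unique   = λ d → Unique.cartesianProduct⁺ (unique F d) (unique G d)
  ; complete = λ d e≤d → ∈.∈-cartesianProduct⁺
      (complete F d (ℕₚ.m+n≤o⇒m≤o _ e≤d)) (complete G d (ℕₚ.m+n≤o⇒n≤o _ e≤d)) }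

_·_ : Monomial → Family I → Family I
t · F = record
  { term     = λ i → t ⊙ term F i
  ; support  = support F
  ; unique   = unique F
  ; complete = λ d e≤d → complete F d (ℕₚ.m+n≤o⇒n≤o (qp t) e≤d) }

doubled : Family I → Family I
doubled F = record
  { term     = double ∘ term F
  ; support  = support F
  ; unique   = unique F
  ; complete = λ d e≤d → complete F d (ℕₚ.≤-trans (ℕₚ.m≤n*m _ 2) e≤d) }

-- Summation of families.

module Sums {c ℓ} (R : CommutativeRing c ℓ)
  (coefficient : ℤ → ℤ → CommutativeRing.Carrier R)
  (coefficient-+ : ∀ s x s′ x′ → CommutativeRing._≈_ R
    (CommutativeRing._*_ R (coefficient s x) (coefficient s′ x′)) (coefficient (s ℤ.+ s′) (x ℤ.+ x′)))
  where

  open CommutativeRing R hiding (zero)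
  open PowerSeries R
  open PowerSeriesRing R
  open Products R
  open import Algebra.Properties.CommutativeSemigroup R⟦q⟧.+-commutativeSemigroup
    using () renaming (x∙yz≈y∙xz to ⊕-swap)

  ⟦_⟧ : Monomial → PowerSeries
  ⟦ ⟨ s , x , e ⟩ ⟧ = coefficient s x ·q^ e

  ⟦⊙⟧ : ∀ t u → ⟦ t ⟧ ⊗ ⟦ u ⟧ ≐ ⟦ t ⊙ u ⟧
  ⟦⊙⟧ t u = R⟦q⟧.trans (⊗-·q^ _ _ _ _) (·q^-cong (coefficient-+ _ _ _ _) ≡.refl)

  opaque

    finiteSum : (I → PowerSeries) → List I → PowerSeries
    finiteSum a []       = 𝟘
    finiteSum a (i ∷ is) = a i ⊕ finiteSum a is

  module _ {a : I → PowerSeries} where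

    opaque
      unfolding finiteSum

      finiteSum-↭ : ∀ {is js} → is ↭ js → finiteSum a is ≐ finiteSum a js
      finiteSum-↭ Perm.refl         = R⟦q⟧.refl
      finiteSum-↭ (Perm.prep i p)   = R⟦q⟧.+-congˡ (finiteSum-↭ p)
      finiteSum-↭ (Perm.swap i j p) =
        R⟦q⟧.trans (R⟦q⟧.+-congˡ (R⟦q⟧.+-congˡ (finiteSum-↭ p))) (⊕-swap _ _ _)
      finiteSum-↭ (Perm.trans p q)  = R⟦q⟧.trans (finiteSum-↭ p) (finiteSum-↭ q)

      finiteSum-filter : ∀ {p} {P : I → Set p} (P? : Decidable P) {N} →
        (∀ i → ¬ P i → a i ≡ 𝟘 mod-q^ N) →
        ∀ is → finiteSum a is ≡ finiteSum a (filter P? is) mod-q^ N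
      finiteSum-filter P? a≡𝟘 []       = mod-refl
      finiteSum-filter P? a≡𝟘 (i ∷ is) with P? i
      ... | yes Pi = ⊕-mod mod-refl (finiteSum-filter P? a≡𝟘 is)
      ... | no ¬Pi = mod-trans (⊕-mod (a≡𝟘 i ¬Pi) (finiteSum-filter P? a≡𝟘 is))
                               (≐⇒mod (R⟦q⟧.+-identityˡ _))

      finiteSum-++ : ∀ is js → finiteSum a (is ++ js) ≐ finiteSum a is ⊕ finiteSum a js
      finiteSum-++ []       js = R⟦q⟧.sym (R⟦q⟧.+-identityˡ _)
      finiteSum-++ (i ∷ is) js =
        R⟦q⟧.trans (R⟦q⟧.+-congˡ (finiteSum-++ is js)) (R⟦q⟧.sym (R⟦q⟧.+-assoc _ _ _))

      finiteSum-map : (g : J → I) → ∀ js → finiteSum a (map g js) ≐ finiteSum (a ∘ g) js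
      finiteSum-map g []       = R⟦q⟧.refl
      finiteSum-map g (j ∷ js) = R⟦q⟧.+-congˡ (finiteSum-map g js)

      finiteSum-cong : ∀ {b : I → PowerSeries} → (∀ i → a i ≐ b i) →
                       ∀ is → finiteSum a is ≐ finiteSum b is
      finiteSum-cong a≐b []       = R⟦q⟧.refl
      finiteSum-cong a≐b (i ∷ is) = R⟦q⟧.+-cong (a≐b i) (finiteSum-cong a≐b is)

      finiteSum-⊗ : ∀ b is → b ⊗ finiteSum a is ≐ finiteSum (λ i → b ⊗ a i) is
      finiteSum-⊗ b []       = R⟦q⟧.zeroʳ b
      finiteSum-⊗ b (i ∷ is) = R⟦q⟧.trans (R⟦q⟧.distribˡ _ _ _) (R⟦q⟧.+-congˡ (finiteSum-⊗ b is))

      finiteSum-V : ∀ is → V (finiteSum a is) ≐ finiteSum (V ∘ a) is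
      finiteSum-V []       = V-𝟘
      finiteSum-V (i ∷ is) = R⟦q⟧.trans (V-⊕ _ _) (R⟦q⟧.+-congˡ (finiteSum-V is))

      finiteSum-lefts-rights : ∀ (b : J → PowerSeries) (js : List (I ⊎ J)) (ab : I ⊎ J → PowerSeries) →
        (∀ i → ab (inj₁ i) ≐ a i) → (∀ j → ab (inj₂ j) ≐ b j) →
        finiteSum ab js ≐ finiteSum a (lefts js) ⊕ finiteSum b (rights js)
      finiteSum-lefts-rights b []            ab p q = R⟦q⟧.sym (R⟦q⟧.+-identityˡ _)
      finiteSum-lefts-rights b (inj₁ i ∷ js) ab p q =
        R⟦q⟧.trans (R⟦q⟧.+-cong (p i) (finiteSum-lefts-rights b js ab p q))
                   (R⟦q⟧.sym (R⟦q⟧.+-assoc _ _ _))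
      finiteSum-lefts-rights b (inj₂ j ∷ js) ab p q =
        R⟦q⟧.trans (R⟦q⟧.+-cong (q j) (finiteSum-lefts-rights b js ab p q)) (⊕-swap _ _ _)

  opaque
    unfolding finiteSum

    finiteSum-× : ∀ (a : I → PowerSeries) (b : J → PowerSeries) is js →
      finiteSum a is ⊗ finiteSum b js ≐ finiteSum (λ (i , j) → a i ⊗ b j) (cartesianProduct is js)
    finiteSum-× a b []       js = R⟦q⟧.zeroˡ _
    finiteSum-× {I = I} {J = J} a b (i ∷ is) js = let open ≐-Reasoning in begin
      (a i ⊕ finiteSum a is) ⊗ finiteSum b js
        ≈⟨ R⟦q⟧.distribʳ _ _ _ ⟩
      a i ⊗ finiteSum b js ⊕ finiteSum a is ⊗ finiteSum b js
        ≈⟨ R⟦q⟧.+-cong (R⟦q⟧.trans (finiteSum-⊗ (a i) js) (R⟦q⟧.sym (finiteSum-map (i ,_) js)))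
                       (finiteSum-× a b is js) ⟩
      finiteSum ab (map (i ,_) js) ⊕ finiteSum ab (cartesianProduct is js)
        ≈⟨ finiteSum-++ (map (i ,_) js) _ ⟨
      finiteSum ab (cartesianProduct (i ∷ is) js) ∎
      where
      ab : I × J → PowerSeries
      ab (i , j) = a i ⊗ b j

  Covers : Family I → ℕ → List I → Set
  Covers F N is = Unique is × (∀ {i} → qp (term F i) ℕ.< N → i ∈ is)

  partialSum : Family I → List I → PowerSeries
  partialSum F = finiteSum (⟦_⟧ ∘ term F)

  -- Modulo `q^N` only the indices of exponent below `N` count. After filtering, both lists are
  -- duplicate-free with the same members, hence permutations of each other. So the sum of a family
  -- does not depend on the chosen lists.
  covers-≡ : ∀ (F : Family I) N {is js} → Covers F N is → Covers F N js →
             partialSum F is ≡ partialSum F js mod-q^ N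
  covers-≡ F N {is} {js} (is! , is∋) (js! , js∋) =
    mod-trans (finiteSum-filter low? high is)
      (mod-trans (≐⇒mod (finiteSum-↭ perm)) (mod-sym (finiteSum-filter low? high js)))
    where
    low? = λ i → qp (term F i) ℕₚ.<? N
    high : ∀ i → ¬ qp (term F i) ℕ.< N → ⟦ term F i ⟧ ≡ 𝟘 mod-q^ N
    high i e≮N = ·q^-mod-𝟘 _ (ℕₚ.≮⇒≥ e≮N)
    perm : filter low? is ↭ filter low? js
    perm = ∼bag⇒↭ (unique∧set⇒bag (Unique.filter⁺ low? {is} is!) (Unique.filter⁺ low? {js} js!)
      (mk⇔ (λ p → let (_ , e<N) = ∈.∈-filter⁻ low? {xs = is} p in ∈.∈-filter⁺ low? (js∋ e<N) e<N)
           (λ p → let (_ , e<N) = ∈.∈-filter⁻ low? {xs = js} p in ∈.∈-filter⁺ low? (is∋ e<N) e<N)))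

  support-covers : (F : Family I) → ∀ N → Covers F N (support F N)
  support-covers F N = unique F N , λ e<N → complete F N (ℕₚ.<⇒≤ e<N)

  opaque
    unfolding 𝟘

    ∑ : Family I → PowerSeries
    ∑ F n = partialSum F (support F n) n

    ∑-covers : ∀ (F : Family I) N {is} → Covers F N is → ∑ F ≡ partialSum F is mod-q^ N
    ∑-covers F N {is} (is! , is∋) = mk-mod λ {n} n<N →
      below (covers-≡ F (suc n) (unique F n , λ e<n → complete F n (ℕ.s≤s⁻¹ e<n))
                                (is! , λ e<n → is∋ (ℕₚ.<-≤-trans e<n n<N)))
            ℕₚ.≤-refl

  ∑-support : ∀ (F : Family I) N → ∑ F ≡ partialSum F (support F N) mod-q^ N
  ∑-support F N = ∑-covers F N (support-covers F N)

  -- Equality of the exponents does not follow from equality of the monomials as series, since a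
  -- coefficient may vanish in `R`. It ensures that the lists of `G` cover `F`.
  ∑-cong : (F G : Family I) → (∀ i → ⟦ term F i ⟧ ≐ ⟦ term G i ⟧) →
           (∀ i → qp (term F i) ≡ qp (term G i)) → ∑ F ≐ ∑ G
  ∑-cong F G F≐G e≡ = mod⇒≐ λ N →
    mod-trans (∑-covers F N (unique G N , λ {i} e<N →
                complete G N (≡.subst (ℕ._≤ N) (e≡ i) (ℕₚ.<⇒≤ e<N))))
      (mod-trans (≐⇒mod (finiteSum-cong F≐G _)) (mod-sym (∑-support G N)))

  ∑-reindex : (σ : J ↔ I) (F : Family I) → ∑ F ≐ ∑ (reindex σ F)
  ∑-reindex σ F = mod⇒≐ λ N → mod-trans (∑-support F N)
    (mod-trans (≐⇒mod (to N)) (mod-sym (∑-support (reindex σ F) N)))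
    where
    module σ = Inverse σ
    to : ∀ N → partialSum F (support F N) ≐ partialSum (reindex σ F) (map σ.from (support F N))
    to N = R⟦q⟧.sym (R⟦q⟧.trans (finiteSum-map σ.from _)
      (finiteSum-cong (λ i → R⟦q⟧.reflexive (≡.cong (⟦_⟧ ∘ term F) (σ.strictlyInverseˡ i))) _))

  ∑-⊎ : (F : Family (I ⊎ J)) → ∑ F ≐ ∑ (left F) ⊕ ∑ (right F)
  ∑-⊎ F = mod⇒≐ λ N → mod-trans (∑-support F N)
    (mod-trans (≐⇒mod (finiteSum-lefts-rights _ (support F N) _ (λ _ → R⟦q⟧.refl) (λ _ → R⟦q⟧.refl)))
               (mod-sym (⊕-mod (∑-support (left F) N) (∑-support (right F) N))))

  ∑-⊠ : (F : Family I) (G : Family J) → ∑ (F ⊠ G) ≐ ∑ F ⊗ ∑ G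
  ∑-⊠ F G = mod⇒≐ λ N → mod-trans (∑-support (F ⊠ G) N)
    (mod-trans (≐⇒mod (R⟦q⟧.sym (R⟦q⟧.trans (finiteSum-× _ _ (support F N) (support G N))
                                  (finiteSum-cong (λ (i , j) → ⟦⊙⟧ (term F i) (term G j)) _))))
               (mod-sym (⊗-mod (∑-support F N) (∑-support G N))))

  ∑-· : (t : Monomial) (F : Family I) → ∑ (t · F) ≐ ⟦ t ⟧ ⊗ ∑ F
  ∑-· t F = mod⇒≐ λ N → mod-trans (∑-support (t · F) N)
    (mod-trans (≐⇒mod (R⟦q⟧.sym (R⟦q⟧.trans (finiteSum-⊗ _ (support F N))
                                  (finiteSum-cong (λ i → ⟦⊙⟧ t (term F i)) _))))
               (⊗-mod mod-refl (mod-sym (∑-support F N))))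

  ∑-doubled : (F : Family I) → ∑ (doubled F) ≐ V (∑ F)
  ∑-doubled F = mod⇒≐ λ N → mod-trans (∑-support (doubled F) N)
    (mod-trans (≐⇒mod (R⟦q⟧.sym (R⟦q⟧.trans (finiteSum-V (support F N))
                                  (finiteSum-cong (λ i → V-·q^ _ _) _))))
               (V-mod (mod-sym (∑-support F N))))

-- Exponents of theta series.

triangular : ℕ → ℕ
triangular zero    = 0
triangular (suc n) = suc n ℕ.+ triangular n

-- n(n + 1)/2 for every integer n, using its symmetry under n ↦ -1 - n; natural-valued so that it
-- can serve as an exponent.
T : ℤ → ℕ
T (+ n)    = triangular n
T -[1+ n ] = triangular n

-- Doubling clears the denominator of n(n + 1)/2, so that equations between exponents become
-- polynomial identities over ℤ.
twice : ℕ → ℤ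
twice e = + e ℤ.+ + e

twice-injective : ∀ {d e} → twice d ≡ twice e → d ≡ e
twice-injective {d} {e} p = ℕₚ.*-cancelˡ-≡ d e 2
  (≡.trans (dbl d) (≡.trans (ℤₚ.+-injective p) (≡.sym (dbl e))))
  where
  dbl : ∀ n → 2 ℕ.* n ≡ n ℕ.+ n
  dbl n = ≡.cong (n ℕ.+_) (ℕₚ.+-identityʳ n)

twice-+ : ∀ d e → twice (d ℕ.+ e) ≡ twice d ℤ.+ twice e
twice-+ d e = solveℤ 2 (λ d e → (d :+ e) :+ (d :+ e) := (d :+ d) :+ (e :+ e)) ≡.refl (+ d) (+ e)
  where open +-*-Solver

twice-* : ∀ d e → twice (d ℕ.* e) ≡ + d ℤ.* twice e
twice-* d e = ≡.trans (≡.cong₂ ℤ._+_ (ℤₚ.pos-* d e) (ℤₚ.pos-* d e))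
  (≡.sym (ℤₚ.*-distribˡ-+ (+ d) (+ e) (+ e)))

twice-triangular : ∀ n → twice (triangular n) ≡ + n ℤ.* + n ℤ.+ + n
twice-triangular zero    = ≡.refl
twice-triangular (suc n) = ≡.trans (twice-+ (suc n) (triangular n))
  (≡.trans (≡.cong (λ z → twice (suc n) ℤ.+ z) (twice-triangular n))
    (solveℤ 1 (λ n → let n′ = con 1ℤ :+ n in (n′ :+ n′) :+ (n :* n :+ n) := n′ :* n′ :+ n′)
           ≡.refl (+ n)))
  where open +-*-Solver

twice-T : ∀ n → twice (T n) ≡ n ℤ.* n ℤ.+ n
twice-T (+ n)    = twice-triangular n
twice-T -[1+ n ] = ≡.trans (twice-triangular n)
  (solveℤ 1 (λ n → let m = :- (con 1ℤ :+ n) in n :* n :+ n := m :* m :+ m) ≡.refl (+ n))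
  where open +-*-Solver

-- The exponent of q in the n-th term of the theta series with factors
-- (1 + y q^a), (1 + y⁻¹ q^b), …
opaque

  E : ℕ → ℕ → ℤ → ℕ
  E a b n = a ℕ.* T n ℕ.+ b ℕ.* T (ℤ.- n)

E₂ : ℤ → ℤ → ℤ → ℤ
E₂ a b n = a ℤ.* (n ℤ.* n ℤ.+ n) ℤ.+ b ℤ.* (ℤ.- n ℤ.* ℤ.- n ℤ.+ ℤ.- n)

triangular-≥ : ∀ n → n ℕ.≤ triangular n
triangular-≥ zero    = ℕ.z≤n
triangular-≥ (suc n) = ℕₚ.m≤m+n (suc n) (triangular n)

∣n∣≤1+T : ∀ n → ∣ n ∣ ℕ.≤ suc (T n)
∣n∣≤1+T (+ n)    = ℕₚ.m≤n⇒m≤1+n (triangular-≥ n)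
∣n∣≤1+T -[1+ n ] = ℕ.s≤s (triangular-≥ n)

opaque
  unfolding E

  twice-E : ∀ a b n → twice (E a b n) ≡ E₂ (+ a) (+ b) n
  twice-E a b n = ≡.trans (twice-+ (a ℕ.* T n) (b ℕ.* T (ℤ.- n)))
    (≡.cong₂ ℤ._+_ (≡.trans (twice-* a (T n)) (≡.cong (λ z → + a ℤ.* z) (twice-T n)))
                   (≡.trans (twice-* b (T (ℤ.- n))) (≡.cong (λ z → + b ℤ.* z) (twice-T (ℤ.- n)))))

  E-0 : ∀ a b → E a b 0ℤ ≡ 0
  E-0 a b = ≡.cong₂ ℕ._+_ (ℕₚ.*-zeroʳ a) (ℕₚ.*-zeroʳ b)

  ∣n∣≤1+E : ∀ a b .{{_ : NonZero a}} n → ∣ n ∣ ℕ.≤ suc (E a b n)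
  ∣n∣≤1+E a b n =
    ℕₚ.≤-trans (∣n∣≤1+T n) (ℕ.s≤s (ℕₚ.≤-trans (ℕₚ.m≤n*m (T n) a) (ℕₚ.m≤m+n _ _)))

  ∣n∣≤E : ∀ a b .{{_ : NonZero a}} .{{_ : NonZero b}} n → ∣ n ∣ ℕ.≤ E a b n
  ∣n∣≤E a b n = ℕₚ.≤-trans (bound n) (ℕₚ.+-mono-≤ (ℕₚ.m≤n*m (T n) a) (ℕₚ.m≤n*m (T (ℤ.- n)) b))
    where
    bound : ∀ n → ∣ n ∣ ℕ.≤ T n ℕ.+ T (ℤ.- n)
    bound (+ n)    = ℕₚ.≤-trans (triangular-≥ n) (ℕₚ.m≤m+n _ _)
    bound -[1+ n ] = ℕₚ.≤-trans (triangular-≥ (suc n)) (ℕₚ.m≤n+m _ (triangular n))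

⊖-+ : ∀ m n → (m ℤ.⊖ n) ℤ.+ + n ≡ + m
⊖-+ m n = ≡.trans (≡.cong (λ z → z ℤ.+ + n) (≡.sym (ℤₚ.m-n≡m⊖n m n)))
  (solveℤ 2 (λ m n → (m :+ :- n) :+ n := m) ≡.refl (+ m) (+ n))
  where open +-*-Solver

⊖-injective : ∀ n {i j} → i ℤ.⊖ n ≡ j ℤ.⊖ n → i ≡ j
⊖-injective n {i} {j} p =
  ℤₚ.+-injective (≡.trans (≡.sym (⊖-+ i n)) (≡.trans (≡.cong (λ z → z ℤ.+ + n) p) (⊖-+ j n)))

integers : ℕ → List ℤ
integers N = map (ℤ._⊖ N) (upTo (suc (N ℕ.+ N)))

integers-unique : ∀ N → Unique (integers N)
integers-unique N = Unique.map⁺ (⊖-injective N) (Unique.upTo⁺ _)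

∈-integers : ∀ N i → ∣ i ∣ ℕ.≤ N → i ∈ integers N
∈-integers N (+ k) k≤N = ≡.subst (_∈ integers N) eq
  (∈.∈-map⁺ (ℤ._⊖ N) (∈.∈-upTo⁺ (ℕ.s≤s (ℕₚ.+-monoˡ-≤ N k≤N))))
  where
  eq : (k ℕ.+ N) ℤ.⊖ N ≡ + k
  eq = ≡.trans (ℤₚ.⊖-≥ (ℕₚ.m≤n+m N k)) (≡.cong +_ (ℕₚ.m+n∸n≡m k N))
∈-integers N -[1+ k ] k<N = ≡.subst (_∈ integers N) eq
  (∈.∈-map⁺ (ℤ._⊖ N) (∈.∈-upTo⁺ (ℕ.s≤s (ℕₚ.≤-trans (ℕₚ.m∸n≤m N (suc k)) (ℕₚ.m≤m+n N N)))))
  where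
  eq : (N ∸ suc k) ℤ.⊖ N ≡ -[1+ k ]
  eq = ≡.trans (ℤₚ.⊖-≤ (ℕₚ.m∸n≤m N (suc k)))
               (≡.cong (λ d → ℤ.- + d) (ℕₚ.m∸[m∸n]≡n k<N))

-- Ramanujan's general theta function, the sum of u^(n(n+1)/2) v^(n(n-1)/2), at u = y q^a and v =
-- y⁻¹ q^b with y = (-1)^s X^l. The case `b = 0` occurs in `Θ₁`.
theta : ℤ → ℤ → (a b : ℕ) → .{{NonZero a}} → Family ℤ
theta s l a b = record
  { term     = λ n → ⟨ s ℤ.* n , l ℤ.* n , E a b n ⟩
  ; support  = λ d → integers (suc d)
  ; unique   = λ d → integers-unique (suc d)
  ; complete = λ d {n} e≤d →
      ∈-integers (suc d) n (ℕₚ.≤-trans (∣n∣≤1+E a b n) (ℕ.s≤s e≤d)) }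

-- Signs and integral powers of X as coefficients.

module Coefficients {c ℓ} (R : CommutativeRing c ℓ) where

  open CommutativeRing R hiding (zero)
  open import Algebra.Properties.Semiring.Exp semiring using (_^_; ^-homo-*)
  open import Algebra.Properties.CommutativeSemigroup *-commutativeSemigroup
    using (interchange)
  open RingProperties ring using (-‿involutive; -1*x≈-x)
  open import Relation.Binary.Reasoning.Setoid setoid

  module _ (x y : Carrier) (xy≈1 : x * y ≈ 1#) where

    power : ℤ → Carrier
    power (+ n)    = x ^ n
    power -[1+ n ] = y ^ suc n

    power-⊖ : ∀ m n → power (m ℤ.⊖ n) ≈ x ^ m * y ^ n
    power-⊖ m       zero    = sym (*-identityʳ _)
    power-⊖ zero    (suc n) = sym (*-identityˡ _)
    power-⊖ (suc m) (suc n) = begin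
      power (suc m ℤ.⊖ suc n)        ≡⟨ ≡.cong power (ℤₚ.[1+m]⊖[1+n]≡m⊖n m n) ⟩
      power (m ℤ.⊖ n)                ≈⟨ power-⊖ m n ⟩
      x ^ m * y ^ n                  ≈⟨ *-identityˡ _ ⟨
      1# * (x ^ m * y ^ n)           ≈⟨ *-congʳ xy≈1 ⟨
      x * y * (x ^ m * y ^ n)        ≈⟨ interchange _ _ _ _ ⟩
      x ^ suc m * y ^ suc n          ∎

    power-+ : ∀ i j → power i * power j ≈ power (i ℤ.+ j)
    power-+ (+ m)    (+ n)    = sym (^-homo-* x m n)
    power-+ (+ m)    -[1+ n ] = sym (power-⊖ m (suc n))
    power-+ -[1+ m ] (+ n)    = trans (*-comm _ _) (sym (power-⊖ n (suc m)))
    power-+ -[1+ m ] -[1+ n ] = trans (sym (^-homo-* y (suc m) (suc n)))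
      (reflexive (≡.cong (y ^_) (≡.cong suc (ℕₚ.+-suc m n))))

  -1*-1≈1 : - 1# * - 1# ≈ 1#
  -1*-1≈1 = trans (-1*x≈-x (- 1#)) (-‿involutive 1#)

  sign : ℤ → Carrier
  sign = power (- 1#) (- 1#) -1*-1≈1

  sign-+ : ∀ i j → sign i * sign j ≈ sign (i ℤ.+ j)
  sign-+ = power-+ (- 1#) (- 1#) -1*-1≈1

  sign-square : ∀ i → sign i * sign i ≈ 1#
  sign-square (+ n)    = square n
    where
    square : ∀ n → (- 1#) ^ n * (- 1#) ^ n ≈ 1#
    square zero    = *-identityˡ 1#
    square (suc n) =
      trans (interchange _ _ _ _) (trans (*-cong -1*-1≈1 (square n)) (*-identityˡ 1#))
  sign-square -[1+ n ] = sign-square (+ suc n)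

  module _ (X X⁻¹ : Carrier) (XX⁻¹≈1 : X * X⁻¹ ≈ 1#) where

    opaque

      coefficient : ℤ → ℤ → Carrier
      coefficient s x = sign s * power X X⁻¹ XX⁻¹≈1 x

    opaque
      unfolding coefficient

      coefficient-+ : ∀ s x s′ x′ →
        coefficient s x * coefficient s′ x′ ≈ coefficient (s ℤ.+ s′) (x ℤ.+ x′)
      coefficient-+ s x s′ x′ =
        trans (interchange _ _ _ _) (*-cong (sign-+ s s′) (power-+ X X⁻¹ XX⁻¹≈1 x x′))

      coefficient-period : ∀ h s x → coefficient (h ℤ.+ h ℤ.+ s) x ≈ coefficient s x
      coefficient-period h s x = *-congʳ (trans (sym (sign-+ (h ℤ.+ h) s))
        (trans (*-congʳ (trans (sym (sign-+ h h)) (sign-square h))) (*-identityˡ _)))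

      coefficient-neg : ∀ s x → coefficient (1ℤ ℤ.+ s) x ≈ - coefficient s x
      coefficient-neg s x = begin
        sign (1ℤ ℤ.+ s) * _          ≈⟨ *-congʳ (sign-+ 1ℤ s) ⟨
        (- 1# * 1#) * sign s * _     ≈⟨ *-congʳ (*-congʳ (*-identityʳ _)) ⟩
        - 1# * sign s * _            ≈⟨ *-assoc _ _ _ ⟩
        - 1# * (sign s * _)          ≈⟨ -1*x≈-x _ ⟩
        - (sign s * _)               ∎

      coefficient-1 : coefficient 0ℤ 0ℤ ≈ 1#
      coefficient-1 = *-identityˡ 1#

      coefficient-X : coefficient 0ℤ 1ℤ ≈ X
      coefficient-X = trans (*-identityˡ _) (*-identityʳ X)

      coefficient-X⁻¹ : coefficient 0ℤ ℤ.-1ℤ ≈ X⁻¹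
      coefficient-X⁻¹ = trans (*-identityˡ _) (*-identityʳ X⁻¹)

-- Gaussian binomial coefficients.

module GaussianBinomials {c ℓ} (R : CommutativeRing c ℓ) where

  open CommutativeRing R using (1#; -_; *-identityˡ)
  open PowerSeries R
  open PowerSeriesRing R
  open Products R
  open R⟦q⟧ using (refl; sym; trans; +-cong; +-congˡ; +-congʳ; *-cong; *-congˡ; *-congʳ)
  open import Algebra.Properties.CommutativeSemigroup R⟦q⟧.+-commutativeSemigroup
    using (interchange)
  open ≐-Reasoning
  open CommutativeMonoidSolver R⟦q⟧.*-commutativeMonoid using (solve; _⊜_)
    renaming (_⊕_ to infixl 7 _∙_)

  opaque

    sumBelow : ℕ → (ℕ → PowerSeries) → PowerSeries
    sumBelow zero    a = 𝟘
    sumBelow (suc n) a = a 0 ⊕ sumBelow n (a ∘ suc)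

  opaque
    unfolding sumBelow

    sumBelow-1 : ∀ a → sumBelow 1 a ≐ a 0
    sumBelow-1 a = R⟦q⟧.+-identityʳ (a 0)

    sumBelow-first : ∀ n a → sumBelow (suc n) a ≐ a 0 ⊕ sumBelow n (a ∘ suc)
    sumBelow-first n a = refl

    sumBelow-cong : ∀ {a b} n → (∀ {i} → i ℕ.< n → a i ≐ b i) → sumBelow n a ≐ sumBelow n b
    sumBelow-cong zero    p = refl
    sumBelow-cong (suc n) p =
      +-cong (p (ℕ.s≤s ℕ.z≤n)) (sumBelow-cong n (λ i<n → p (ℕ.s≤s i<n)))

    sumBelow-mod : ∀ {a b N} n → (∀ {i} → i ℕ.< n → a i ≡ b i mod-q^ N) →
                   sumBelow n a ≡ sumBelow n b mod-q^ N
    sumBelow-mod zero    p = mod-refl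
    sumBelow-mod (suc n) p =
      ⊕-mod (p (ℕ.s≤s ℕ.z≤n)) (sumBelow-mod n (λ i<n → p (ℕ.s≤s i<n)))

    sumBelow-⊕ : ∀ n a b → sumBelow n (λ i → a i ⊕ b i) ≐ sumBelow n a ⊕ sumBelow n b
    sumBelow-⊕ zero    a b = sym (R⟦q⟧.+-identityˡ _)
    sumBelow-⊕ (suc n) a b =
      trans (+-congˡ (sumBelow-⊕ n (a ∘ suc) (b ∘ suc))) (interchange _ _ _ _)

    sumBelow-⊗ : ∀ n a b → sumBelow n a ⊗ b ≐ sumBelow n (λ i → a i ⊗ b)
    sumBelow-⊗ zero    a b = R⟦q⟧.zeroˡ b
    sumBelow-⊗ (suc n) a b = trans (R⟦q⟧.distribʳ _ _ _) (+-congˡ (sumBelow-⊗ n (a ∘ suc) b))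

    sumBelow-last : ∀ n a → sumBelow (suc n) a ≐ sumBelow n a ⊕ a n
    sumBelow-last zero    a = R⟦q⟧.+-comm (a 0) 𝟘
    sumBelow-last (suc n) a =
      trans (+-congˡ (sumBelow-last n (a ∘ suc))) (sym (R⟦q⟧.+-assoc _ _ _))

  module _ (M : ℕ) where

    Q : ℕ → PowerSeries
    Q k = 1# ·q^ (M ℕ.* k)

    Q-+ : ∀ j k → Q j ⊗ Q k ≐ Q (j ℕ.+ k)
    Q-+ j k = trans (⊗-·q^ _ _ _ _) (·q^-cong (*-identityˡ 1#) (≡.sym (ℕₚ.*-distribˡ-+ M j k)))

    Q-0 : Q 0 ≐ 𝟏
    Q-0 = trans (·q^-cong (CommutativeRing.refl R) (ℕₚ.*-zeroʳ M)) (sym 𝟏≐·q^)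

    -- The Gaussian binomial in base q^M, through the Pascal rule that involves no subtraction.
    qbin : ℕ → ℕ → PowerSeries
    qbin K       zero    = 𝟏
    qbin zero    (suc i) = 𝟘
    qbin (suc K) (suc i) = qbin K i ⊕ Q (suc i) ⊗ qbin K (suc i)

    qbin-zero : ∀ {K i} → K ℕ.< i → qbin K i ≐ 𝟘
    qbin-zero {zero}  {suc i} _           = refl
    qbin-zero {suc K} {suc i} (ℕ.s≤s K<i) =
      trans (+-cong (qbin-zero K<i) (*-congˡ (qbin-zero (ℕₚ.m<n⇒m<1+n K<i))))
            (trans (R⟦q⟧.+-identityˡ _) (R⟦q⟧.zeroʳ _))

    qbin-self : ∀ K → qbin K K ≐ 𝟏
    qbin-self zero    = refl
    qbin-self (suc K) =
      trans (+-cong (qbin-self K) (trans (*-congˡ (qbin-zero {K} {suc K} ℕₚ.≤-refl)) (R⟦q⟧.zeroʳ _)))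
            (R⟦q⟧.+-identityʳ _)

    -- The companion Pascal rule. Each rule serves one side of the triple product. After both terms
    -- are expanded by induction, the two contributions of `qbin K (suc i)` with a power of `q`
    -- agree, as both powers total `Q (suc K)`.
    qbin-pascal : ∀ K i → qbin (suc K) (suc i) ≐ qbin K (suc i) ⊕ Q (K ∸ i) ⊗ qbin K i
    qbin-pascal zero zero = begin
      𝟏 ⊕ Q 1 ⊗ 𝟘   ≈⟨ +-congˡ (R⟦q⟧.zeroʳ _) ⟩
      𝟏 ⊕ 𝟘         ≈⟨ R⟦q⟧.+-comm _ _ ⟩
      𝟘 ⊕ 𝟏         ≈⟨ +-congˡ (trans (R⟦q⟧.*-identityʳ _) Q-0) ⟨
      𝟘 ⊕ Q 0 ⊗ 𝟏   ∎
    qbin-pascal zero (suc i) = +-congˡ (trans (R⟦q⟧.zeroʳ _) (sym (R⟦q⟧.zeroʳ _)))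
    qbin-pascal (suc K) zero = begin
      𝟏 ⊕ Q 1 ⊗ qbin (suc K) 1
        ≈⟨ +-congˡ (*-congˡ (qbin-pascal K 0)) ⟩
      𝟏 ⊕ Q 1 ⊗ (qbin K 1 ⊕ Q K ⊗ 𝟏)
        ≈⟨ +-congˡ (R⟦q⟧.distribˡ _ _ _) ⟩
      𝟏 ⊕ (Q 1 ⊗ qbin K 1 ⊕ Q 1 ⊗ (Q K ⊗ 𝟏))
        ≈⟨ R⟦q⟧.+-assoc _ _ _ ⟨
      (𝟏 ⊕ Q 1 ⊗ qbin K 1) ⊕ Q 1 ⊗ (Q K ⊗ 𝟏)
        ≈⟨ +-congˡ (trans (sym (R⟦q⟧.*-assoc _ _ _)) (*-congʳ (Q-+ 1 K))) ⟩
      qbin (suc K) 1 ⊕ Q (suc K) ⊗ 𝟏 ∎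
    qbin-pascal (suc K) (suc i) = begin
      qbin (suc K) (suc i) ⊕ Q (2 ℕ.+ i) ⊗ qbin (suc K) (2 ℕ.+ i)
        ≈⟨ +-cong (qbin-pascal K i) (*-congˡ (qbin-pascal K (suc i))) ⟩
      (b₁ ⊕ Q (K ∸ i) ⊗ b₀) ⊕ Q (2 ℕ.+ i) ⊗ (b₂ ⊕ Q (K ∸ suc i) ⊗ b₁)
        ≈⟨ +-congˡ (R⟦q⟧.distribˡ _ _ _) ⟩
      (b₁ ⊕ Q (K ∸ i) ⊗ b₀) ⊕ (Q (2 ℕ.+ i) ⊗ b₂ ⊕ Q (2 ℕ.+ i) ⊗ (Q (K ∸ suc i) ⊗ b₁))
        ≈⟨ interchange _ _ _ _ ⟩
      (b₁ ⊕ Q (2 ℕ.+ i) ⊗ b₂) ⊕ (Q (K ∸ i) ⊗ b₀ ⊕ Q (2 ℕ.+ i) ⊗ (Q (K ∸ suc i) ⊗ b₁))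
        ≈⟨ +-congˡ (+-congˡ (exchange (i ℕₚ.<? K))) ⟩
      (b₁ ⊕ Q (2 ℕ.+ i) ⊗ b₂) ⊕ (Q (K ∸ i) ⊗ b₀ ⊕ Q (K ∸ i) ⊗ (Q (suc i) ⊗ b₁))
        ≈⟨ +-congˡ (R⟦q⟧.distribˡ _ _ _) ⟨
      qbin (suc K) (2 ℕ.+ i) ⊕ Q (K ∸ i) ⊗ qbin (suc K) (suc i) ∎
      where
      b₀ = qbin K i
      b₁ = qbin K (suc i)
      b₂ = qbin K (2 ℕ.+ i)
      exponents : i ℕ.< K → 2 ℕ.+ i ℕ.+ (K ∸ suc i) ≡ K ∸ i ℕ.+ suc i
      exponents i<K = ≡.trans (≡.cong suc (ℕₚ.m+[n∸m]≡n i<K))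
        (≡.trans (≡.cong suc (≡.sym (ℕₚ.m∸n+n≡m (ℕₚ.<⇒≤ i<K)))) (≡.sym (ℕₚ.+-suc (K ∸ i) i)))
      exchange : _ → Q (2 ℕ.+ i) ⊗ (Q (K ∸ suc i) ⊗ b₁) ≐ Q (K ∸ i) ⊗ (Q (suc i) ⊗ b₁)
      exchange (yes i<K) = begin
        Q (2 ℕ.+ i) ⊗ (Q (K ∸ suc i) ⊗ b₁)   ≈⟨ R⟦q⟧.*-assoc _ _ _ ⟨
        Q (2 ℕ.+ i) ⊗ Q (K ∸ suc i) ⊗ b₁     ≈⟨ *-congʳ (Q-+ _ _) ⟩
        Q (2 ℕ.+ i ℕ.+ (K ∸ suc i)) ⊗ b₁     ≡⟨ ≡.cong (λ e → Q e ⊗ b₁) (exponents i<K) ⟩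
        Q (K ∸ i ℕ.+ suc i) ⊗ b₁             ≈⟨ *-congʳ (Q-+ _ _) ⟨
        Q (K ∸ i) ⊗ Q (suc i) ⊗ b₁           ≈⟨ R⟦q⟧.*-assoc _ _ _ ⟩
        Q (K ∸ i) ⊗ (Q (suc i) ⊗ b₁)         ∎
      -- For `i ≥ K` truncated subtraction spoils the count of exponents, but then `b₁` is 0.
      exchange (no i≮K) = trans (vanishing _ _) (sym (vanishing _ _))
        where
        vanishing : ∀ x y → x ⊗ (y ⊗ b₁) ≐ 𝟘
        vanishing x y = trans (*-congˡ (trans (*-congˡ (qbin-zero (ℕ.s≤s (ℕₚ.≮⇒≥ i≮K)))) (R⟦q⟧.zeroʳ y)))
                              (R⟦q⟧.zeroʳ x)

    factorial : ℕ → PowerSeries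
    factorial = poch 1# M M

    factorial-suc : ∀ k → factorial (suc k) ≐ factorial k ⊗ (𝟏 ⊕ ⊝ Q (suc k))
    factorial-suc k = *-congˡ (+-congˡ (trans (·q^-neg _ _)
      (R⟦q⟧.-‿cong (·q^-cong (CommutativeRing.refl R) (≡.sym (ℕₚ.*-suc M k))))))

    -- The quotient formula without division. With Q = q^M, the induction rests on (1 - Q^(m+1)) +
    -- Q^(m+1) (1 - Q^(n+1)) = 1 - Q^(m+n+2), which is `telescope`.
    qbin-factorial : ∀ m n → qbin (m ℕ.+ n) m ⊗ (factorial m ⊗ factorial n) ≐ factorial (m ℕ.+ n)
    qbin-factorial zero n = trans (R⟦q⟧.*-identityˡ _) (R⟦q⟧.*-identityˡ _)
    qbin-factorial (suc m) zero rewrite ℕₚ.+-identityʳ m =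
      trans (*-cong (qbin-self (suc m)) (R⟦q⟧.*-identityʳ _)) (R⟦q⟧.*-identityˡ _)
    qbin-factorial (suc m) (suc n) = begin
      (A ⊕ Qm ⊗ B) ⊗ (factorial (suc m) ⊗ factorial (suc n))
        ≈⟨ *-congˡ (*-cong (factorial-suc m) (factorial-suc n)) ⟩
      (A ⊕ Qm ⊗ B) ⊗ ((p ⊗ dm) ⊗ (r ⊗ dn))
        ≈⟨ R⟦q⟧.distribʳ _ _ _ ⟩
      A ⊗ ((p ⊗ dm) ⊗ (r ⊗ dn)) ⊕ Qm ⊗ B ⊗ ((p ⊗ dm) ⊗ (r ⊗ dn))
        ≈⟨ +-cong
             (solve 5 (λ A p dm r dn → A ∙ ((p ∙ dm) ∙ (r ∙ dn)) ⊜ (A ∙ (p ∙ (r ∙ dn))) ∙ dm)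
                    refl A p dm r dn)
             (solve 6 (λ Q B p dm r dn → (Q ∙ B) ∙ ((p ∙ dm) ∙ (r ∙ dn))
                                         ⊜ (B ∙ ((p ∙ dm) ∙ r)) ∙ (Q ∙ dn))
                    refl Qm B p dm r dn) ⟩
      (A ⊗ (p ⊗ (r ⊗ dn))) ⊗ dm ⊕ (B ⊗ ((p ⊗ dm) ⊗ r)) ⊗ (Qm ⊗ dn)
        ≈⟨ +-cong
             (*-congʳ (trans (*-congˡ (*-congˡ (sym (factorial-suc n)))) (qbin-factorial m (suc n))))
             (*-congʳ (trans (*-congˡ (*-congʳ (sym (factorial-suc m)))) other)) ⟩
      Z ⊗ dm ⊕ Z ⊗ (Qm ⊗ dn)
        ≈⟨ R⟦q⟧.distribˡ _ _ _ ⟨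
      Z ⊗ (dm ⊕ Qm ⊗ dn)
        ≈⟨ *-congˡ telescope ⟩
      Z ⊗ (𝟏 ⊕ ⊝ Q (suc (m ℕ.+ suc n)))
        ≈⟨ factorial-suc (m ℕ.+ suc n) ⟨
      factorial (suc (m ℕ.+ suc n)) ∎
      where
      open import Algebra.Properties.Ring R⟦q⟧.ring using (-‿distribʳ-*)
      A = qbin (m ℕ.+ suc n) m
      B = qbin (m ℕ.+ suc n) (suc m)
      Z = factorial (m ℕ.+ suc n)
      p = factorial m
      r = factorial n
      Qm = Q (suc m)
      Qn = Q (suc n)
      dm = 𝟏 ⊕ ⊝ Qm
      dn = 𝟏 ⊕ ⊝ Qn
      other : B ⊗ (factorial (suc m) ⊗ r) ≐ Z
      other rewrite ℕₚ.+-suc m n = qbin-factorial (suc m) n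
      telescope : dm ⊕ Qm ⊗ dn ≐ 𝟏 ⊕ ⊝ Q (suc m ℕ.+ suc n)
      telescope = begin
        (𝟏 ⊕ ⊝ Qm) ⊕ Qm ⊗ (𝟏 ⊕ ⊝ Qn)
          ≈⟨ +-congˡ (trans (R⟦q⟧.distribˡ _ _ _)
               (+-cong (R⟦q⟧.*-identityʳ _) (trans (sym (-‿distribʳ-* _ _)) (R⟦q⟧.-‿cong (Q-+ _ _))))) ⟩
        (𝟏 ⊕ ⊝ Qm) ⊕ (Qm ⊕ ⊝ Q (suc m ℕ.+ suc n))
          ≈⟨ R⟦q⟧.+-assoc _ _ _ ⟩
        𝟏 ⊕ (⊝ Qm ⊕ (Qm ⊕ ⊝ Q (suc m ℕ.+ suc n)))
          ≈⟨ +-congˡ (R⟦q⟧.+-assoc _ _ _) ⟨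
        𝟏 ⊕ ((⊝ Qm ⊕ Qm) ⊕ ⊝ Q (suc m ℕ.+ suc n))
          ≈⟨ +-congˡ (trans (+-congʳ (R⟦q⟧.-‿inverseˡ Qm)) (R⟦q⟧.+-identityˡ _)) ⟩
        𝟏 ⊕ ⊝ Q (suc m ℕ.+ suc n) ∎

    qbinSum : ℕ → (ℕ → PowerSeries) → PowerSeries
    qbinSum K t = sumBelow (suc K) (λ i → qbin K i ⊗ t i)

    private
      -- What the two Pascal rules share: the summands split into an unshifted part `w` and a
      -- shifted part `v`, and the surplus index `suc K` of the unshifted part carries a zero
      -- binomial.
      qbinSum-step : ∀ K (t w v : ℕ → PowerSeries) → t 0 ≐ w 0 →
        (∀ i → qbin (suc K) (suc i) ⊗ t (suc i) ≐ qbin K (suc i) ⊗ w (suc i) ⊕ qbin K i ⊗ v i) →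
        qbinSum (suc K) t ≐ qbinSum K (λ i → w i ⊕ v i)
      qbinSum-step K t w v t₀ tᵢ = begin
        qbinSum (suc K) t
          ≈⟨ sumBelow-first _ _ ⟩
        𝟏 ⊗ t 0 ⊕ sumBelow (suc K) (λ i → qbin (suc K) (suc i) ⊗ t (suc i))
          ≈⟨ +-cong (*-congˡ t₀)
               (trans (sumBelow-cong (suc K) (λ {i} _ → tᵢ i)) (sumBelow-⊕ (suc K) _ _)) ⟩
        𝟏 ⊗ w 0 ⊕ (sumBelow (suc K) (λ i → qbin K (suc i) ⊗ w (suc i)) ⊕ qbinSum K v)
          ≈⟨ R⟦q⟧.+-assoc _ _ _ ⟨
        (𝟏 ⊗ w 0 ⊕ sumBelow (suc K) (λ i → qbin K (suc i) ⊗ w (suc i))) ⊕ qbinSum K v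
          ≈⟨ +-congʳ (sumBelow-first _ (λ i → qbin K i ⊗ w i)) ⟨
        sumBelow (2 ℕ.+ K) (λ i → qbin K i ⊗ w i) ⊕ qbinSum K v
          ≈⟨ +-congʳ (trans (sumBelow-last (suc K) _)
               (trans (+-congˡ (trans (*-congʳ (qbin-zero {K} {suc K} ℕₚ.≤-refl)) (R⟦q⟧.zeroˡ _)))
                      (R⟦q⟧.+-identityʳ _))) ⟩
        qbinSum K w ⊕ qbinSum K v
          ≈⟨ sumBelow-⊕ (suc K) _ _ ⟨
        sumBelow (suc K) (λ i → qbin K i ⊗ w i ⊕ qbin K i ⊗ v i)
          ≈⟨ sumBelow-cong (suc K) (λ _ → sym (R⟦q⟧.distribˡ _ _ _)) ⟩
        qbinSum K (λ i → w i ⊕ v i) ∎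

    qbinSum-pascalʳ : ∀ K t →
      qbinSum (suc K) t ≐ qbinSum K (λ i → t i ⊕ Q (K ∸ i) ⊗ t (suc i))
    qbinSum-pascalʳ K t = qbinSum-step K t t (λ i → Q (K ∸ i) ⊗ t (suc i)) refl λ i →
      trans (*-congʳ (qbin-pascal K i)) (trans (R⟦q⟧.distribʳ _ _ _)
        (+-congˡ (solve 3 (λ a b c → (a ∙ b) ∙ c ⊜ b ∙ (a ∙ c)) refl _ _ _)))

    qbinSum-pascalˡ : ∀ K t → qbinSum (suc K) t ≐ qbinSum K (λ i → Q i ⊗ t i ⊕ t (suc i))
    qbinSum-pascalˡ K t = qbinSum-step K t (λ i → Q i ⊗ t i) (t ∘ suc)
      (sym (trans (*-congʳ Q-0) (R⟦q⟧.*-identityˡ _))) λ i →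
      trans (R⟦q⟧.distribʳ _ _ _) (trans (R⟦q⟧.+-comm _ _)
        (+-congʳ (solve 3 (λ a b c → (a ∙ b) ∙ c ⊜ b ∙ (a ∙ c)) refl _ _ _)))

-- The Jacobi triple product.

suc-⊖ : ∀ i n → suc i ℤ.⊖ n ≡ 1ℤ ℤ.+ (i ℤ.⊖ n)
suc-⊖ i n = ≡.trans (≡.sym (ℤₚ.m-n≡m⊖n (suc i) n))
  (≡.trans (ℤₚ.+-assoc 1ℤ (+ i) (ℤ.- + n)) (≡.cong (λ z → 1ℤ ℤ.+ z) (ℤₚ.m-n≡m⊖n i n)))

-- Choosing the new monomial of the `m`-th x-factor moves the theta index from `j` to `1 + j`. For
-- `j = i - n` the surplus power is `Q (m + n - i)`, the weight in `qbin-pascal`.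
E-shift-up : ∀ a b j m {d} → + d ≡ + m ℤ.- j →
  E a b j ℕ.+ (a ℕ.+ (a ℕ.+ b) ℕ.* m) ≡ (a ℕ.+ b) ℕ.* d ℕ.+ E a b (1ℤ ℤ.+ j)
E-shift-up a b j m {d} d≡ = twice-injective (begin
  twice (E a b j ℕ.+ (a ℕ.+ (a ℕ.+ b) ℕ.* m))
    ≡⟨ twice-+ (E a b j) _ ⟩
  twice (E a b j) ℤ.+ twice (a ℕ.+ (a ℕ.+ b) ℕ.* m)
    ≡⟨ ≡.cong₂ ℤ._+_ (twice-E a b j)
         (≡.trans (twice-+ a _) (≡.cong (λ z → twice a ℤ.+ z) (twice-* (a ℕ.+ b) m))) ⟩
  E₂ (+ a) (+ b) j ℤ.+ (twice a ℤ.+ (+ a ℤ.+ + b) ℤ.* twice m)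
    ≡⟨ solveℤ 4 (λ a b j m →
         let e = λ n → a :* (n :* n :+ n) :+ b :* (:- n :* :- n :+ :- n) in
         e j :+ ((a :+ a) :+ (a :+ b) :* (m :+ m))
         := (a :+ b) :* ((m :+ :- j) :+ (m :+ :- j)) :+ e (con 1ℤ :+ j)) ≡.refl (+ a) (+ b) j (+ m) ⟩
  (+ a ℤ.+ + b) ℤ.* ((+ m ℤ.- j) ℤ.+ (+ m ℤ.- j)) ℤ.+ E₂ (+ a) (+ b) (1ℤ ℤ.+ j)
    ≡⟨ ≡.cong (λ z → (+ a ℤ.+ + b) ℤ.* (z ℤ.+ z) ℤ.+ E₂ (+ a) (+ b) (1ℤ ℤ.+ j)) d≡ ⟨
  (+ a ℤ.+ + b) ℤ.* twice d ℤ.+ E₂ (+ a) (+ b) (1ℤ ℤ.+ j)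
    ≡⟨ ≡.cong₂ ℤ._+_ (twice-* (a ℕ.+ b) d) (twice-E a b (1ℤ ℤ.+ j)) ⟨
  twice ((a ℕ.+ b) ℕ.* d) ℤ.+ twice (E a b (1ℤ ℤ.+ j))
    ≡⟨ twice-+ ((a ℕ.+ b) ℕ.* d) _ ⟨
  twice ((a ℕ.+ b) ℕ.* d ℕ.+ E a b (1ℤ ℤ.+ j)) ∎)
  where
  open ≡.≡-Reasoning

-- Choosing the new monomial of a y-factor lowers the index instead, and the surplus `Q i` is the
-- weight in the defining Pascal rule.
E-shift-down : ∀ a b j n {i} → + i ≡ (1ℤ ℤ.+ j) ℤ.+ + n →
  E a b (1ℤ ℤ.+ j) ℕ.+ (b ℕ.+ (a ℕ.+ b) ℕ.* n) ≡ (a ℕ.+ b) ℕ.* i ℕ.+ E a b j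
E-shift-down a b j n {i} i≡ = twice-injective (begin
  twice (E a b (1ℤ ℤ.+ j) ℕ.+ (b ℕ.+ (a ℕ.+ b) ℕ.* n))
    ≡⟨ twice-+ (E a b (1ℤ ℤ.+ j)) _ ⟩
  twice (E a b (1ℤ ℤ.+ j)) ℤ.+ twice (b ℕ.+ (a ℕ.+ b) ℕ.* n)
    ≡⟨ ≡.cong₂ ℤ._+_ (twice-E a b (1ℤ ℤ.+ j))
         (≡.trans (twice-+ b _) (≡.cong (λ z → twice b ℤ.+ z) (twice-* (a ℕ.+ b) n))) ⟩
  E₂ (+ a) (+ b) (1ℤ ℤ.+ j) ℤ.+ (twice b ℤ.+ (+ a ℤ.+ + b) ℤ.* twice n)
    ≡⟨ solveℤ 4 (λ a b j n →
         let e = λ n → a :* (n :* n :+ n) :+ b :* (:- n :* :- n :+ :- n)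
             i = (con 1ℤ :+ j) :+ n in
         e (con 1ℤ :+ j) :+ ((b :+ b) :+ (a :+ b) :* (n :+ n))
         := (a :+ b) :* (i :+ i) :+ e j) ≡.refl (+ a) (+ b) j (+ n) ⟩
  (+ a ℤ.+ + b) ℤ.* (((1ℤ ℤ.+ j) ℤ.+ + n) ℤ.+ ((1ℤ ℤ.+ j) ℤ.+ + n)) ℤ.+ E₂ (+ a) (+ b) j
    ≡⟨ ≡.cong (λ z → (+ a ℤ.+ + b) ℤ.* (z ℤ.+ z) ℤ.+ E₂ (+ a) (+ b) j) i≡ ⟨
  (+ a ℤ.+ + b) ℤ.* twice i ℤ.+ E₂ (+ a) (+ b) j
    ≡⟨ ≡.cong₂ ℤ._+_ (twice-* (a ℕ.+ b) i) (twice-E a b j) ⟨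
  twice ((a ℕ.+ b) ℕ.* i) ℤ.+ twice (E a b j)
    ≡⟨ twice-+ ((a ℕ.+ b) ℕ.* i) _ ⟨
  twice ((a ℕ.+ b) ℕ.* i ℕ.+ E a b j) ∎)
  where
  open ≡.≡-Reasoning

∸≡-⊖ : ∀ m n {i} → i ℕ.≤ m ℕ.+ n → + (m ℕ.+ n ∸ i) ≡ + m ℤ.- (i ℤ.⊖ n)
∸≡-⊖ m n {i} i≤K = begin
  + (m ℕ.+ n ∸ i)          ≡⟨ ℤₚ.⊖-≥ i≤K ⟨
  (m ℕ.+ n) ℤ.⊖ i          ≡⟨ ℤₚ.m-n≡m⊖n (m ℕ.+ n) i ⟨
  (+ m ℤ.+ + n) ℤ.- + i    ≡⟨ solveℤ 3 (λ m n i → (m :+ n) :+ :- i := m :+ :- (i :+ :- n))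
                                     ≡.refl (+ m) (+ n) (+ i) ⟩
  + m ℤ.- (+ i ℤ.- + n)    ≡⟨ ≡.cong (λ z → + m ℤ.- z) (ℤₚ.m-n≡m⊖n i n) ⟩
  + m ℤ.- (i ℤ.⊖ n)        ∎
  where
  open ≡.≡-Reasoning

-- As `i` and `d` lie symmetrically about `N`, their minimum is `N` minus the distance of `i` from
-- `N`. This is the count of precision in the triple product: what the binomial loses, the theta
-- term regains.
⊓+∣⊖∣ : ∀ N i d → i ℕ.+ d ≡ N ℕ.+ N → N ℕ.≤ (i ℕ.⊓ d) ℕ.+ ∣ i ℤ.⊖ N ∣
⊓+∣⊖∣ N i d i+d≡ = ≡.subst (N ℕ.≤_) (≡.sym (ℕₚ.+-distribʳ-⊓ ∣ i ℤ.⊖ N ∣ i d))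
  (ℕₚ.⊓-glb (bound i) (≡.subst (λ e → N ℕ.≤ d ℕ.+ e) sym-eq (bound d)))
  where
  bound : ∀ i → N ℕ.≤ i ℕ.+ ∣ i ℤ.⊖ N ∣
  bound i with i ℕₚ.≤? N
  ... | yes i≤N rewrite ℤₚ.∣⊖∣-≤ i≤N = ℕₚ.≤-reflexive (≡.sym (ℕₚ.m+[n∸m]≡n i≤N))
  ... | no i≰N = ℕₚ.≤-trans (ℕₚ.<⇒≤ (ℕₚ.≰⇒> i≰N)) (ℕₚ.m≤m+n i _)
  sym-eq : ∣ d ℤ.⊖ N ∣ ≡ ∣ i ℤ.⊖ N ∣
  sym-eq = ≡.trans (ℤₚ.∣m⊖n∣≡∣n⊖m∣ d N) (≡.cong ∣_∣ (begin
    N ℤ.⊖ d                       ≡⟨ ℤₚ.+-cancelˡ-⊖ i N d ⟨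
    (i ℕ.+ N) ℤ.⊖ (i ℕ.+ d)       ≡⟨ ≡.cong₂ ℤ._⊖_ (ℕₚ.+-comm i N) i+d≡ ⟩
    (N ℕ.+ i) ℤ.⊖ (N ℕ.+ N)       ≡⟨ ℤₚ.+-cancelˡ-⊖ N i N ⟩
    i ℤ.⊖ N                       ∎))
    where open ≡.≡-Reasoning

module JacobiTripleProduct {c ℓ} (R : CommutativeRing c ℓ)
  (X X⁻¹ : CommutativeRing.Carrier R)
  (XX⁻¹≈1 : CommutativeRing._≈_ R (CommutativeRing._*_ R X X⁻¹) (CommutativeRing.1# R)) where

  private module R = CommutativeRing R
  open R using (Carrier; _≈_; 1#)
  open PowerSeries R using (PowerSeries)
  open PowerSeriesRing R
  open Products R
  open GaussianBinomials R
  private module C = Coefficients R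

  coefficient : ℤ → ℤ → Carrier
  coefficient = C.coefficient X X⁻¹ XX⁻¹≈1

  coefficient-+ : ∀ s x s′ x′ →
    coefficient s x R.* coefficient s′ x′ ≈ coefficient (s ℤ.+ s′) (x ℤ.+ x′)
  coefficient-+ = C.coefficient-+ X X⁻¹ XX⁻¹≈1

  coefficient-period : ∀ h s x → coefficient (h ℤ.+ h ℤ.+ s) x ≈ coefficient s x
  coefficient-period = C.coefficient-period X X⁻¹ XX⁻¹≈1

  coefficient-neg : ∀ s x → coefficient (1ℤ ℤ.+ s) x ≈ R.- coefficient s x
  coefficient-neg = C.coefficient-neg X X⁻¹ XX⁻¹≈1

  coefficient-1 : coefficient 0ℤ 0ℤ ≈ 1#
  coefficient-1 = C.coefficient-1 X X⁻¹ XX⁻¹≈1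

  open Sums R coefficient coefficient-+ public
  open R⟦q⟧ using (refl; sym; trans; +-cong; +-congˡ; +-congʳ; *-cong; *-congˡ; *-congʳ)

  ⟦⟧-cong : ∀ h {t u} → sgn t ≡ h ℤ.+ h ℤ.+ sgn u → xp t ≡ xp u → qp t ≡ qp u → ⟦ t ⟧ ≐ ⟦ u ⟧
  ⟦⟧-cong h {t} {u} s≡ x≡ e≡ =
    ·q^-cong (R.trans (R.reflexive (≡.cong₂ coefficient s≡ x≡))
                      (coefficient-period h (sgn u) (xp u))) e≡

  ⟦⟧-≡ : ∀ {t u} → sgn t ≡ sgn u → xp t ≡ xp u → qp t ≡ qp u → ⟦ t ⟧ ≐ ⟦ u ⟧
  ⟦⟧-≡ {t} {u} s≡ x≡ e≡ = ·q^-cong (R.reflexive (≡.cong₂ coefficient s≡ x≡)) e≡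

  opaque
    unfolding finiteSum sumBelow

    finiteSum-upTo : ∀ {I : Set} (t : I → PowerSeries) (g : ℕ → I) (h : ℕ → ℕ) n →
                     finiteSum t (map g (applyUpTo h n)) ≐ sumBelow n (t ∘ g ∘ h)
    finiteSum-upTo t g h zero    = refl
    finiteSum-upTo t g h (suc n) = +-congˡ (finiteSum-upTo t g (h ∘ suc) n)

  module _ (s l : ℤ) (a b : ℕ) .{{_ : NonZero a}} where

    private
      M = a ℕ.+ b

      θ : ℤ → PowerSeries
      θ j = ⟦ term (theta s l a b) j ⟧

      Q≐ : ∀ d → Q M d ≐ ⟦ ⟨ 0ℤ , 0ℤ , M ℕ.* d ⟩ ⟧
      Q≐ d = ·q^-cong (R.sym coefficient-1) ≡.refl

      θ-up : ∀ j m {d} → + d ≡ + m ℤ.- j →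
             θ j ⊗ coefficient s l ·q^ (a ℕ.+ M ℕ.* m) ≐ Q M d ⊗ θ (1ℤ ℤ.+ j)
      θ-up j m {d} d≡ = trans (⟦⊙⟧ (term (theta s l a b) j) ⟨ s , l , a ℕ.+ M ℕ.* m ⟩)
        (trans (⟦⟧-≡ (lemma s j) (lemma l j) (E-shift-up a b j m d≡))
               (sym (trans (*-congʳ (Q≐ d))
                           (⟦⊙⟧ ⟨ 0ℤ , 0ℤ , M ℕ.* d ⟩ (term (theta s l a b) (1ℤ ℤ.+ j))))))
        where
        lemma : ∀ s j → s ℤ.* j ℤ.+ s ≡ 0ℤ ℤ.+ s ℤ.* (1ℤ ℤ.+ j)
        lemma = solveℤ 2 (λ s j → s :* j :+ s := con 0ℤ :+ s :* (con 1ℤ :+ j)) ≡.refl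

      θ-down : ∀ j n {i} → + i ≡ (1ℤ ℤ.+ j) ℤ.+ + n →
               θ (1ℤ ℤ.+ j) ⊗ coefficient (ℤ.- s) (ℤ.- l) ·q^ (b ℕ.+ M ℕ.* n) ≐ Q M i ⊗ θ j
      θ-down j n {i} i≡ = trans
        (⟦⊙⟧ (term (theta s l a b) (1ℤ ℤ.+ j)) ⟨ ℤ.- s , ℤ.- l , b ℕ.+ M ℕ.* n ⟩)
        (trans (⟦⟧-≡ (lemma s j) (lemma l j) (E-shift-down a b j n i≡))
               (sym (trans (*-congʳ (Q≐ i)) (⟦⊙⟧ ⟨ 0ℤ , 0ℤ , M ℕ.* i ⟩ (term (theta s l a b) j)))))
        where
        lemma : ∀ s j → s ℤ.* (1ℤ ℤ.+ j) ℤ.+ ℤ.- s ≡ 0ℤ ℤ.+ s ℤ.* j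
        lemma = solveℤ 2 (λ s j → s :* (con 1ℤ :+ j) :+ :- s := con 0ℤ :+ s :* j) ≡.refl

    module _ {x y : Carrier} (-x≈ : R.- x ≈ coefficient s l)
             (-y≈ : R.- y ≈ coefficient (ℤ.- s) (ℤ.- l)) where

      open ≐-Reasoning

      -- A form of the q-binomial theorem, with the summation index centred at `n` so that each term
      -- has a limit. The y-factors are attached first, then the x-factors, one at a time.
      finite-triple-product : ∀ m n →
        poch x a M m ⊗ poch y b M n ≐ qbinSum M (m ℕ.+ n) (λ i → θ (i ℤ.⊖ n))
      finite-triple-product zero zero = begin
        𝟏 ⊗ 𝟏                           ≈⟨ *-congˡ 𝟏≐θ₀ ⟩
        𝟏 ⊗ θ 0ℤ                        ≈⟨ sumBelow-1 _ ⟨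
        qbinSum M 0 (λ i → θ (i ℤ.⊖ 0)) ∎
        where
        𝟏≐θ₀ : 𝟏 ≐ θ 0ℤ
        𝟏≐θ₀ = trans 𝟏≐·q^ (·q^-cong
          (R.trans (R.sym coefficient-1)
            (R.reflexive (≡.sym (≡.cong₂ coefficient (ℤₚ.*-zeroʳ s) (ℤₚ.*-zeroʳ l)))))
          (≡.sym (E-0 a b)))
      finite-triple-product zero (suc n) = begin
        𝟏 ⊗ (poch y b M n ⊗ (𝟏 ⊕ (R.- y) ·q^ (b ℕ.+ M ℕ.* n)))
          ≈⟨ R⟦q⟧.*-assoc _ _ _ ⟨
        (𝟏 ⊗ poch y b M n) ⊗ (𝟏 ⊕ (R.- y) ·q^ (b ℕ.+ M ℕ.* n))
          ≈⟨ *-cong (finite-triple-product zero n) (+-congˡ (·q^-cong -y≈ ≡.refl)) ⟩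
        qbinSum M n (λ i → θ (i ℤ.⊖ n)) ⊗ (𝟏 ⊕ coefficient (ℤ.- s) (ℤ.- l) ·q^ (b ℕ.+ M ℕ.* n))
          ≈⟨ trans (sumBelow-⊗ (suc n) _ _) (sumBelow-cong (suc n) λ {i} _ →
               trans (R⟦q⟧.*-assoc _ _ _) (*-congˡ (summand i))) ⟩
        qbinSum M n (λ i → Q M i ⊗ θ (i ℤ.⊖ suc n) ⊕ θ (suc i ℤ.⊖ suc n))
          ≈⟨ qbinSum-pascalˡ M n (λ i → θ (i ℤ.⊖ suc n)) ⟨
        qbinSum M (suc n) (λ i → θ (i ℤ.⊖ suc n)) ∎
        where
        summand : ∀ i → θ (i ℤ.⊖ n) ⊗ (𝟏 ⊕ coefficient (ℤ.- s) (ℤ.- l) ·q^ (b ℕ.+ M ℕ.* n))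
                        ≐ Q M i ⊗ θ (i ℤ.⊖ suc n) ⊕ θ (suc i ℤ.⊖ suc n)
        summand i = begin
          θ (i ℤ.⊖ n) ⊗ (𝟏 ⊕ r)                  ≈⟨ R⟦q⟧.distribˡ _ _ _ ⟩
          θ (i ℤ.⊖ n) ⊗ 𝟏 ⊕ θ (i ℤ.⊖ n) ⊗ r      ≈⟨ R⟦q⟧.+-comm _ _ ⟩
          θ (i ℤ.⊖ n) ⊗ r ⊕ θ (i ℤ.⊖ n) ⊗ 𝟏      ≈⟨ +-cong down (R⟦q⟧.*-identityʳ _) ⟩
          Q M i ⊗ θ (i ℤ.⊖ suc n) ⊕ θ (i ℤ.⊖ n)
            ≡⟨ ≡.cong (λ j → Q M i ⊗ θ (i ℤ.⊖ suc n) ⊕ θ j) (ℤₚ.[1+m]⊖[1+n]≡m⊖n i n) ⟨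
          Q M i ⊗ θ (i ℤ.⊖ suc n) ⊕ θ (suc i ℤ.⊖ suc n) ∎
          where
          r = coefficient (ℤ.- s) (ℤ.- l) ·q^ (b ℕ.+ M ℕ.* n)
          j≡ : i ℤ.⊖ n ≡ 1ℤ ℤ.+ (i ℤ.⊖ suc n)
          j≡ = ≡.trans (≡.sym (ℤₚ.[1+m]⊖[1+n]≡m⊖n i n)) (suc-⊖ i (suc n))
          down : θ (i ℤ.⊖ n) ⊗ r ≐ Q M i ⊗ θ (i ℤ.⊖ suc n)
          down = trans (R⟦q⟧.reflexive (≡.cong (λ j → θ j ⊗ r) j≡))
            (θ-down (i ℤ.⊖ suc n) n (≡.trans (≡.sym (⊖-+ i n)) (≡.cong (λ j → j ℤ.+ + n) j≡)))
      finite-triple-product (suc m) n = begin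
        (poch x a M m ⊗ (𝟏 ⊕ (R.- x) ·q^ (a ℕ.+ M ℕ.* m))) ⊗ poch y b M n
          ≈⟨ xy∙z≈xz∙y _ _ _ ⟩
        (poch x a M m ⊗ poch y b M n) ⊗ (𝟏 ⊕ (R.- x) ·q^ (a ℕ.+ M ℕ.* m))
          ≈⟨ *-cong (finite-triple-product m n) (+-congˡ (·q^-cong -x≈ ≡.refl)) ⟩
        qbinSum M K (λ i → θ (i ℤ.⊖ n)) ⊗ (𝟏 ⊕ r)
          ≈⟨ trans (sumBelow-⊗ (suc K) _ _) (sumBelow-cong (suc K) λ {i} i≤K →
               trans (R⟦q⟧.*-assoc _ _ _) (*-congˡ (summand i (ℕ.s≤s⁻¹ i≤K)))) ⟩
        qbinSum M K (λ i → θ (i ℤ.⊖ n) ⊕ Q M (K ∸ i) ⊗ θ (suc i ℤ.⊖ n))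
          ≈⟨ qbinSum-pascalʳ M K (λ i → θ (i ℤ.⊖ n)) ⟨
        qbinSum M (suc K) (λ i → θ (i ℤ.⊖ n)) ∎
        where
        open import Algebra.Properties.CommutativeSemigroup R⟦q⟧.*-commutativeSemigroup
          using (xy∙z≈xz∙y)
        K = m ℕ.+ n
        r = coefficient s l ·q^ (a ℕ.+ M ℕ.* m)
        summand : ∀ i → i ℕ.≤ K → θ (i ℤ.⊖ n) ⊗ (𝟏 ⊕ r) ≐ θ (i ℤ.⊖ n) ⊕ Q M (K ∸ i) ⊗ θ (suc i ℤ.⊖ n)
        summand i i≤K = trans (R⟦q⟧.distribˡ _ _ _)
          (+-cong (R⟦q⟧.*-identityʳ _)
            (trans (θ-up (i ℤ.⊖ n) m (∸≡-⊖ m n i≤K))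
                   (R⟦q⟧.reflexive (≡.cong (λ j → Q M (K ∸ i) ⊗ θ j) (≡.sym (suc-⊖ i n))))))

      module _ .{{_ : NonZero b}} .{{_ : NonZero M}} where

        private
          φ = Poch 1# M M

          φ-unit : Unit φ
          φ-unit = Poch-unit 1# M M

          -- To this precision `φ` may replace each finite factorial. So `φ ⊗ φ` times the binomial
          -- becomes the factorial of `i + d`, which is again `φ`, and one `φ` cancels.
          φ⊗qbin : ∀ i d → φ ⊗ qbin M (i ℕ.+ d) i ≡ 𝟏 mod-q^ (i ℕ.⊓ d)
          φ⊗qbin i d = unit-cancelˡ-mod φ-unit (mod-trans
            (mod-trans (≐⇒mod (solve 2 (λ f g → f ∙ (f ∙ g) ⊜ g ∙ (f ∙ f)) refl φ _))
              (⊗-mod mod-refl (⊗-mod (approx i (ℕₚ.m⊓n≤m i d)) (approx d (ℕₚ.m⊓n≤n i d)))))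
            (mod-trans (≐⇒mod (qbin-factorial M i d))
              (mod-trans (mod-sym (approx (i ℕ.+ d) (ℕₚ.≤-trans (ℕₚ.m⊓n≤m i d) (ℕₚ.m≤m+n i d))))
                         (≐⇒mod (sym (R⟦q⟧.*-identityʳ φ))))))
            where
            open CommutativeMonoidSolver R⟦q⟧.*-commutativeMonoid using (solve; _⊜_)
              renaming (_⊕_ to infixl 7 _∙_)
            approx : ∀ k → i ℕ.⊓ d ℕ.≤ k → φ ≡ factorial M k mod-q^ (i ℕ.⊓ d)
            approx k r≤k = mod-weaken r≤k (mod-sym (poch-limit 1# M M k))

          φ-term : ∀ N {i} → i ℕ.< suc (N ℕ.+ N) →
            (qbin M (N ℕ.+ N) i ⊗ θ (i ℤ.⊖ N)) ⊗ φ ≡ θ (i ℤ.⊖ N) mod-q^ N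
          φ-term N {i} i<
            with d , i+d≡ ← ℕₚ.m≤n⇒∃[o]m+o≡n (ℕ.s≤s⁻¹ i<)
            rewrite ≡.sym i+d≡ = mod-trans
              (≐⇒mod (solve 3 (λ g t f → (g ∙ t) ∙ f ⊜ t ∙ (f ∙ g)) refl _ _ _))
              (mod-trans (mod-weaken bound (·q^⊗-mod _ _ (φ⊗qbin i d))) (≐⇒mod (R⟦q⟧.*-identityʳ _)))
            where
            open CommutativeMonoidSolver R⟦q⟧.*-commutativeMonoid using (solve; _⊜_)
              renaming (_⊕_ to infixl 7 _∙_)
            bound : N ℕ.≤ E a b (i ℤ.⊖ N) ℕ.+ (i ℕ.⊓ d)
            bound = ℕₚ.≤-trans (⊓+∣⊖∣ N i d i+d≡)
              (≡.subst (ℕ._≤ E a b (i ℤ.⊖ N) ℕ.+ (i ℕ.⊓ d)) (ℕₚ.+-comm ∣ i ℤ.⊖ N ∣ (i ℕ.⊓ d))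
                (ℕₚ.+-monoˡ-≤ (i ℕ.⊓ d) (∣n∣≤E a b (i ℤ.⊖ N))))

        triple-product : Poch x a M ⊗ Poch y b M ⊗ Poch 1# M M ≐ ∑ (theta s l a b)
        triple-product = mod⇒≐ λ N → mod-trans
          (mod-sym (⊗-mod (⊗-mod (poch-limit x a M N) (poch-limit y b M N)) mod-refl))
          (mod-trans (≐⇒mod (trans (*-congʳ (finite-triple-product N N)) (sumBelow-⊗ _ _ _)))
          (mod-trans (sumBelow-mod _ (φ-term N))
          (mod-trans (≐⇒mod (sym (finiteSum-upTo θ (ℤ._⊖ N) id _)))
                     (mod-sym (∑-covers (theta s l a b) N (integers-unique N , λ {n} e<N →
                        ∈-integers N n (ℕₚ.≤-trans (∣n∣≤E a b n) (ℕₚ.<⇒≤ e<N))))))))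

-- Bijections of the lattice ℤ².

ℤ² : Set
ℤ² = ℤ × ℤ

unhalve : ℤ ⊎ ℤ → ℤ
unhalve (inj₁ k) = k ℤ.+ k
unhalve (inj₂ k) = 1ℤ ℤ.+ (k ℤ.+ k)

halve : ℤ → ℤ ⊎ ℤ
halve z with z %ℕ 2
... | zero  = inj₁ (z /ℕ 2)
... | suc _ = inj₂ (z /ℕ 2)

unhalve-halve : ∀ z → unhalve (halve z) ≡ z
unhalve-halve z with z %ℕ 2 | n%ℕd<d z 2 | a≡a%ℕn+[a/ℕn]*n z 2
... | zero        | _ | z≡ = ≡.trans
  (solveℤ 1 (λ k → k :+ k := con 0ℤ :+ k :* con (+ 2)) ≡.refl (z /ℕ 2)) (≡.sym z≡)
... | suc zero    | _ | z≡ = ≡.trans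
  (solveℤ 1 (λ k → con 1ℤ :+ (k :+ k) := con 1ℤ :+ k :* con (+ 2)) ≡.refl (z /ℕ 2)) (≡.sym z≡)
... | suc (suc _) | ℕ.s≤s (ℕ.s≤s ()) | _

1+2n≢0 : ∀ k → 1ℤ ℤ.+ (k ℤ.+ k) ≢ 0ℤ
1+2n≢0 k p = absurd ∣ k ∣ (≡.trans (≡.sym (ℤₚ.abs-* (+ 2) k)) (≡.cong ∣_∣
  (≡.trans (solveℤ 1 (λ k → con (+ 2) :* k := (con 1ℤ :+ (k :+ k)) :+ con -1ℤ) ≡.refl k)
           (≡.cong (λ z → z ℤ.+ -1ℤ) p))))
  where
  absurd : ∀ n → 2 ℕ.* n ≢ 1
  absurd (suc n) p with () ← ≡.trans (≡.sym (ℕₚ.*-suc 2 n)) p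

double-injective : ∀ {k l} → k ℤ.+ k ≡ l ℤ.+ l → k ≡ l
double-injective {k} {l} p =
  ℤₚ.*-cancelˡ-≡ (+ 2) k l (≡.trans (dbl k) (≡.trans p (≡.sym (dbl l))))
  where
  dbl : ∀ k → + 2 ℤ.* k ≡ k ℤ.+ k
  dbl = solveℤ 1 (λ k → con (+ 2) :* k := k :+ k) ≡.refl

odd≢even : ∀ k l → 1ℤ ℤ.+ (k ℤ.+ k) ≢ l ℤ.+ l
odd≢even k l p = 1+2n≢0 (k ℤ.- l)
  (≡.trans (solveℤ 2 (λ k l → let d = k :+ :- l in
                       con 1ℤ :+ (d :+ d) := (con 1ℤ :+ (k :+ k)) :+ :- (l :+ l)) ≡.refl k l)
    (≡.trans (≡.cong (λ z → z ℤ.- (l ℤ.+ l)) p) (ℤₚ.+-inverseʳ (l ℤ.+ l))))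

unhalve-injective : ∀ s t → unhalve s ≡ unhalve t → s ≡ t
unhalve-injective (inj₁ k) (inj₁ l) p = ≡.cong inj₁ (double-injective p)
unhalve-injective (inj₁ k) (inj₂ l) p = contradiction (≡.sym p) (odd≢even l k)
unhalve-injective (inj₂ k) (inj₁ l) p = contradiction p (odd≢even k l)
unhalve-injective (inj₂ k) (inj₂ l) p = ≡.cong inj₂ (double-injective (ℤGroup.∙-cancelˡ 1ℤ _ _ p))

-- Injectivity of `unhalve` yields the second inverse law without computing quotients.
halve-unhalve : ∀ s → halve (unhalve s) ≡ s
halve-unhalve s = unhalve-injective _ s (unhalve-halve (unhalve s))

parity₁ : (ℤ² ⊎ ℤ²) ↔ ℤ²
parity₁ = mk↔ₛ′ to from to∘from from∘to
  where
  to : ℤ² ⊎ ℤ² → ℤ²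
  to (inj₁ (x , y)) = x ℤ.+ x , y
  to (inj₂ (x , y)) = 1ℤ ℤ.+ (x ℤ.+ x) , y
  from : ℤ² → ℤ² ⊎ ℤ²
  from (z , y) = [ (λ x → inj₁ (x , y)) , (λ x → inj₂ (x , y)) ]′ (halve z)
  to∘from : ∀ p → to (from p) ≡ p
  to∘from (z , y) with halve z | unhalve-halve z
  ... | inj₁ x | eq = ≡.cong (_, y) eq
  ... | inj₂ x | eq = ≡.cong (_, y) eq
  from∘to : ∀ p → from (to p) ≡ p
  from∘to (inj₁ (x , y)) rewrite halve-unhalve (inj₁ x) = ≡.refl
  from∘to (inj₂ (x , y)) rewrite halve-unhalve (inj₂ x) = ≡.refl

parity₂ : (ℤ² ⊎ ℤ²) ↔ ℤ²
parity₂ = mk↔ₛ′ to from to∘from from∘to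
  where
  to : ℤ² ⊎ ℤ² → ℤ²
  to (inj₁ (x , y)) = x , y ℤ.+ y
  to (inj₂ (x , y)) = x , 1ℤ ℤ.+ (y ℤ.+ y)
  from : ℤ² → ℤ² ⊎ ℤ²
  from (x , z) = [ (λ y → inj₁ (x , y)) , (λ y → inj₂ (x , y)) ]′ (halve z)
  to∘from : ∀ p → to (from p) ≡ p
  to∘from (x , z) with halve z | unhalve-halve z
  ... | inj₁ y | eq = ≡.cong (x ,_) eq
  ... | inj₂ y | eq = ≡.cong (x ,_) eq
  from∘to : ∀ p → from (to p) ≡ p
  from∘to (inj₁ (x , y)) rewrite halve-unhalve (inj₁ y) = ≡.refl
  from∘to (inj₂ (x , y)) rewrite halve-unhalve (inj₂ y) = ≡.refl

-- The sublattice m ≡ n modulo 2 and its translate by (1, 0). In these coordinates m² + n² stays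
-- diagonal, while m² + 3n² becomes 4(j² - jk + k²) and calls for one more parity split to complete
-- the square.
rotation : (ℤ² ⊎ ℤ²) ↔ ℤ²
rotation = mk↔ₛ′ to from to∘from from∘to
  where
  to : ℤ² ⊎ ℤ² → ℤ²
  to (inj₁ (j , k)) = j ℤ.+ k , j ℤ.- k
  to (inj₂ (j , k)) = 1ℤ ℤ.+ (j ℤ.+ k) , j ℤ.- k
  from : ℤ² → ℤ² ⊎ ℤ²
  from (m , n) = [ (λ k → inj₁ (n ℤ.+ k , k)) , (λ k → inj₂ (n ℤ.+ k , k)) ]′ (halve (m ℤ.- n))
  to∘from : ∀ p → to (from p) ≡ p
  to∘from (m , n) with halve (m ℤ.- n) | unhalve-halve (m ℤ.- n)
  ... | inj₁ k | eq = ×-≡,≡→≡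
    ( ≡.trans (solveℤ 2 (λ n k → (n :+ k) :+ k := n :+ (k :+ k)) ≡.refl n k)
        (≡.trans (≡.cong (λ z → n ℤ.+ z) eq) (solveℤ 2 (λ m n → n :+ (m :+ :- n) := m) ≡.refl m n))
    , solveℤ 2 (λ n k → (n :+ k) :+ :- k := n) ≡.refl n k )
  ... | inj₂ k | eq = ×-≡,≡→≡
    ( ≡.trans (solveℤ 2 (λ n k → con 1ℤ :+ ((n :+ k) :+ k) := n :+ (con 1ℤ :+ (k :+ k))) ≡.refl n k)
        (≡.trans (≡.cong (λ z → n ℤ.+ z) eq) (solveℤ 2 (λ m n → n :+ (m :+ :- n) := m) ≡.refl m n))
    , solveℤ 2 (λ n k → (n :+ k) :+ :- k := n) ≡.refl n k )
  from∘to : ∀ p → from (to p) ≡ p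
  from∘to (inj₁ (j , k))
    rewrite solveℤ 2 (λ j k → (j :+ k) :+ :- (j :+ :- k) := k :+ k) ≡.refl j k
          | halve-unhalve (inj₁ k) =
    ≡.cong (λ x → inj₁ (x , k)) (solveℤ 2 (λ j k → (j :+ :- k) :+ k := j) ≡.refl j k)
  from∘to (inj₂ (j , k))
    rewrite solveℤ 2 (λ j k → (con 1ℤ :+ (j :+ k)) :+ :- (j :+ :- k) := con 1ℤ :+ (k :+ k)) ≡.refl j k
          | halve-unhalve (inj₂ k) =
    ≡.cong (λ x → inj₂ (x , k)) (solveℤ 2 (λ j k → (j :+ :- k) :+ k := j) ≡.refl j k)

-- The shears complete squares; the reflections bring the remaining residue class to the same normal
-- form or exhibit a cancellation.
shear₁ shear₂ reflect₁ reflect₂ : (ℤ → ℤ) → ℤ² ↔ ℤ²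
shear₁ f = mk↔ₛ′ (λ (x , y) → f y ℤ.+ x , y) (λ (x , y) → ℤ.- f y ℤ.+ x , y)
  (λ (x , y) → ≡.cong (_, y) (solveℤ 2 (λ u x → u :+ (:- u :+ x) := x) ≡.refl (f y) x))
  (λ (x , y) → ≡.cong (_, y) (solveℤ 2 (λ u x → :- u :+ (u :+ x) := x) ≡.refl (f y) x))
shear₂ f = mk↔ₛ′ (λ (x , y) → x , f x ℤ.+ y) (λ (x , y) → x , ℤ.- f x ℤ.+ y)
  (λ (x , y) → ≡.cong (x ,_) (solveℤ 2 (λ u y → u :+ (:- u :+ y) := y) ≡.refl (f x) y))
  (λ (x , y) → ≡.cong (x ,_) (solveℤ 2 (λ u y → :- u :+ (u :+ y) := y) ≡.refl (f x) y))
reflect₁ f = mk↔ₛ′ r r involutive involutive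
  where
  r : ℤ² → ℤ²
  r (x , y) = f y ℤ.- x , y
  involutive : ∀ p → r (r p) ≡ p
  involutive (x , y) = ≡.cong (_, y) (solveℤ 2 (λ u x → u :+ :- (u :+ :- x) := x) ≡.refl (f y) x)
reflect₂ f = mk↔ₛ′ r r involutive involutive
  where
  r : ℤ² → ℤ²
  r (x , y) = x , f x ℤ.- y
  involutive : ∀ p → r (r p) ≡ p
  involutive (x , y) = ≡.cong (x ,_) (solveℤ 2 (λ u y → u :+ :- (u :+ :- y) := y) ≡.refl (f x) y)

-- Dissections of products of two theta series.

e₂ : ∀ {v} → ℕ → ℕ → Polynomial v → Polynomial v
e₂ a b n = con (+ a) :* (n :* n :+ n) :+ con (+ b) :* (:- n :* :- n :+ :- n)

module Dissections {c ℓ} (R : CommutativeRing c ℓ)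
  (X X⁻¹ : CommutativeRing.Carrier R)
  (XX⁻¹≈1 : CommutativeRing._≈_ R (CommutativeRing._*_ R X X⁻¹) (CommutativeRing.1# R)) where

  private module R = CommutativeRing R
  open PowerSeries R using (PowerSeries)
  open PowerSeriesRing R
  open Products R
  open JacobiTripleProduct R X X⁻¹ XX⁻¹≈1
  open R⟦q⟧ using (refl; sym; trans; +-cong; +-congˡ; +-congʳ; *-cong; *-congˡ; *-congʳ)

  -- sgn is an exponent of -1, so it only matters modulo 2.
  record _≈ᵐ_ (t u : Monomial) : Set where
    constructor match
    field
      h    : ℤ
      sgn≡ : sgn t ≡ h ℤ.+ h ℤ.+ sgn u
      xp≡  : xp t ≡ xp u
      qp≡  : qp t ≡ qp u

  ∑-≈ᵐ : ∀ {I} (F G : Family I) → (∀ i → term F i ≈ᵐ term G i) → ∑ F ≐ ∑ G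
  ∑-≈ᵐ F G F≈G = ∑-cong F G
    (λ i → let open _≈ᵐ_ (F≈G i) in ⟦⟧-cong h sgn≡ xp≡ qp≡) (λ i → _≈ᵐ_.qp≡ (F≈G i))

  evens₁ odds₁ evens₂ odds₂ rotatedE rotatedO : Family ℤ² → Family ℤ²
  evens₁ F = left (reindex parity₁ F)
  odds₁ F = right (reindex parity₁ F)
  evens₂ F = left (reindex parity₂ F)
  odds₂ F = right (reindex parity₂ F)
  rotatedE F = left (reindex rotation F)
  rotatedO F = right (reindex rotation F)

  ∑-parity₁ : ∀ F → ∑ F ≐ ∑ (evens₁ F) ⊕ ∑ (odds₁ F)
  ∑-parity₁ F = trans (∑-reindex parity₁ F) (∑-⊎ (reindex parity₁ F))

  ∑-parity₂ : ∀ F → ∑ F ≐ ∑ (evens₂ F) ⊕ ∑ (odds₂ F)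
  ∑-parity₂ F = trans (∑-reindex parity₂ F) (∑-⊎ (reindex parity₂ F))

  ∑-rotation : ∀ F → ∑ F ≐ ∑ (rotatedE F) ⊕ ∑ (rotatedO F)
  ∑-rotation F = trans (∑-reindex rotation F) (∑-⊎ (reindex rotation F))

  ∑-along : ∀ (σ : ℤ² ↔ ℤ²) (F G : Family ℤ²) →
            (∀ i → term (reindex σ F) i ≈ᵐ term G i) → ∑ F ≐ ∑ G
  ∑-along σ F G p = trans (∑-reindex σ F) (∑-≈ᵐ (reindex σ F) G p)

  ∑-along₂ : ∀ (τ σ : ℤ² ↔ ℤ²) (F G : Family ℤ²) →
             (∀ i → term (reindex σ (reindex τ F)) i ≈ᵐ term G i) → ∑ F ≐ ∑ G
  ∑-along₂ τ σ F G p = trans (∑-reindex τ F) (∑-along σ (reindex τ F) G p)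

  -1ᵐ q -q : Monomial
  q  = ⟨ 0ℤ , 0ℤ , 1 ⟩
  -q = ⟨ 1ℤ , 0ℤ , 1 ⟩
  -1ᵐ = ⟨ 1ℤ , 0ℤ , 0 ⟩

  ∑-neg : ∀ {I} (F : Family I) → ∑ (-1ᵐ · F) ≐ ⊝ ∑ F
  ∑-neg F = trans (∑-· -1ᵐ F) (trans (*-congʳ -1≐) (-1*x≈-x (∑ F)))
    where
    open import Algebra.Properties.Ring R⟦q⟧.ring using (-1*x≈-x)
    -1≐ : ⟦ -1ᵐ ⟧ ≐ ⊝ 𝟏
    -1≐ = trans (·q^-cong (R.trans (coefficient-neg 0ℤ 0ℤ) (R.-‿cong coefficient-1)) ≡.refl)
                (trans (·q^-neg _ _) (R⟦q⟧.-‿cong (sym 𝟏≐·q^)))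

  -- `σ` matches the indices with even second coordinate to those with odd one and reverses the
  -- sign.
  ∑-cancel : ∀ (σ : ℤ² ↔ ℤ²) (F : Family ℤ²) →
    (∀ i → term (reindex σ (odds₂ F)) i ≈ᵐ term (-1ᵐ · evens₂ F) i) → ∑ F ≐ 𝟘
  ∑-cancel σ F p = trans (∑-parity₂ F)
    (trans (+-congˡ (trans (∑-along σ (odds₂ F) (-1ᵐ · evens₂ F) p) (∑-neg (evens₂ F))))
           (R⟦q⟧.-‿inverseʳ _))

  -- twice (E a b n) is a polynomial in n, so exponents are compared through their doubles.
  E+E : ∀ a b m c d n → twice (E a b m ℕ.+ E c d n) ≡ E₂ (+ a) (+ b) m ℤ.+ E₂ (+ c) (+ d) n
  E+E a b m c d n = ≡.trans (twice-+ (E a b m) (E c d n)) (≡.cong₂ ℤ._+_ (twice-E a b m) (twice-E c d n))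

  module _ {a b c d a′ b′ c′ d′ : ℕ} {m n m′ n′ : ℤ} where

    private
      e = E a b m ℕ.+ E c d n
      e′ = E a′ b′ m′ ℕ.+ E c′ d′ n′
      p = E₂ (+ a) (+ b) m ℤ.+ E₂ (+ c) (+ d) n
      p′ = E₂ (+ a′) (+ b′) m′ ℤ.+ E₂ (+ c′) (+ d′) n′

    exponents : ∀ k → p ≡ twice k ℤ.+ p′ → e ≡ k ℕ.+ e′
    exponents k p≡ = twice-injective {e} {k ℕ.+ e′} (≡.trans (E+E a b m c d n)
      (≡.trans p≡ (≡.sym (≡.trans (twice-+ k e′)
        (≡.cong (λ z → twice k ℤ.+ z) (E+E a′ b′ m′ c′ d′ n′))))))

    exponents₂ : ∀ k → p ≡ twice k ℤ.+ + 2 ℤ.* p′ → e ≡ k ℕ.+ 2 ℕ.* e′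
    exponents₂ k p≡ = twice-injective {e} {k ℕ.+ 2 ℕ.* e′} (≡.trans (E+E a b m c d n)
      (≡.trans p≡ (≡.sym (≡.trans (twice-+ k (2 ℕ.* e′))
        (≡.cong (λ z → twice k ℤ.+ z)
          (≡.trans (twice-* 2 e′) (≡.cong (λ z → + 2 ℤ.* z) (E+E a′ b′ m′ c′ d′ n′))))))))

  -- Ramanujan's φ(q^a), φ(-q^a), ψ(q^a), ψ(-q^a), with ψ as the bilateral series
  -- ∑_n q^{2n² + n}.
  φ φ⁻ ψ ψ⁻ : (a : ℕ) → .{{NonZero a}} → Family ℤ
  φ  a = theta 0ℤ 0ℤ a a
  φ⁻ a = theta 1ℤ 0ℤ a a
  ψ  a = theta 0ℤ 0ℤ (3 ℕ.* a) a {{ℕₚ.m*n≢0 3 a}}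
  ψ⁻ a = theta 1ℤ 0ℤ (3 ℕ.* a) a {{ℕₚ.m*n≢0 3 a}}

  ∑-·doubled-⊠ : ∀ {I J} t (F : Family I) (G : Family J) →
                 ∑ (t · doubled (F ⊠ G)) ≐ ⟦ t ⟧ ⊗ V (∑ F ⊗ ∑ G)
  ∑-·doubled-⊠ t F G =
    trans (∑-· t _) (*-congˡ (trans (∑-doubled (F ⊠ G)) (V-cong (∑-⊠ F G))))

  -- Put u = j - k/2. For m - n even the exponent is 8u² + 4u + 6k²; for m - n odd it is 1 + 2w² +
  -- 6k² + 6k with w = 2u + 1. Each parity of k then fills one parity class of a series on the
  -- right.
  ψψ-dissection : ∑ (ψ 1) ⊗ ∑ (ψ 3) ≐
                  V (∑ (ψ 2) ⊗ ∑ (φ 3)) ⊕ ⟦ q ⟧ ⊗ V (∑ (φ 1) ⊗ ∑ (ψ 6))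
  ψψ-dissection = begin
    ∑ (ψ 1) ⊗ ∑ (ψ 3)
      ≈⟨ ∑-⊠ (ψ 1) (ψ 3) ⟨
    ∑ F
      ≈⟨ ∑-rotation F ⟩
    ∑ (rotatedE F) ⊕ ∑ (rotatedO F)
      ≈⟨ +-cong (∑-parity₂ (rotatedE F)) (∑-parity₂ (rotatedO F)) ⟩
    (∑ (evens₂ (rotatedE F)) ⊕ ∑ (odds₂ (rotatedE F))) ⊕
    (∑ (evens₂ (rotatedO F)) ⊕ ∑ (odds₂ (rotatedO F)))
      -- In the odd class w = 2j - k + 1 has the parity opposite to that of k, so the two halves
      -- change places.
      ≈⟨ +-cong (+-cong EE EO) (trans (R⟦q⟧.+-comm _ _) (+-cong OO OE)) ⟩
    (∑ (evens₂ G) ⊕ ∑ (odds₂ G)) ⊕ (∑ (evens₁ H) ⊕ ∑ (odds₁ H))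
      ≈⟨ +-cong (∑-parity₂ G) (∑-parity₁ H) ⟨
    ∑ G ⊕ ∑ H
      ≈⟨ +-cong (trans (∑-doubled (ψ 2 ⊠ φ 3)) (V-cong (∑-⊠ (ψ 2) (φ 3))))
                (∑-·doubled-⊠ q (φ 1) (ψ 6)) ⟩
    V (∑ (ψ 2) ⊗ ∑ (φ 3)) ⊕ ⟦ q ⟧ ⊗ V (∑ (φ 1) ⊗ ∑ (ψ 6)) ∎
    where
    open ≐-Reasoning
    F = ψ 1 ⊠ ψ 3
    G = doubled (ψ 2 ⊠ φ 3)
    H = q · doubled (φ 1 ⊠ ψ 6)
    EE : ∑ (evens₂ (rotatedE F)) ≐ ∑ (evens₂ G)
    EE = ∑-along (shear₁ id) (evens₂ (rotatedE F)) (evens₂ G) λ (x , y) →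
      match 0ℤ ≡.refl ≡.refl (exponents₂ 0 (solveℤ 2 (λ x y →
        let j = y :+ x ; k = y :+ y in
        e₂ 3 1 (j :+ k) :+ e₂ 9 3 (j :+ :- k)
        := con 0ℤ :+ con (+ 2) :* (e₂ 6 2 x :+ e₂ 3 3 (y :+ y))) ≡.refl x y))
    EO : ∑ (odds₂ (rotatedE F)) ≐ ∑ (odds₂ G)
    -- For odd k, u is a half-integer; the substitution u = -1/2 - x restores an integer and
    -- preserves the value of 8u² + 4u.
    EO = ∑-along (reflect₁ id) (odds₂ (rotatedE F)) (odds₂ G) λ (x , y) →
      match 0ℤ ≡.refl ≡.refl (exponents₂ 0 (solveℤ 2 (λ x y →
        let j = y :+ :- x ; k = con 1ℤ :+ (y :+ y) in
        e₂ 3 1 (j :+ k) :+ e₂ 9 3 (j :+ :- k)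
        := con 0ℤ :+ con (+ 2) :* (e₂ 6 2 x :+ e₂ 3 3 (con 1ℤ :+ (y :+ y)))) ≡.refl x y))
    OE : ∑ (evens₂ (rotatedO F)) ≐ ∑ (odds₁ H)
    OE = ∑-along (shear₁ id) (evens₂ (rotatedO F)) (odds₁ H) λ (x , y) →
      match 0ℤ ≡.refl ≡.refl (exponents₂ 1 (solveℤ 2 (λ x y →
        let j = y :+ x ; k = y :+ y in
        e₂ 3 1 (con 1ℤ :+ (j :+ k)) :+ e₂ 9 3 (j :+ :- k)
        := con (+ 2) :+ con (+ 2) :* (e₂ 1 1 (con 1ℤ :+ (x :+ x)) :+ e₂ 18 6 y)) ≡.refl x y))
    OO : ∑ (odds₂ (rotatedO F)) ≐ ∑ (evens₁ H)
    -- The odd k is written as -1 - 2y because 6k² + 6k is fixed by k ↦ -1 - k; so it takes the same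
    -- value 24y² + 12y as at k = 2y.
    OO = ∑-along₂ (reflect₂ (const -1ℤ)) (shear₁ (λ y → -1ℤ ℤ.- y))
                  (odds₂ (rotatedO F)) (evens₁ H) λ (x , y) →
      match 0ℤ ≡.refl ≡.refl (exponents₂ 1 (solveℤ 2 (λ x y →
        let y′ = con -1ℤ :+ :- y ; j = y′ :+ x ; k = con 1ℤ :+ (y′ :+ y′) in
        e₂ 3 1 (con 1ℤ :+ (j :+ k)) :+ e₂ 9 3 (j :+ :- k)
        := con (+ 2) :+ con (+ 2) :* (e₂ 1 1 (x :+ x) :+ e₂ 18 6 y)) ≡.refl x y))

  -- φX = ∑ (-X)^n q^{n²} and φ₃ = ∑ X^n q^{3n²};
  -- A = (qX, q²/X, q³; q³)_∞ and A′ = (q/X, q²X, q³; q³)_∞;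
  -- θ = (q³X², q³/X², q⁶; q⁶)_∞.
  φX φ₃ A A′ α β Θ₀ Θ₁ θ S₀ S₊ S₋ : Family ℤ
  φX = theta 1ℤ 1ℤ 1 1
  φ₃ = theta 0ℤ 1ℤ 3 3
  A  = theta 1ℤ 1ℤ 1 2
  A′ = theta 1ℤ -1ℤ 1 2
  α  = theta 0ℤ 0ℤ 2 4
  β  = theta 0ℤ 0ℤ 5 1
  Θ₀ = theta 0ℤ (+ 2) 3 3
  Θ₁ = ⟨ 0ℤ , 1ℤ , 0 ⟩ · theta 0ℤ (+ 2) 6 0
  θ  = theta 1ℤ (+ 2) 3 3
  S₀ = theta 1ℤ (+ 4) 6 6
  S₊ = ⟨ 0ℤ , 1ℤ , 0 ⟩ · theta 1ℤ (+ 4) 9 3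
  S₋ = ⟨ 0ℤ , -1ℤ , 0 ⟩ · theta 1ℤ (ℤ.- + 4) 9 3

  -- For m - n even the exponent is 4(k - j/2)² + 3j² and the sign (-1)^(j+k). Hence the split is on
  -- j, and for odd j the reflection k ↦ j - k reverses the sign. For m - n odd both parities of j
  -- survive. They are the powers X^e with e ≡ 1 and e ≡ 3 modulo 4 of a single series over odd e
  -- with exponents 3(e² - 1)/8, which is `S₊` plus `S₋`.
  φφ-dissection : ∑ φX ⊗ ∑ φ₃ ≐
                  V (∑ S₀ ⊗ ∑ (φ⁻ 2)) ⊕ ⟦ -q ⟧ ⊗ V ((∑ S₊ ⊕ ∑ S₋) ⊗ ∑ (ψ⁻ 1))
  φφ-dissection = begin
    ∑ φX ⊗ ∑ φ₃
      ≈⟨ ∑-⊠ φX φ₃ ⟨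
    ∑ F
      ≈⟨ ∑-rotation F ⟩
    ∑ (rotatedE F) ⊕ ∑ (rotatedO F)
      ≈⟨ +-cong (∑-parity₁ (rotatedE F)) (∑-parity₁ (rotatedO F)) ⟩
    (∑ (evens₁ (rotatedE F)) ⊕ ∑ (odds₁ (rotatedE F))) ⊕
    (∑ (evens₁ (rotatedO F)) ⊕ ∑ (odds₁ (rotatedO F)))
      ≈⟨ +-cong (+-cong EE EO) (+-cong OE OO) ⟩
    (∑ G ⊕ 𝟘) ⊕ (∑ H₊ ⊕ ∑ H₋)
      ≈⟨ +-cong (trans (R⟦q⟧.+-identityʳ _) (trans (∑-doubled (S₀ ⊠ φ⁻ 2)) (V-cong (∑-⊠ S₀ (φ⁻ 2)))))
                (+-cong (∑-·doubled-⊠ -q S₊ (ψ⁻ 1)) (∑-·doubled-⊠ -q S₋ (ψ⁻ 1))) ⟩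
    V (∑ S₀ ⊗ ∑ (φ⁻ 2)) ⊕ (⟦ -q ⟧ ⊗ V (∑ S₊ ⊗ ∑ (ψ⁻ 1)) ⊕ ⟦ -q ⟧ ⊗ V (∑ S₋ ⊗ ∑ (ψ⁻ 1)))
      ≈⟨ +-congˡ (trans (*-congˡ (trans (V-cong (R⟦q⟧.distribʳ _ _ _)) (V-⊕ _ _)))
                        (R⟦q⟧.distribˡ _ _ _)) ⟨
    V (∑ S₀ ⊗ ∑ (φ⁻ 2)) ⊕ ⟦ -q ⟧ ⊗ V ((∑ S₊ ⊕ ∑ S₋) ⊗ ∑ (ψ⁻ 1)) ∎
    where
    open ≐-Reasoning
    F = φX ⊠ φ₃
    G = doubled (S₀ ⊠ φ⁻ 2)
    H₊ = -q · doubled (S₊ ⊠ ψ⁻ 1)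
    H₋ = -q · doubled (S₋ ⊠ ψ⁻ 1)
    EE : ∑ (evens₁ (rotatedE F)) ≐ ∑ G
    -- The argument of `match` is half the difference of the two exponents of -1, here 3x + y
    -- against x + y.
    EE = ∑-along (shear₂ id) (evens₁ (rotatedE F)) G λ (x , y) → match x
      (solveℤ 2 (λ x y → con 1ℤ :* m x y :+ con 0ℤ :* n x y
        := (x :+ x) :+ (con 1ℤ :* x :+ con 1ℤ :* y)) ≡.refl x y)
      (solveℤ 2 (λ x y → con 1ℤ :* m x y :+ con 1ℤ :* n x y
        := con (+ 4) :* x :+ con 0ℤ :* y) ≡.refl x y)
      (exponents₂ 0 (solveℤ 2 (λ x y → e₂ 1 1 (m x y) :+ e₂ 3 3 (n x y)
        := con 0ℤ :+ con (+ 2) :* (e₂ 6 6 x :+ e₂ 2 2 y)) ≡.refl x y))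
      where
      m n : Polynomial 2 → Polynomial 2 → Polynomial 2
      m x y = (x :+ x) :+ (x :+ y)
      n x y = (x :+ x) :+ :- (x :+ y)
    EO : ∑ (odds₁ (rotatedE F)) ≐ 𝟘
    EO = ∑-cancel (reflect₂ id) (odds₁ (rotatedE F)) λ (x , y) → match (x ℤ.- (y ℤ.+ y))
      (solveℤ 2 (λ x y → let h = x :+ :- (y :+ y) in
        con 1ℤ :* m′ x y :+ con 0ℤ :* n′ x y
        := (h :+ h) :+ (con 1ℤ :+ (con 1ℤ :* m x y :+ con 0ℤ :* n x y))) ≡.refl x y)
      (solveℤ 2 (λ x y → con 1ℤ :* m′ x y :+ con 1ℤ :* n′ x y
        := con 0ℤ :+ (con 1ℤ :* m x y :+ con 1ℤ :* n x y)) ≡.refl x y)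
      (exponents 0 (solveℤ 2 (λ x y → e₂ 1 1 (m′ x y) :+ e₂ 3 3 (n′ x y)
        := con 0ℤ :+ (e₂ 1 1 (m x y) :+ e₂ 3 3 (n x y))) ≡.refl x y))
      where
      m n m′ n′ : Polynomial 2 → Polynomial 2 → Polynomial 2
      m x y = (con 1ℤ :+ (x :+ x)) :+ (y :+ y)
      n x y = (con 1ℤ :+ (x :+ x)) :+ :- (y :+ y)
      m′ x y = (con 1ℤ :+ (x :+ x)) :+ (con 1ℤ :+ ((x :+ :- y) :+ (x :+ :- y)))
      n′ x y = (con 1ℤ :+ (x :+ x)) :+ :- (con 1ℤ :+ ((x :+ :- y) :+ (x :+ :- y)))
    OE : ∑ (evens₁ (rotatedO F)) ≐ ∑ H₊
    OE = ∑-along (shear₂ id) (evens₁ (rotatedO F)) H₊ λ (x , y) → match x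
      (solveℤ 2 (λ x y → con 1ℤ :* m x y :+ con 0ℤ :* n x y
        := (x :+ x) :+ (con 1ℤ :+ ((con 0ℤ :+ con 1ℤ :* x) :+ con 1ℤ :* y))) ≡.refl x y)
      (solveℤ 2 (λ x y → con 1ℤ :* m x y :+ con 1ℤ :* n x y
        := con 0ℤ :+ ((con 1ℤ :+ con (+ 4) :* x) :+ con 0ℤ :* y)) ≡.refl x y)
      (exponents₂ 1 (solveℤ 2 (λ x y → e₂ 1 1 (m x y) :+ e₂ 3 3 (n x y)
        := con (+ 2) :+ con (+ 2) :* (e₂ 9 3 x :+ e₂ 3 1 y)) ≡.refl x y))
      where
      m n : Polynomial 2 → Polynomial 2 → Polynomial 2
      m x y = con 1ℤ :+ ((x :+ x) :+ (x :+ y))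
      n x y = (x :+ x) :+ :- (x :+ y)
    OO : ∑ (odds₁ (rotatedO F)) ≐ ∑ H₋
    -- With j = -1 - 2x the power X^(1+2j) is X^(-1-4x), as in `S₋`; k = -1 - x - y then removes the
    -- cross term.
    OO = ∑-along₂ (reflect₁ (const -1ℤ)) (reflect₂ (λ x → -1ℤ ℤ.- x))
                  (odds₁ (rotatedO F)) H₋ λ (x , y) →
      match (-1ℤ ℤ.- (x ℤ.+ x) ℤ.- y)
      (solveℤ 2 (λ x y → let h = (con -1ℤ :+ :- (x :+ x)) :+ :- y in
        con 1ℤ :* m x y :+ con 0ℤ :* n x y
        := (h :+ h) :+ (con 1ℤ :+ ((con 0ℤ :+ con 1ℤ :* x) :+ con 1ℤ :* y))) ≡.refl x y)
      (solveℤ 2 (λ x y → con 1ℤ :* m x y :+ con 1ℤ :* n x y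
        := con 0ℤ :+ ((con -1ℤ :+ con (ℤ.- + 4) :* x) :+ con 0ℤ :* y)) ≡.refl x y)
      (exponents₂ 1 (solveℤ 2 (λ x y → e₂ 1 1 (m x y) :+ e₂ 3 3 (n x y)
        := con (+ 2) :+ con (+ 2) :* (e₂ 9 3 x :+ e₂ 3 1 y)) ≡.refl x y))
      where
      j k m n : Polynomial 2 → Polynomial 2 → Polynomial 2
      j x y = con 1ℤ :+ ((con -1ℤ :+ :- x) :+ (con -1ℤ :+ :- x))
      k x y = (con -1ℤ :+ :- x) :+ :- y
      m x y = con 1ℤ :+ (j x y :+ k x y)
      n x y = j x y :+ :- k x y

  -- Both factors have the same quadratic part, so the rotation alone diagonalizes. The sign
  -- (-1)^(m+n) is constant on each class and X occurs with exponent m - n, a function of k only;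
  -- the sums over j are therefore free of X.
  AA′-dissection : ∑ A ⊗ ∑ A′ ≐ ∑ α ⊗ ∑ Θ₀ ⊕ ⟦ -q ⟧ ⊗ (∑ β ⊗ ∑ Θ₁)
  AA′-dissection = begin
    ∑ A ⊗ ∑ A′                          ≈⟨ ∑-⊠ A A′ ⟨
    ∑ F                                 ≈⟨ ∑-rotation F ⟩
    ∑ (rotatedE F) ⊕ ∑ (rotatedO F)     ≈⟨ +-cong E-part O-part ⟩
    ∑ (α ⊠ Θ₀) ⊕ ∑ (-q · (β ⊠ Θ₁))
      ≈⟨ +-cong (∑-⊠ α Θ₀) (trans (∑-· -q (β ⊠ Θ₁)) (*-congˡ (∑-⊠ β Θ₁))) ⟩
    ∑ α ⊗ ∑ Θ₀ ⊕ ⟦ -q ⟧ ⊗ (∑ β ⊗ ∑ Θ₁)  ∎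
    where
    open ≐-Reasoning
    F = A ⊠ A′
    E-part : ∑ (rotatedE F) ≐ ∑ (α ⊠ Θ₀)
    E-part = ∑-≈ᵐ (rotatedE F) (α ⊠ Θ₀) λ (x , y) → match x
      (solveℤ 2 (λ x y → con 1ℤ :* (x :+ y) :+ con 1ℤ :* (x :+ :- y) := (x :+ x) :+ con 0ℤ) ≡.refl x y)
      (solveℤ 2 (λ x y → con 1ℤ :* (x :+ y) :+ con -1ℤ :* (x :+ :- y)
        := con 0ℤ :* x :+ con (+ 2) :* y) ≡.refl x y)
      (exponents 0 (solveℤ 2 (λ x y → e₂ 1 2 (x :+ y) :+ e₂ 1 2 (x :+ :- y)
        := con 0ℤ :+ (e₂ 2 4 x :+ e₂ 3 3 y)) ≡.refl x y))
    O-part : ∑ (rotatedO F) ≐ ∑ (-q · (β ⊠ Θ₁))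
    O-part = ∑-≈ᵐ (rotatedO F) (-q · (β ⊠ Θ₁)) λ (x , y) → match x
      (solveℤ 2 (λ x y → con 1ℤ :* (con 1ℤ :+ (x :+ y)) :+ con 1ℤ :* (x :+ :- y)
        := (x :+ x) :+ con 1ℤ) ≡.refl x y)
      (solveℤ 2 (λ x y → con 1ℤ :* (con 1ℤ :+ (x :+ y)) :+ con -1ℤ :* (x :+ :- y)
        := con 0ℤ :+ (con 0ℤ :* x :+ (con 1ℤ :+ con (+ 2) :* y))) ≡.refl x y)
      (exponents 1 (solveℤ 2 (λ x y → e₂ 1 2 (con 1ℤ :+ (x :+ y)) :+ e₂ 1 2 (x :+ :- y)
        := con (+ 2) :+ (e₂ 5 1 x :+ e₂ 6 0 y)) ≡.refl x y))

  -- `θ` is `Θ₀` with alternating signs. For m - n odd, k ↦ -1 - k keeps the exponents of q and X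
  -- and reverses the sign, so only powers of X⁴ survive.
  Θ₀θ-dissection : ∑ Θ₀ ⊗ ∑ θ ≐ ∑ S₀ ⊗ ∑ (φ⁻ 6)
  Θ₀θ-dissection = begin
    ∑ Θ₀ ⊗ ∑ θ                         ≈⟨ ∑-⊠ Θ₀ θ ⟨
    ∑ F                                ≈⟨ ∑-rotation F ⟩
    ∑ (rotatedE F) ⊕ ∑ (rotatedO F)    ≈⟨ +-cong E-part O-part ⟩
    ∑ (S₀ ⊠ φ⁻ 6) ⊕ 𝟘                  ≈⟨ R⟦q⟧.+-identityʳ _ ⟩
    ∑ (S₀ ⊠ φ⁻ 6)                      ≈⟨ ∑-⊠ S₀ (φ⁻ 6) ⟩
    ∑ S₀ ⊗ ∑ (φ⁻ 6)                    ∎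
    where
    open ≐-Reasoning
    F = Θ₀ ⊠ θ
    E-part : ∑ (rotatedE F) ≐ ∑ (S₀ ⊠ φ⁻ 6)
    E-part = ∑-≈ᵐ (rotatedE F) (S₀ ⊠ φ⁻ 6) λ (x , y) → match (ℤ.- y)
      (solveℤ 2 (λ x y → con 0ℤ :* (x :+ y) :+ con 1ℤ :* (x :+ :- y)
        := (:- y :+ :- y) :+ (con 1ℤ :* x :+ con 1ℤ :* y)) ≡.refl x y)
      (solveℤ 2 (λ x y → con (+ 2) :* (x :+ y) :+ con (+ 2) :* (x :+ :- y)
        := con (+ 4) :* x :+ con 0ℤ :* y) ≡.refl x y)
      (exponents 0 (solveℤ 2 (λ x y → e₂ 3 3 (x :+ y) :+ e₂ 3 3 (x :+ :- y)
        := con 0ℤ :+ (e₂ 6 6 x :+ e₂ 6 6 y)) ≡.refl x y))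
    O-part : ∑ (rotatedO F) ≐ 𝟘
    O-part = ∑-cancel (reflect₂ (const -1ℤ)) (rotatedO F) λ (x , y) → match (y ℤ.+ y)
      (solveℤ 2 (λ x y →
        con 0ℤ :* m x (k′ y) :+ con 1ℤ :* n x (k′ y)
        := ((y :+ y) :+ (y :+ y)) :+ (con 1ℤ :+ (con 0ℤ :* m x (k y) :+ con 1ℤ :* n x (k y)))) ≡.refl x y)
      (solveℤ 2 (λ x y → con (+ 2) :* m x (k′ y) :+ con (+ 2) :* n x (k′ y)
        := con 0ℤ :+ (con (+ 2) :* m x (k y) :+ con (+ 2) :* n x (k y))) ≡.refl x y)
      (exponents 0 (solveℤ 2 (λ x y → e₂ 3 3 (m x (k′ y)) :+ e₂ 3 3 (n x (k′ y))
        := con 0ℤ :+ (e₂ 3 3 (m x (k y)) :+ e₂ 3 3 (n x (k y)))) ≡.refl x y))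
      where
      k k′ : Polynomial 2 → Polynomial 2
      k y = y :+ y
      k′ y = con 1ℤ :+ ((con -1ℤ :+ :- y) :+ (con -1ℤ :+ :- y))
      m n : Polynomial 2 → Polynomial 2 → Polynomial 2
      m x k = con 1ℤ :+ (x :+ k)
      n x k = x :+ :- k

  -- Here nothing cancels: the even class has the powers X^(1+4j) of `S₊`, the odd class has
  -- X^(3+4j), and j ↦ -1 - j turns these into the powers in `S₋`.
  Θ₁θ-dissection : ∑ Θ₁ ⊗ ∑ θ ≐ (∑ S₊ ⊕ ∑ S₋) ⊗ ∑ (ψ⁻ 3)
  Θ₁θ-dissection = begin
    ∑ Θ₁ ⊗ ∑ θ                           ≈⟨ ∑-⊠ Θ₁ θ ⟨
    ∑ F                                  ≈⟨ ∑-rotation F ⟩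
    ∑ (rotatedE F) ⊕ ∑ (rotatedO F)      ≈⟨ +-cong E-part O-part ⟩
    ∑ (S₊ ⊠ ψ⁻ 3) ⊕ ∑ (S₋ ⊠ ψ⁻ 3)        ≈⟨ +-cong (∑-⊠ S₊ (ψ⁻ 3)) (∑-⊠ S₋ (ψ⁻ 3)) ⟩
    ∑ S₊ ⊗ ∑ (ψ⁻ 3) ⊕ ∑ S₋ ⊗ ∑ (ψ⁻ 3)    ≈⟨ R⟦q⟧.distribʳ _ _ _ ⟨
    (∑ S₊ ⊕ ∑ S₋) ⊗ ∑ (ψ⁻ 3)             ∎
    where
    open ≐-Reasoning
    F = Θ₁ ⊠ θ
    E-part : ∑ (rotatedE F) ≐ ∑ (S₊ ⊠ ψ⁻ 3)
    E-part = ∑-≈ᵐ (rotatedE F) (S₊ ⊠ ψ⁻ 3) λ (x , y) → match (ℤ.- y)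
      (solveℤ 2 (λ x y → (con 0ℤ :+ con 0ℤ :* (x :+ y)) :+ con 1ℤ :* (x :+ :- y)
        := (:- y :+ :- y) :+ ((con 0ℤ :+ con 1ℤ :* x) :+ con 1ℤ :* y)) ≡.refl x y)
      (solveℤ 2 (λ x y → (con 1ℤ :+ con (+ 2) :* (x :+ y)) :+ con (+ 2) :* (x :+ :- y)
        := (con 1ℤ :+ con (+ 4) :* x) :+ con 0ℤ :* y) ≡.refl x y)
      (exponents 0 (solveℤ 2 (λ x y → e₂ 6 0 (x :+ y) :+ e₂ 3 3 (x :+ :- y)
        := con 0ℤ :+ (e₂ 9 3 x :+ e₂ 9 3 y)) ≡.refl x y))
    O-part : ∑ (rotatedO F) ≐ ∑ (S₋ ⊠ ψ⁻ 3)
    O-part = ∑-along₂ (reflect₁ (const -1ℤ)) (reflect₂ (const -1ℤ))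
                      (rotatedO F) (S₋ ⊠ ψ⁻ 3) λ (x , y) →
      match (ℤ.- x)
      (solveℤ 2 (λ x y → (con 0ℤ :+ con 0ℤ :* m x y) :+ con 1ℤ :* n x y
        := (:- x :+ :- x) :+ ((con 0ℤ :+ con 1ℤ :* x) :+ con 1ℤ :* y)) ≡.refl x y)
      (solveℤ 2 (λ x y → (con 1ℤ :+ con (+ 2) :* m x y) :+ con (+ 2) :* n x y
        := (con -1ℤ :+ con (ℤ.- + 4) :* x) :+ con 0ℤ :* y) ≡.refl x y)
      (exponents 0 (solveℤ 2 (λ x y → e₂ 6 0 (m x y) :+ e₂ 3 3 (n x y)
        := con 0ℤ :+ (e₂ 9 3 x :+ e₂ 9 3 y)) ≡.refl x y))
      where
      m n : Polynomial 2 → Polynomial 2 → Polynomial 2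
      m x y = con 1ℤ :+ ((con -1ℤ :+ :- x) :+ (con -1ℤ :+ :- y))
      n x y = (con -1ℤ :+ :- x) :+ :- (con -1ℤ :+ :- y)

+-nonZero : ∀ m n .{{_ : NonZero m}} → NonZero (m ℕ.+ n)
+-nonZero (suc _) _ = nonZero

-- Infinite products free of X.

module EtaQuotients {c ℓ} (R : CommutativeRing c ℓ) where

  private module R = CommutativeRing R
  open R using (Carrier; _≈_; 1#; -_)
  open PowerSeries R using (PowerSeries)
  open PowerSeriesRing R
  open Products R
  open R⟦q⟧ using (refl; sym; trans; +-cong; +-congˡ; +-congʳ; *-cong; *-congˡ; *-congʳ)
  open ≐-Reasoning
  open CommutativeMonoidSolver R⟦q⟧.*-commutativeMonoid using (solve; _⊜_)
    renaming (_⊕_ to infixl 7 _∙_)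

  -- f a = (q^a; q^a), g a = (-q^a; q^a), o a = (q^a; q^{2a}), p a = (-q^a; q^{2a})
  f g : (a : ℕ) → .{{NonZero a}} → PowerSeries
  f a = Poch 1# a a
  g a = Poch (- 1#) a a

  o p : (a : ℕ) → .{{NonZero (2 ℕ.* a)}} → PowerSeries
  o a = Poch 1# a (2 ℕ.* a)
  p a = Poch (- 1#) a (2 ℕ.* a)

  Poch-split₂ : ∀ x k m .{{_ : NonZero m}} .{{_ : NonZero (2 ℕ.* m)}} →
                Poch x k m ≐ Poch x k (2 ℕ.* m) ⊗ Poch x (k ℕ.+ m) (2 ℕ.* m)
  Poch-split₂ x k m = trans (Poch-split x k m 2)
    (*-cong (trans (R⟦q⟧.*-identityˡ _) (Poch-cong R.refl (lemma₀ k m) ≡.refl))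
            (Poch-cong R.refl (≡.cong (k ℕ.+_) (ℕₚ.*-identityʳ m)) ≡.refl))
    where
    lemma₀ : ∀ k m → k ℕ.+ m ℕ.* 0 ≡ k
    lemma₀ = solve-∀

  Poch-split₃ : ∀ x k m .{{_ : NonZero m}} .{{_ : NonZero (3 ℕ.* m)}} →
    Poch x k m ≐
    Poch x k (3 ℕ.* m) ⊗ Poch x (k ℕ.+ m) (3 ℕ.* m) ⊗ Poch x (k ℕ.+ 2 ℕ.* m) (3 ℕ.* m)
  Poch-split₃ x k m = trans (Poch-split x k m 3)
    (*-cong (*-cong (trans (R⟦q⟧.*-identityˡ _) (Poch-cong R.refl (lemma₀ k m) ≡.refl))
                    (Poch-cong R.refl (≡.cong (k ℕ.+_) (ℕₚ.*-identityʳ m)) ≡.refl))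
            (Poch-cong R.refl (≡.cong (k ℕ.+_) (ℕₚ.*-comm m 2)) ≡.refl))
    where
    lemma₀ : ∀ k m → k ℕ.+ m ℕ.* 0 ≡ k
    lemma₀ = solve-∀

  module _ (a : ℕ) .{{_ : NonZero a}} .{{_ : NonZero (2 ℕ.* a)}} where

    f≐o⊗f : f a ≐ o a ⊗ f (2 ℕ.* a)
    f≐o⊗f = trans (Poch-split₂ 1# a a) (*-congˡ (Poch-cong R.refl (lemma a) ≡.refl))
      where
      lemma : ∀ a → a ℕ.+ a ≡ 2 ℕ.* a
      lemma = solve-∀

    f⊗g : f a ⊗ g a ≐ f (2 ℕ.* a)
    f⊗g = trans (Poch-conjugate 1# a a) (Poch-cong (R.*-identityˡ 1#) ≡.refl ≡.refl)

    p⊗o : .{{_ : NonZero (2 ℕ.* (2 ℕ.* a))}} → p a ⊗ o a ≐ o (2 ℕ.* a)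
    p⊗o = trans (R⟦q⟧.*-comm _ _) (trans (Poch-conjugate 1# a (2 ℕ.* a))
      (Poch-cong (R.*-identityˡ 1#) ≡.refl ≡.refl))

  -- Residue 3 is the only odd class modulo 6 that the classes 1 and 2 modulo 3 miss.
  residues-mod-6 : ∀ x → Poch x 3 6 ⊗ (Poch x 1 3 ⊗ Poch x 2 3) ≐
                         (Poch x 2 6 ⊗ Poch x 4 6) ⊗ Poch x 1 2
  residues-mod-6 x = begin
    x₃ ⊗ (Poch x 1 3 ⊗ Poch x 2 3)
      ≈⟨ *-congˡ (*-cong (Poch-split₂ x 1 3) (Poch-split₂ x 2 3)) ⟩
    x₃ ⊗ ((x₁ ⊗ x₄) ⊗ (x₂ ⊗ x₅))
      ≈⟨ solve 5 (λ x₁ x₂ x₃ x₄ x₅ → x₃ ∙ ((x₁ ∙ x₄) ∙ (x₂ ∙ x₅))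
                   ⊜ (x₂ ∙ x₄) ∙ ((x₁ ∙ x₃) ∙ x₅)) refl x₁ x₂ x₃ x₄ x₅ ⟩
    (x₂ ⊗ x₄) ⊗ (x₁ ⊗ x₃ ⊗ x₅)
      ≈⟨ *-congˡ (Poch-split₃ x 1 2) ⟨
    (x₂ ⊗ x₄) ⊗ Poch x 1 2 ∎
    where
    x₁ = Poch x 1 6
    x₂ = Poch x 2 6
    x₃ = Poch x 3 6
    x₄ = Poch x 4 6
    x₅ = Poch x 5 6

-- Product forms, eta identities and the even part.

module EvenPart {c ℓ} (R : CommutativeRing c ℓ)
  (X X⁻¹ : CommutativeRing.Carrier R)
  (XX⁻¹≈1 : CommutativeRing._≈_ R (CommutativeRing._*_ R X X⁻¹) (CommutativeRing.1# R)) where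

  private module R = CommutativeRing R
  open R using (Carrier; _≈_; 1#; -_)
  open RingProperties R.ring using (-‿involutive)
  open PowerSeries R hiding (f)
  open PowerSeriesRing R
  open Products R
  open EtaQuotients R
  open JacobiTripleProduct R X X⁻¹ XX⁻¹≈1
  open Dissections R X X⁻¹ XX⁻¹≈1
  open R⟦q⟧ using (refl; sym; trans; +-cong; +-congˡ; +-congʳ; *-cong; *-congˡ; *-congʳ)
  open ≐-Reasoning
  open CommutativeMonoidSolver R⟦q⟧.*-commutativeMonoid using (solve; _⊜_)
    renaming (_⊕_ to infixl 7 _∙_)

  module _ {x y : Carrier} {l : ℤ} (x≈ : x ≈ coefficient 0ℤ l) (y≈ : y ≈ coefficient 0ℤ (ℤ.- l))
    (a b : ℕ) .{{_ : NonZero a}} .{{_ : NonZero b}} .{{_ : NonZero (a ℕ.+ b)}} where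

    theta⁻-product : ∑ (theta 1ℤ l a b) ≐
                     Poch x a (a ℕ.+ b) ⊗ Poch y b (a ℕ.+ b) ⊗ f (a ℕ.+ b)
    theta⁻-product = sym (triple-product 1ℤ l a b
      (R.trans (R.-‿cong x≈) (R.sym (coefficient-neg 0ℤ l)))
      (R.trans (R.-‿cong y≈) (R.trans (R.sym (coefficient-neg 0ℤ (ℤ.- l)))
                                      -- The triple product expects the sign exponent -1 for the
                                      -- inverse factor where negation produced 1; both are odd.
                                      (R.sym (coefficient-period -1ℤ 1ℤ (ℤ.- l))))))

    theta⁺-product : ∑ (theta 0ℤ l a b) ≐
                     Poch (- x) a (a ℕ.+ b) ⊗ Poch (- y) b (a ℕ.+ b) ⊗ f (a ℕ.+ b)
    theta⁺-product = sym (triple-product 0ℤ l a b (R.trans (-‿involutive x) x≈)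
                                                  (R.trans (-‿involutive y) y≈))

  private
    1≈ : 1# ≈ coefficient 0ℤ 0ℤ
    1≈ = R.sym coefficient-1

    X≈ : X ≈ coefficient 0ℤ 1ℤ
    X≈ = R.sym (Coefficients.coefficient-X R X X⁻¹ XX⁻¹≈1)

    X⁻¹≈ : X⁻¹ ≈ coefficient 0ℤ -1ℤ
    X⁻¹≈ = R.sym (Coefficients.coefficient-X⁻¹ R X X⁻¹ XX⁻¹≈1)

    X²≈ : X R.* X ≈ coefficient 0ℤ (+ 2)
    X²≈ = R.trans (R.*-cong X≈ X≈) (coefficient-+ 0ℤ 1ℤ 0ℤ 1ℤ)

    X⁻²≈ : X⁻¹ R.* X⁻¹ ≈ coefficient 0ℤ (ℤ.- + 2)
    X⁻²≈ = R.trans (R.*-cong X⁻¹≈ X⁻¹≈) (coefficient-+ 0ℤ -1ℤ 0ℤ -1ℤ)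

  module _ (a : ℕ) .{{_ : NonZero a}} .{{_ : NonZero (2 ℕ.* a)}}
           .{{_ : NonZero (2 ℕ.* (2 ℕ.* a))}} where

    private
      instance
        a+a≢0 : NonZero (a ℕ.+ a)
        a+a≢0 = +-nonZero a a

        3a≢0 : NonZero (3 ℕ.* a)
        3a≢0 = ℕₚ.m*n≢0 3 a

        3a+a≢0 : NonZero (3 ℕ.* a ℕ.+ a)
        3a+a≢0 = +-nonZero (3 ℕ.* a) a

      a+a≡2a : ∀ a → a ℕ.+ a ≡ 2 ℕ.* a
      a+a≡2a = solve-∀

      3a+a≡4a : ∀ a → 3 ℕ.* a ℕ.+ a ≡ 2 ℕ.* (2 ℕ.* a)
      3a+a≡4a = solve-∀

      3a≡a+2a : ∀ a → 3 ℕ.* a ≡ a ℕ.+ 2 ℕ.* a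
      3a≡a+2a = solve-∀

      φ-factors : ∀ y → Poch y a (a ℕ.+ a) ⊗ Poch y a (a ℕ.+ a) ⊗ f (a ℕ.+ a) ≐
                        Poch y a (2 ℕ.* a) ⊗ Poch y a (2 ℕ.* a) ⊗ f (2 ℕ.* a)
      φ-factors y = *-cong (*-cong factor factor) (Poch-cong R.refl (a+a≡2a a) (a+a≡2a a))
        where factor = Poch-cong R.refl ≡.refl (a+a≡2a a)

      -- The classes a and 3a modulo 4a together are the odd multiples of a, so two products in base
      -- q^(4a) merge into one in base q^(2a).
      ψ-factors : ∀ y →
        Poch y (3 ℕ.* a) (3 ℕ.* a ℕ.+ a) ⊗ Poch y a (3 ℕ.* a ℕ.+ a) ⊗ f (3 ℕ.* a ℕ.+ a) ≐
        Poch y a (2 ℕ.* a) ⊗ f (2 ℕ.* (2 ℕ.* a))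
      ψ-factors y = *-cong
        (trans (R⟦q⟧.*-comm _ _)
          (trans (*-cong (Poch-cong R.refl ≡.refl (3a+a≡4a a))
                         (Poch-cong R.refl (3a≡a+2a a) (3a+a≡4a a)))
                 (sym (Poch-split₂ y a (2 ℕ.* a)))))
        (Poch-cong R.refl (3a+a≡4a a) (3a+a≡4a a))

    φ≐ : ∑ (φ a) ≐ p a ⊗ p a ⊗ f (2 ℕ.* a)
    φ≐ = trans (theta⁺-product 1≈ 1≈ a a) (φ-factors (- 1#))

    φ⁻≐ : ∑ (φ⁻ a) ≐ o a ⊗ o a ⊗ f (2 ℕ.* a)
    φ⁻≐ = trans (theta⁻-product 1≈ 1≈ a a) (φ-factors 1#)

    ψ≐ : ∑ (ψ a) ≐ p a ⊗ f (2 ℕ.* (2 ℕ.* a))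
    ψ≐ = trans (theta⁺-product 1≈ 1≈ (3 ℕ.* a) a) (ψ-factors (- 1#))

    ψ⁻≐ : ∑ (ψ⁻ a) ≐ o a ⊗ f (2 ℕ.* (2 ℕ.* a))
    ψ⁻≐ = trans (theta⁻-product 1≈ 1≈ (3 ℕ.* a) a) (ψ-factors 1#)

    -- Gauss's product ψ(q) = f₂²/f₁ at q^a, cleared of its denominator.
    ψ⊗f : ∑ (ψ a) ⊗ f a ≐ f (2 ℕ.* a) ⊗ f (2 ℕ.* a)
    ψ⊗f = begin
      ∑ (ψ a) ⊗ f a
        ≈⟨ *-cong ψ≐ (f≐o⊗f a) ⟩
      (p a ⊗ f (2 ℕ.* (2 ℕ.* a))) ⊗ (o a ⊗ f (2 ℕ.* a))
        ≈⟨ solve 4 (λ p f₄ o f₂ → (p ∙ f₄) ∙ (o ∙ f₂) ⊜ ((p ∙ o) ∙ f₄) ∙ f₂) refl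
             (p a) (f (2 ℕ.* (2 ℕ.* a))) (o a) (f (2 ℕ.* a)) ⟩
      p a ⊗ o a ⊗ f (2 ℕ.* (2 ℕ.* a)) ⊗ f (2 ℕ.* a)
        ≈⟨ *-congʳ (trans (*-congʳ (p⊗o a)) (sym (f≐o⊗f (2 ℕ.* a)))) ⟩
      f (2 ℕ.* a) ⊗ f (2 ℕ.* a) ∎

  -- That is, α = f₄ f₆²/(f₂ f₁₂). Of (-q²; q²)_∞, `α` contains the residues 2 and 4 modulo 6, and
  -- the rest is `g 6`.
  α⊗f⊗f : f 4 ⊗ (f 6 ⊗ f 6) ≐ f 2 ⊗ (∑ α ⊗ f 12)
  α⊗f⊗f = begin
    f 4 ⊗ (f 6 ⊗ f 6)
      ≈⟨ *-congʳ (f⊗g 2) ⟨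
    f 2 ⊗ g 2 ⊗ (f 6 ⊗ f 6)
      ≈⟨ *-congʳ (*-congˡ (Poch-split₃ (- 1#) 2 2)) ⟩
    f 2 ⊗ (g₂ ⊗ g₄ ⊗ g 6) ⊗ (f 6 ⊗ f 6)
      ≈⟨ solve 5 (λ f₂ g₂ g₄ g₆ f₆ → (f₂ ∙ ((g₂ ∙ g₄) ∙ g₆)) ∙ (f₆ ∙ f₆)
                   ⊜ f₂ ∙ (((g₂ ∙ g₄) ∙ f₆) ∙ (f₆ ∙ g₆))) refl (f 2) g₂ g₄ (g 6) (f 6) ⟩
    f 2 ⊗ (g₂ ⊗ g₄ ⊗ f 6 ⊗ (f 6 ⊗ g 6))
      ≈⟨ *-congˡ (*-cong (theta⁺-product 1≈ 1≈ 2 4) (sym (f⊗g 6))) ⟨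
    f 2 ⊗ (∑ α ⊗ f 12) ∎
    where
    g₂ = Poch (- 1#) 2 6
    g₄ = Poch (- 1#) 4 6

  -- `β` contains the residues 1 and 5 modulo 6 of (-q; q²)_∞. The missing residue 3 is extracted
  -- from `f 12` through `o 12 = p 6 ⊗ p 3 ⊗ o 3`.
  β⊗f : ∑ β ⊗ f 12 ≐ p 1 ⊗ p 6 ⊗ f 24 ⊗ f 3
  β⊗f = begin
    ∑ β ⊗ f 12
      ≈⟨ *-cong (theta⁺-product 1≈ 1≈ 5 1) (f≐o⊗f 12) ⟩
    (p₅ ⊗ p₁ ⊗ f 6) ⊗ (o 12 ⊗ f 24)
      ≈⟨ *-congˡ (*-congʳ (trans (sym (p⊗o 6)) (*-congˡ (sym (p⊗o 3))))) ⟩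
    (p₅ ⊗ p₁ ⊗ f 6) ⊗ (p 6 ⊗ (p 3 ⊗ o 3) ⊗ f 24)
      ≈⟨ solve 7 (λ p₁ p₃ p₅ p₆ o₃ f₆ f₂₄ → ((p₅ ∙ p₁) ∙ f₆) ∙ ((p₆ ∙ (p₃ ∙ o₃)) ∙ f₂₄)
                   ⊜ ((((p₁ ∙ p₃) ∙ p₅) ∙ p₆) ∙ f₂₄) ∙ (o₃ ∙ f₆))
           refl p₁ (p 3) p₅ (p 6) (o 3) (f 6) (f 24) ⟩
    p₁ ⊗ p 3 ⊗ p₅ ⊗ p 6 ⊗ f 24 ⊗ (o 3 ⊗ f 6)
      ≈⟨ *-cong (*-congʳ (*-congʳ (Poch-split₃ (- 1#) 1 2))) (f≐o⊗f 3) ⟨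
    p 1 ⊗ p 6 ⊗ f 24 ⊗ f 3 ∎
    where
    p₁ = Poch (- 1#) 1 6
    p₅ = Poch (- 1#) 5 6

  -- Matches the coefficients of `S₀` in `U₂W`. Both sides are f₂ f₄ f₆⁵/f₁₂².
  even-identity : ∑ (ψ 2) ⊗ ∑ (φ 3) ⊗ ∑ (φ⁻ 2) ⊗ (f 3 ⊗ f 3) ≐
                  (f 2 ⊗ f 2 ⊗ f 6) ⊗ (∑ α ⊗ ∑ (φ⁻ 6))
  even-identity = begin
    ∑ (ψ 2) ⊗ ∑ (φ 3) ⊗ ∑ (φ⁻ 2) ⊗ (f 3 ⊗ f 3)
      ≈⟨ *-cong (*-cong (*-cong (ψ≐ 2) (φ≐ 3)) (φ⁻≐ 2)) (*-cong (f≐o⊗f 3) (f≐o⊗f 3)) ⟩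
    (p 2 ⊗ f 8) ⊗ (p 3 ⊗ p 3 ⊗ f 6) ⊗ (o 2 ⊗ o 2 ⊗ f 4) ⊗ ((o 3 ⊗ f 6) ⊗ (o 3 ⊗ f 6))
      ≈⟨ solve 7 (λ p₂ f₈ p₃ f₆ o₂ f₄ o₃ →
           (((p₂ ∙ f₈) ∙ ((p₃ ∙ p₃) ∙ f₆)) ∙ ((o₂ ∙ o₂) ∙ f₄)) ∙ ((o₃ ∙ f₆) ∙ (o₃ ∙ f₆))
           ⊜ ((((p₂ ∙ o₂) ∙ f₈) ∙ (o₂ ∙ f₄)) ∙ (f₆ ∙ ((p₃ ∙ o₃) ∙ (p₃ ∙ o₃)))) ∙ (f₆ ∙ f₆))
           refl (p 2) (f 8) (p 3) (f 6) (o 2) (f 4) (o 3) ⟩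
    (p 2 ⊗ o 2 ⊗ f 8) ⊗ (o 2 ⊗ f 4) ⊗ (f 6 ⊗ ((p 3 ⊗ o 3) ⊗ (p 3 ⊗ o 3))) ⊗ (f 6 ⊗ f 6)
      ≈⟨ *-congʳ (*-cong (*-cong (trans (*-congʳ (p⊗o 2)) (sym (f≐o⊗f 4))) (sym (f≐o⊗f 2)))
                         (*-congˡ (*-cong (p⊗o 3) (p⊗o 3)))) ⟩
    f 4 ⊗ f 2 ⊗ (f 6 ⊗ (o 6 ⊗ o 6)) ⊗ (f 6 ⊗ f 6)
      ≈⟨ solve 4 (λ f₂ f₄ f₆ o₆ → ((f₄ ∙ f₂) ∙ (f₆ ∙ (o₆ ∙ o₆))) ∙ (f₆ ∙ f₆)
                   ⊜ ((f₂ ∙ f₆) ∙ (o₆ ∙ o₆)) ∙ (f₄ ∙ (f₆ ∙ f₆))) refl (f 2) (f 4) (f 6) (o 6) ⟩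
    f 2 ⊗ f 6 ⊗ (o 6 ⊗ o 6) ⊗ (f 4 ⊗ (f 6 ⊗ f 6))
      ≈⟨ *-congˡ α⊗f⊗f ⟩
    f 2 ⊗ f 6 ⊗ (o 6 ⊗ o 6) ⊗ (f 2 ⊗ (∑ α ⊗ f 12))
      ≈⟨ solve 5 (λ f₂ f₆ o₆ a f₁₂ → ((f₂ ∙ f₆) ∙ (o₆ ∙ o₆)) ∙ (f₂ ∙ (a ∙ f₁₂))
                   ⊜ ((f₂ ∙ f₂) ∙ f₆) ∙ (a ∙ ((o₆ ∙ o₆) ∙ f₁₂)))
           refl (f 2) (f 6) (o 6) (∑ α) (f 12) ⟩
    (f 2 ⊗ f 2 ⊗ f 6) ⊗ (∑ α ⊗ (o 6 ⊗ o 6 ⊗ f 12))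
      ≈⟨ *-congˡ (*-congˡ (φ⁻≐ 6)) ⟨
    (f 2 ⊗ f 2 ⊗ f 6) ⊗ (∑ α ⊗ ∑ (φ⁻ 6)) ∎

  -- Matches the coefficients of `S₊` plus `S₋` in `U₂W`. Both sides are f₂⁴ f₃² f₁₂²/(f₁ f₄ f₆).
  odd-identity : ∑ (φ 1) ⊗ ∑ (ψ 6) ⊗ ∑ (ψ⁻ 1) ⊗ (f 3 ⊗ f 3) ≐
                 (f 2 ⊗ f 2 ⊗ f 6) ⊗ (∑ β ⊗ ∑ (ψ⁻ 3))
  odd-identity = begin
    ∑ (φ 1) ⊗ ∑ (ψ 6) ⊗ ∑ (ψ⁻ 1) ⊗ (f 3 ⊗ f 3)
      ≈⟨ *-cong (*-cong (*-cong (φ≐ 1) (ψ≐ 6)) (ψ⁻≐ 1)) (*-congˡ (f≐o⊗f 3)) ⟩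
    (p 1 ⊗ p 1 ⊗ f 2) ⊗ (p 6 ⊗ f 24) ⊗ (o 1 ⊗ f 4) ⊗ (f 3 ⊗ (o 3 ⊗ f 6))
      ≈⟨ solve 9 (λ p₁ f₂ p₆ f₂₄ o₁ f₄ f₃ o₃ f₆ →
           ((((p₁ ∙ p₁) ∙ f₂) ∙ (p₆ ∙ f₂₄)) ∙ (o₁ ∙ f₄)) ∙ (f₃ ∙ (o₃ ∙ f₆))
           ⊜ ((f₂ ∙ ((p₁ ∙ o₁) ∙ f₄)) ∙ f₆) ∙ ((((p₁ ∙ p₆) ∙ f₂₄) ∙ f₃) ∙ o₃))
           refl (p 1) (f 2) (p 6) (f 24) (o 1) (f 4) (f 3) (o 3) (f 6) ⟩
    f 2 ⊗ (p 1 ⊗ o 1 ⊗ f 4) ⊗ f 6 ⊗ (p 1 ⊗ p 6 ⊗ f 24 ⊗ f 3 ⊗ o 3)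
      ≈⟨ *-cong (*-congʳ (*-congˡ (trans (*-congʳ (p⊗o 1)) (sym (f≐o⊗f 2))))) (*-congʳ (sym β⊗f)) ⟩
    f 2 ⊗ f 2 ⊗ f 6 ⊗ (∑ β ⊗ f 12 ⊗ o 3)
      ≈⟨ *-congˡ (solve 3 (λ b f₁₂ o₃ → (b ∙ f₁₂) ∙ o₃ ⊜ b ∙ (o₃ ∙ f₁₂)) refl (∑ β) (f 12) (o 3)) ⟩
    f 2 ⊗ f 2 ⊗ f 6 ⊗ (∑ β ⊗ (o 3 ⊗ f 12))
      ≈⟨ *-congˡ (*-congˡ (ψ⁻≐ 3)) ⟨
    (f 2 ⊗ f 2 ⊗ f 6) ⊗ (∑ β ⊗ ∑ (ψ⁻ 3)) ∎

  -- `B` is the part of the series that contains X. `V K` carries the factors of residue 3 modulo 6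
  -- that `B` lacks, with X of either sign.
  B K P : PowerSeries
  B = Poch X 1 3 ⊗ (Poch X⁻¹ 2 3 ⊗ (Poch X 2 3 ⊗ Poch X⁻¹ 1 3))
  K = Poch (X R.* X) 3 6 ⊗ Poch (X⁻¹ R.* X⁻¹) 3 6 ⊗ (f 3 ⊗ f 3)
  P = ∑ A ⊗ ∑ A′

  P≐ : P ≐ B ⊗ (f 3 ⊗ f 3)
  P≐ = trans (*-cong (theta⁻-product X≈ X⁻¹≈ 1 2) (theta⁻-product X⁻¹≈ X≈ 1 2))
    (solve 5 (λ a b c d f₃ → ((a ∙ b) ∙ f₃) ∙ ((d ∙ c) ∙ f₃) ⊜ (a ∙ (b ∙ (c ∙ d))) ∙ (f₃ ∙ f₃))
           refl (Poch X 1 3) (Poch X⁻¹ 2 3) (Poch X 2 3) (Poch X⁻¹ 1 3) (f 3))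

  θ≐ : ∑ θ ≐ Poch (X R.* X) 3 6 ⊗ Poch (X⁻¹ R.* X⁻¹) 3 6 ⊗ f 6
  θ≐ = theta⁻-product X²≈ X⁻²≈ 3 3

  K⊗f : K ⊗ f 6 ≐ ∑ θ ⊗ (f 3 ⊗ f 3)
  K⊗f = trans (solve 3 (λ z f₃ f₆ → (z ∙ (f₃ ∙ f₃)) ∙ f₆ ⊜ (z ∙ f₆) ∙ (f₃ ∙ f₃)) refl _ (f 3) (f 6))
              (*-congʳ (sym θ≐))

  V-f : ∀ a .{{_ : NonZero a}} .{{_ : NonZero (2 ℕ.* a)}} → V (f a) ≐ f (2 ℕ.* a)
  V-f a = V-Poch 1# a a

  VK≐ : V K ≐ (Poch X 3 6 ⊗ Poch X⁻¹ 3 6) ⊗ (Poch (- X) 3 6 ⊗ Poch (- X⁻¹) 3 6) ⊗ (f 6 ⊗ f 6)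
  VK≐ = begin
    V K
      ≈⟨ trans (V-⊗ _ _) (*-cong (trans (V-⊗ _ _) (*-cong (V-Poch _ 3 6) (V-Poch _ 3 6)))
                                 (trans (V-⊗ _ _) (*-cong (V-f 3) (V-f 3)))) ⟩
    Poch (X R.* X) 6 12 ⊗ Poch (X⁻¹ R.* X⁻¹) 6 12 ⊗ (f 6 ⊗ f 6)
      ≈⟨ *-congʳ (*-cong (Poch-conjugate X 3 6) (Poch-conjugate X⁻¹ 3 6)) ⟨
    (Poch X 3 6 ⊗ Poch (- X) 3 6) ⊗ (Poch X⁻¹ 3 6 ⊗ Poch (- X⁻¹) 3 6) ⊗ (f 6 ⊗ f 6)
      ≈⟨ *-congʳ (interchange _ _ _ _) ⟩
    (Poch X 3 6 ⊗ Poch X⁻¹ 3 6) ⊗ (Poch (- X) 3 6 ⊗ Poch (- X⁻¹) 3 6) ⊗ (f 6 ⊗ f 6) ∎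
    where
    open import Algebra.Properties.CommutativeSemigroup R⟦q⟧.*-commutativeSemigroup
      using (interchange)

  VB≐ : V B ≐ Poch X 2 6 ⊗ (Poch X⁻¹ 4 6 ⊗ (Poch X 4 6 ⊗ Poch X⁻¹ 2 6))
  VB≐ = trans (V-⊗ _ _) (*-cong (V-Poch X 1 3) (trans (V-⊗ _ _) (*-cong (V-Poch X⁻¹ 2 3)
          (trans (V-⊗ _ _) (*-cong (V-Poch X 2 3) (V-Poch X⁻¹ 1 3))))))

  B-dilation : (Poch X 3 6 ⊗ Poch X⁻¹ 3 6) ⊗ B ≐ V B ⊗ (Poch X 1 2 ⊗ Poch X⁻¹ 1 2)
  B-dilation = begin
    (Poch X 3 6 ⊗ Poch X⁻¹ 3 6) ⊗ B
      ≈⟨ solve 6 (λ a b c d e f → (a ∙ b) ∙ (c ∙ (d ∙ (e ∙ f))) ⊜ (a ∙ (c ∙ e)) ∙ (b ∙ (f ∙ d)))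
           refl (Poch X 3 6) (Poch X⁻¹ 3 6) (Poch X 1 3) (Poch X⁻¹ 2 3) (Poch X 2 3) (Poch X⁻¹ 1 3) ⟩
    (Poch X 3 6 ⊗ (Poch X 1 3 ⊗ Poch X 2 3)) ⊗ (Poch X⁻¹ 3 6 ⊗ (Poch X⁻¹ 1 3 ⊗ Poch X⁻¹ 2 3))
      ≈⟨ *-cong (residues-mod-6 X) (residues-mod-6 X⁻¹) ⟩
    ((Poch X 2 6 ⊗ Poch X 4 6) ⊗ Poch X 1 2) ⊗ ((Poch X⁻¹ 2 6 ⊗ Poch X⁻¹ 4 6) ⊗ Poch X⁻¹ 1 2)
      ≈⟨ solve 6 (λ a b c d e f → ((a ∙ b) ∙ c) ∙ ((d ∙ e) ∙ f) ⊜ (a ∙ (e ∙ (b ∙ d))) ∙ (c ∙ f))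
           refl (Poch X 2 6) (Poch X 4 6) (Poch X 1 2) (Poch X⁻¹ 2 6) (Poch X⁻¹ 4 6) (Poch X⁻¹ 1 2) ⟩
    (Poch X 2 6 ⊗ (Poch X⁻¹ 4 6 ⊗ (Poch X 4 6 ⊗ Poch X⁻¹ 2 6))) ⊗ (Poch X 1 2 ⊗ Poch X⁻¹ 1 2)
      ≈⟨ *-congʳ VB≐ ⟨
    V B ⊗ (Poch X 1 2 ⊗ Poch X⁻¹ 1 2) ∎

  W : PowerSeries
  W = (∑ (ψ 1) ⊗ ∑ (ψ 3)) ⊗ (∑ φX ⊗ ∑ φ₃)

  -- Only the even-even and odd-odd products survive, and q times -q is `V ⟦ -q ⟧`.
  U₂-dissected : ∀ a₀ a₁ b₀ b₁ →
    U₂ ((V a₀ ⊕ ⟦ q ⟧ ⊗ V a₁) ⊗ (V b₀ ⊕ ⟦ -q ⟧ ⊗ V b₁)) ≐ a₀ ⊗ b₀ ⊕ ⟦ -q ⟧ ⊗ (a₁ ⊗ b₁)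
  U₂-dissected a₀ a₁ b₀ b₁ = begin
    U₂ ((V a₀ ⊕ ⟦ q ⟧ ⊗ V a₁) ⊗ b)
      ≈⟨ trans (U₂-cong (R⟦q⟧.distribʳ _ _ _)) (U₂-⊕ _ _) ⟩
    U₂ (V a₀ ⊗ b) ⊕ U₂ (⟦ q ⟧ ⊗ V a₁ ⊗ b)
      ≈⟨ +-cong (U₂-V⊗ _ _) (trans (U₂-cong (solve 3 (λ q a b → q ∙ a ∙ b ⊜ a ∙ (q ∙ b)) refl _ _ _))
                                   (U₂-V⊗ _ _)) ⟩
    a₀ ⊗ U₂ b ⊕ a₁ ⊗ U₂ (⟦ q ⟧ ⊗ b)
      ≈⟨ +-cong (*-congˡ even) (*-congˡ odd) ⟩
    a₀ ⊗ b₀ ⊕ a₁ ⊗ (⟦ -q ⟧ ⊗ b₁)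
      ≈⟨ +-congˡ (solve 3 (λ q a b → a ∙ (q ∙ b) ⊜ q ∙ (a ∙ b)) refl _ _ _) ⟩
    a₀ ⊗ b₀ ⊕ ⟦ -q ⟧ ⊗ (a₁ ⊗ b₁) ∎
    where
    b = V b₀ ⊕ ⟦ -q ⟧ ⊗ V b₁
    even : U₂ b ≐ b₀
    even = begin
      U₂ b                             ≈⟨ U₂-⊕ _ _ ⟩
      U₂ (V b₀) ⊕ U₂ (⟦ -q ⟧ ⊗ V b₁)   ≈⟨ +-cong (U₂-V b₀) (U₂-qV _ b₁) ⟩
      b₀ ⊕ 𝟘                           ≈⟨ R⟦q⟧.+-identityʳ b₀ ⟩
      b₀                               ∎
    odd : U₂ (⟦ q ⟧ ⊗ b) ≐ ⟦ -q ⟧ ⊗ b₁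
    odd = begin
      U₂ (⟦ q ⟧ ⊗ b)
        ≈⟨ trans (U₂-cong (R⟦q⟧.distribˡ _ _ _)) (U₂-⊕ _ _) ⟩
      U₂ (⟦ q ⟧ ⊗ V b₀) ⊕ U₂ (⟦ q ⟧ ⊗ (⟦ -q ⟧ ⊗ V b₁))
        ≈⟨ +-cong (U₂-qV _ b₀) (U₂-cong (trans (sym (R⟦q⟧.*-assoc _ _ _))
             (*-congʳ (trans (⟦⊙⟧ q -q) (sym (V-·q^ _ 1)))))) ⟩
      𝟘 ⊕ U₂ (V ⟦ -q ⟧ ⊗ V b₁)
        ≈⟨ trans (R⟦q⟧.+-identityˡ _) (U₂-V⊗ _ _) ⟩
      ⟦ -q ⟧ ⊗ U₂ (V b₁)
        ≈⟨ *-congˡ (U₂-V b₁) ⟩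
      ⟦ -q ⟧ ⊗ b₁ ∎

  U₂W : f 3 ⊗ f 3 ⊗ U₂ W ≐ (f 2 ⊗ f 2 ⊗ f 6) ⊗ (P ⊗ ∑ θ)
  U₂W = begin
    f₃² ⊗ U₂ W
      ≈⟨ *-congˡ (trans (U₂-cong (*-cong ψψ-dissection φφ-dissection)) (U₂-dissected _ _ _ _)) ⟩
    f₃² ⊗ ((∑ (ψ 2) ⊗ ∑ (φ 3)) ⊗ (∑ S₀ ⊗ ∑ (φ⁻ 2)) ⊕
           ⟦ -q ⟧ ⊗ ((∑ (φ 1) ⊗ ∑ (ψ 6)) ⊗ (S ⊗ ∑ (ψ⁻ 1))))
      ≈⟨ trans (R⟦q⟧.distribˡ _ _ _) (+-cong
           (solve 4 (λ u a s b → u ∙ (a ∙ (s ∙ b)) ⊜ a ∙ b ∙ u ∙ s)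
              refl f₃² (∑ (ψ 2) ⊗ ∑ (φ 3)) (∑ S₀) (∑ (φ⁻ 2)))
           (solve 5 (λ u q a s b → u ∙ (q ∙ (a ∙ (s ∙ b))) ⊜ a ∙ b ∙ u ∙ (q ∙ s))
              refl f₃² ⟦ -q ⟧ (∑ (φ 1) ⊗ ∑ (ψ 6)) S (∑ (ψ⁻ 1)))) ⟩
    (∑ (ψ 2) ⊗ ∑ (φ 3) ⊗ ∑ (φ⁻ 2) ⊗ f₃²) ⊗ ∑ S₀ ⊕
    (∑ (φ 1) ⊗ ∑ (ψ 6) ⊗ ∑ (ψ⁻ 1) ⊗ f₃²) ⊗ (⟦ -q ⟧ ⊗ S)
      ≈⟨ +-cong (*-congʳ even-identity) (*-congʳ odd-identity) ⟩
    (v ⊗ (∑ α ⊗ ∑ (φ⁻ 6))) ⊗ ∑ S₀ ⊕ (v ⊗ (∑ β ⊗ ∑ (ψ⁻ 3))) ⊗ (⟦ -q ⟧ ⊗ S)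
      ≈⟨ +-cong
           (solve 4 (λ v a b s → (v ∙ (a ∙ b)) ∙ s ⊜ v ∙ (a ∙ (s ∙ b)))
              refl v (∑ α) (∑ (φ⁻ 6)) (∑ S₀))
           (solve 5 (λ v a b q s → (v ∙ (a ∙ b)) ∙ (q ∙ s) ⊜ v ∙ (q ∙ (a ∙ (s ∙ b))))
              refl v (∑ β) (∑ (ψ⁻ 3)) ⟦ -q ⟧ S) ⟩
    v ⊗ (∑ α ⊗ (∑ S₀ ⊗ ∑ (φ⁻ 6))) ⊕ v ⊗ (⟦ -q ⟧ ⊗ (∑ β ⊗ (S ⊗ ∑ (ψ⁻ 3))))
      ≈⟨ +-cong (*-congˡ (*-congˡ Θ₀θ-dissection)) (*-congˡ (*-congˡ (*-congˡ Θ₁θ-dissection))) ⟨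
    v ⊗ (∑ α ⊗ (∑ Θ₀ ⊗ ∑ θ)) ⊕ v ⊗ (⟦ -q ⟧ ⊗ (∑ β ⊗ (∑ Θ₁ ⊗ ∑ θ)))
      ≈⟨ +-cong (*-congˡ (R⟦q⟧.*-assoc _ _ _))
           (*-congˡ (solve 4 (λ q a b c → (q ∙ (a ∙ b)) ∙ c ⊜ q ∙ (a ∙ (b ∙ c)))
                       refl ⟦ -q ⟧ (∑ β) (∑ Θ₁) (∑ θ))) ⟨
    v ⊗ ((∑ α ⊗ ∑ Θ₀) ⊗ ∑ θ) ⊕ v ⊗ ((⟦ -q ⟧ ⊗ (∑ β ⊗ ∑ Θ₁)) ⊗ ∑ θ)
      ≈⟨ trans (*-congˡ (R⟦q⟧.distribʳ _ _ _)) (R⟦q⟧.distribˡ _ _ _) ⟨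
    v ⊗ ((∑ α ⊗ ∑ Θ₀ ⊕ ⟦ -q ⟧ ⊗ (∑ β ⊗ ∑ Θ₁)) ⊗ ∑ θ)
      ≈⟨ *-congˡ (*-congʳ AA′-dissection) ⟨
    v ⊗ (P ⊗ ∑ θ) ∎
    where
    f₃² = f 3 ⊗ f 3
    v = f 2 ⊗ f 2 ⊗ f 6
    S = ∑ S₊ ⊕ ∑ S₋

  -- `F` is known only through this equation, which keeps inverse series out of the computation.
  module _ {F : PowerSeries} (F≐ : F ⊗ (f 1 ⊗ f 3) ≐ (f 2 ⊗ f 6) ⊗ B) where

    F-dilation : V (f 1 ⊗ f 2 ⊗ f 6 ⊗ K) ⊗ F ≐ V (f 3 ⊗ F) ⊗ W
    -- In `u`, the factor `f 1 ⊗ f 3` clears the denominator of `F` on the left and those of ψ(q)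
    -- and ψ(q³) on the right; `f 2 ⊗ f 6` clears that of `V F`.
    F-dilation = unit-cancelˡ u₀ (begin
      u ⊗ (V (f 1 ⊗ f 2 ⊗ f 6 ⊗ K) ⊗ F)
        ≈⟨ *-congˡ (*-congʳ (trans (V-⊗ _ _) (*-cong (trans (V-⊗ _ _) (*-cong (trans (V-⊗ _ _)
             (*-cong (V-f 1) (V-f 2))) (V-f 6))) VK≐))) ⟩
      u ⊗ (f 2 ⊗ f 4 ⊗ f 12 ⊗ (z ⊗ y ⊗ (f 6 ⊗ f 6)) ⊗ F)
        ≈⟨ solve 9 (λ f₁ f₂ f₃ f₄ f₆ f₁₂ z y F →
             ((f₁ ∙ f₃) ∙ (f₂ ∙ f₆)) ∙ ((((f₂ ∙ f₄) ∙ f₁₂) ∙ ((z ∙ y) ∙ (f₆ ∙ f₆))) ∙ F)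
             ⊜ ((f₂ ∙ f₂) ∙ (f₄ ∙ f₁₂) ∙ (f₆ ∙ (f₆ ∙ f₆)) ∙ (y ∙ z)) ∙ (F ∙ (f₁ ∙ f₃)))
             refl (f 1) (f 2) (f 3) (f 4) (f 6) (f 12) z y F ⟩
      (f 2 ⊗ f 2 ⊗ (f 4 ⊗ f 12) ⊗ (f 6 ⊗ (f 6 ⊗ f 6)) ⊗ (y ⊗ z)) ⊗ (F ⊗ (f 1 ⊗ f 3))
        ≈⟨ *-congˡ F≐ ⟩
      (f 2 ⊗ f 2 ⊗ (f 4 ⊗ f 12) ⊗ (f 6 ⊗ (f 6 ⊗ f 6)) ⊗ (y ⊗ z)) ⊗ ((f 2 ⊗ f 6) ⊗ B)
        ≈⟨ solve 7 (λ f₂ f₄ f₆ f₁₂ z y B →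
             ((f₂ ∙ f₂) ∙ (f₄ ∙ f₁₂) ∙ (f₆ ∙ (f₆ ∙ f₆)) ∙ (y ∙ z)) ∙ ((f₂ ∙ f₆) ∙ B)
             ⊜ (f₂ ∙ (f₂ ∙ f₂) ∙ (f₄ ∙ f₁₂) ∙ ((f₆ ∙ f₆) ∙ (f₆ ∙ f₆)) ∙ y) ∙ (z ∙ B))
             refl (f 2) (f 4) (f 6) (f 12) z y B ⟩
      (f 2 ⊗ (f 2 ⊗ f 2) ⊗ (f 4 ⊗ f 12) ⊗ ((f 6 ⊗ f 6) ⊗ (f 6 ⊗ f 6)) ⊗ y) ⊗ (z ⊗ B)
        ≈⟨ *-congˡ B-dilation ⟩
      (f 2 ⊗ (f 2 ⊗ f 2) ⊗ (f 4 ⊗ f 12) ⊗ ((f 6 ⊗ f 6) ⊗ (f 6 ⊗ f 6)) ⊗ y) ⊗ (V B ⊗ x)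
        ≈⟨ solve 7 (λ f₂ f₄ f₆ f₁₂ x y VB →
             (f₂ ∙ (f₂ ∙ f₂) ∙ (f₄ ∙ f₁₂) ∙ ((f₆ ∙ f₆) ∙ (f₆ ∙ f₆)) ∙ y) ∙ (VB ∙ x)
             ⊜ f₆ ∙ ((f₄ ∙ f₁₂) ∙ VB) ∙ (((f₂ ∙ f₂) ∙ (f₆ ∙ f₆)) ∙ ((x ∙ f₂) ∙ (y ∙ f₆))))
             refl (f 2) (f 4) (f 6) (f 12) x y (V B) ⟩
      f 6 ⊗ ((f 4 ⊗ f 12) ⊗ V B) ⊗ (((f 2 ⊗ f 2) ⊗ (f 6 ⊗ f 6)) ⊗ ((x ⊗ f 2) ⊗ (y ⊗ f 6)))
        ≈⟨ *-cong (*-congˡ VF≐) (*-cong (*-cong (ψ⊗f 1) (ψ⊗f 3))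
             (*-cong (theta⁻-product X≈ X⁻¹≈ 1 1) (theta⁺-product X≈ X⁻¹≈ 3 3))) ⟨
      f 6 ⊗ (V F ⊗ (f 2 ⊗ f 6)) ⊗ ((∑ (ψ 1) ⊗ f 1) ⊗ (∑ (ψ 3) ⊗ f 3) ⊗ (∑ φX ⊗ ∑ φ₃))
        ≈⟨ solve 8 (λ f₁ f₂ f₃ f₆ VF ψ₁ ψ₃ φφ →
             (f₆ ∙ (VF ∙ (f₂ ∙ f₆))) ∙ (((ψ₁ ∙ f₁) ∙ (ψ₃ ∙ f₃)) ∙ φφ)
             ⊜ ((f₁ ∙ f₃) ∙ (f₂ ∙ f₆)) ∙ ((f₆ ∙ VF) ∙ ((ψ₁ ∙ ψ₃) ∙ φφ)))
             refl (f 1) (f 2) (f 3) (f 6) (V F) (∑ (ψ 1)) (∑ (ψ 3)) (∑ φX ⊗ ∑ φ₃) ⟩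
      u ⊗ (f 6 ⊗ V F ⊗ W)
        ≈⟨ *-congˡ (*-congʳ (trans (V-⊗ _ _) (*-congʳ (V-f 3)))) ⟨
      u ⊗ (V (f 3 ⊗ F) ⊗ W) ∎)
      where
      u = (f 1 ⊗ f 3) ⊗ (f 2 ⊗ f 6)
      x = Poch X 1 2 ⊗ Poch X⁻¹ 1 2
      y = Poch (- X) 3 6 ⊗ Poch (- X⁻¹) 3 6
      z = Poch X 3 6 ⊗ Poch X⁻¹ 3 6
      u₀ : Unit u
      u₀ = ⊗-unit (⊗-unit (Poch-unit 1# 1 1) (Poch-unit 1# 3 3))
                  (⊗-unit (Poch-unit 1# 2 2) (Poch-unit 1# 6 6))
      VF≐ : V F ⊗ (f 2 ⊗ f 6) ≐ (f 4 ⊗ f 12) ⊗ V B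
      VF≐ = begin
        V F ⊗ (f 2 ⊗ f 6)        ≈⟨ *-congˡ (trans (V-⊗ _ _) (*-cong (V-f 1) (V-f 3))) ⟨
        V F ⊗ V (f 1 ⊗ f 3)      ≈⟨ V-⊗ _ _ ⟨
        V (F ⊗ (f 1 ⊗ f 3))      ≈⟨ V-cong F≐ ⟩
        V ((f 2 ⊗ f 6) ⊗ B)      ≈⟨ V-⊗ _ _ ⟩
        V (f 2 ⊗ f 6) ⊗ V B      ≈⟨ *-congʳ (trans (V-⊗ _ _) (*-cong (V-f 2) (V-f 6))) ⟩
        (f 4 ⊗ f 12) ⊗ V B       ∎

    U₂F : U₂ F ≐ F ⊗ F
    -- In `u`, `θ` and two factors `f 3` make `K ⊗ f 6`, which joins `f 1 ⊗ f 2` to form the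
    -- argument of `V` in `F-dilation`. The third `f 3` pairs with the one from `V (f 3 ⊗ F)` to
    -- meet `U₂W`.
    U₂F = unit-cancelˡ u₀ (begin
      u ⊗ U₂ F
        ≈⟨ solve 5 (λ f₁ f₂ f₃ θ UF → (((f₁ ∙ f₂) ∙ (f₃ ∙ (f₃ ∙ f₃))) ∙ θ) ∙ UF
                     ⊜ (f₁ ∙ f₂) ∙ (f₃ ∙ (θ ∙ (f₃ ∙ f₃))) ∙ UF) refl (f 1) (f 2) (f 3) (∑ θ) (U₂ F) ⟩
      f 1 ⊗ f 2 ⊗ (f 3 ⊗ (∑ θ ⊗ (f 3 ⊗ f 3))) ⊗ U₂ F
        ≈⟨ *-congʳ (*-congˡ (*-congˡ K⊗f)) ⟨
      f 1 ⊗ f 2 ⊗ (f 3 ⊗ (K ⊗ f 6)) ⊗ U₂ F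
        ≈⟨ solve 6 (λ f₁ f₂ f₃ f₆ K UF → ((f₁ ∙ f₂) ∙ (f₃ ∙ (K ∙ f₆))) ∙ UF
                     ⊜ f₃ ∙ ((((f₁ ∙ f₂) ∙ f₆) ∙ K) ∙ UF)) refl (f 1) (f 2) (f 3) (f 6) K (U₂ F) ⟩
      f 3 ⊗ ((f 1 ⊗ f 2 ⊗ f 6 ⊗ K) ⊗ U₂ F)
        -- `U₂` strips the dilation from the first factor on each side of `F-dilation`. This leaves
        -- one undilated `F` beside `U₂ W`; the second `F` of the square arises from the numerator
        -- `P`.
        ≈⟨ *-congˡ (trans (sym (U₂-V⊗ _ _)) (trans (U₂-cong F-dilation) (U₂-V⊗ _ _))) ⟩
      f 3 ⊗ ((f 3 ⊗ F) ⊗ U₂ W)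
        ≈⟨ solve 3 (λ f₃ F UW → f₃ ∙ ((f₃ ∙ F) ∙ UW) ⊜ F ∙ ((f₃ ∙ f₃) ∙ UW)) refl (f 3) F (U₂ W) ⟩
      F ⊗ (f 3 ⊗ f 3 ⊗ U₂ W)
        ≈⟨ *-congˡ (trans U₂W (*-congˡ (*-congʳ P≐))) ⟩
      F ⊗ ((f 2 ⊗ f 2 ⊗ f 6) ⊗ ((B ⊗ (f 3 ⊗ f 3)) ⊗ ∑ θ))
        ≈⟨ solve 6 (λ f₂ f₃ f₆ F B θ → F ∙ (((f₂ ∙ f₂) ∙ f₆) ∙ ((B ∙ (f₃ ∙ f₃)) ∙ θ))
                     ⊜ (f₂ ∙ (f₃ ∙ f₃) ∙ θ ∙ F) ∙ ((f₂ ∙ f₆) ∙ B)) refl (f 2) (f 3) (f 6) F B (∑ θ) ⟩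
      (f 2 ⊗ (f 3 ⊗ f 3) ⊗ ∑ θ ⊗ F) ⊗ ((f 2 ⊗ f 6) ⊗ B)
        ≈⟨ *-congˡ F≐ ⟨
      (f 2 ⊗ (f 3 ⊗ f 3) ⊗ ∑ θ ⊗ F) ⊗ (F ⊗ (f 1 ⊗ f 3))
        ≈⟨ solve 5 (λ f₁ f₂ f₃ F θ → (f₂ ∙ (f₃ ∙ f₃) ∙ θ ∙ F) ∙ (F ∙ (f₁ ∙ f₃))
                     ⊜ (((f₁ ∙ f₂) ∙ (f₃ ∙ (f₃ ∙ f₃))) ∙ θ) ∙ (F ∙ F)) refl (f 1) (f 2) (f 3) F (∑ θ) ⟩
      u ⊗ (F ⊗ F) ∎)
      where
      u = (f 1 ⊗ f 2) ⊗ (f 3 ⊗ (f 3 ⊗ f 3)) ⊗ ∑ θ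
      f₃-unit : Unit (f 3)
      f₃-unit = Poch-unit 1# 3 3
      u₀ : Unit u
      u₀ = ⊗-unit
        (⊗-unit (⊗-unit (Poch-unit 1# 1 1) (Poch-unit 1# 2 2))
                (⊗-unit f₃-unit (⊗-unit f₃-unit f₃-unit)))
        (unit-≐ (sym θ≐) (⊗-unit (⊗-unit (Poch-unit _ 3 6) (Poch-unit _ 3 6)) (Poch-unit 1# 6 6)))

-- Transfer from the opaque operations to those of the statement.

theorem1p2 : ∀ {c ℓ} (R : CommutativeRing c ℓ) →
    let open CommutativeRing R
        open PowerSeries R
    in
    (X X⁻¹ : Carrier) → X * X⁻¹ ≈ 1# →
    let F = ((f 2 ⊛ f 6) ⊘ (f 1 ⊛ f 3))
              ⊛ ⟪ X q^ 1 ∷ X⁻¹ q^ 2 ∷ X q^ 2 ∷ X⁻¹ q^ 1 ∷ [] ⨾q^ 3 ⟫∞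
    in
    U 2 F ≋ F ⊛ F
theorem1p2 R X X⁻¹ XX⁻¹≈1 n = R.trans (R.reflexive (≡.sym (U₂-at F n)))
  (at (R⟦q⟧.trans (U₂F F≐) (R⟦q⟧.sym (⊛≐⊗ R⟦q⟧.refl R⟦q⟧.refl))) n)
  where
  module R = CommutativeRing R
  open PowerSeries R
  open PowerSeriesRing R
  open Products R
  module η = EtaQuotients R
  open EvenPart R X X⁻¹ XX⁻¹≈1 using (B; U₂F)
  open ≐-Reasoning

  B⊛ F : PowerSeries
  B⊛ = ⟪ X q^ 1 ∷ X⁻¹ q^ 2 ∷ X q^ 2 ∷ X⁻¹ q^ 1 ∷ [] ⨾q^ 3 ⟫∞
  F = ((f 2 ⊛ f 6) ⊘ (f 1 ⊛ f 3)) ⊛ B⊛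

  f≐ : ∀ i .{{_ : NonZero i}} → f i ≐ η.f i
  f≐ i = ⟨⟩∞≐Poch R.1# i i

  B≐ : B⊛ ≐ B
  B≐ = ⊛≐⊗ (⟨⟩∞≐Poch X 1 3) (⊛≐⊗ (⟨⟩∞≐Poch X⁻¹ 2 3) (⊛≐⊗ (⟨⟩∞≐Poch X 2 3)
         (R⟦q⟧.trans (⊛≐⊗ (⟨⟩∞≐Poch X⁻¹ 1 3) 𝟙≐𝟏) (R⟦q⟧.*-identityʳ _))))

  F≐ : F ⊗ (η.f 1 ⊗ η.f 3) ≐ (η.f 2 ⊗ η.f 6) ⊗ B
  F≐ = begin
    F ⊗ (η.f 1 ⊗ η.f 3)
      ≈⟨ R⟦q⟧.*-cong (⊛≐⊗ (⊛≐⊗ (⊛≐⊗ (f≐ 2) (f≐ 6)) R⟦q⟧.refl) B≐) (R⟦q⟧.sym (⊛≐⊗ (f≐ 1) (f≐ 3))) ⟩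
    ((η.f 2 ⊗ η.f 6) ⊗ u ⁻¹) ⊗ B ⊗ u
      ≈⟨ solve 4 (λ v i b u → v ∙ i ∙ b ∙ u ⊜ v ∙ (u ∙ i) ∙ b) R⟦q⟧.refl _ _ _ _ ⟩
    (η.f 2 ⊗ η.f 6) ⊗ (u ⊗ u ⁻¹) ⊗ B
      ≈⟨ R⟦q⟧.*-congʳ (R⟦q⟧.trans (R⟦q⟧.*-congˡ (unit-inverse (mk-unit (f⊛f-constant 1 3))))
                                  (R⟦q⟧.*-identityʳ _)) ⟩
    (η.f 2 ⊗ η.f 6) ⊗ B ∎
    where
    open CommutativeMonoidSolver R⟦q⟧.*-commutativeMonoid using (solve; _⊜_)
      renaming (_⊕_ to infixl 7 _∙_)
    u = f 1 ⊛ f 3
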